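{- Let $d \geq 2$ and let $s_{1},\ldots,s_{d} \geq 2$ be integers such that $s_{d} \geq \big((d-1)(s_{1}s_{2}\cdots s_{d-1}-1)\big)!+1$. Then there exist a constant $c>0$ (depending only on $d, s_1,\ldots,s_d$) and arbitrarily large integers $N$ such that there is a $d$-uniform hypergraph $\mathcal{H}$ with $|V(\mathcal{H})|=N$ that contains no copy of $K_{s_{1},\ldots,s_{d}}^{(d)}$ and satisfies $$|E(\mathcal{H})| \geq c\, N^{d-\frac{1}{s_{1}\cdots s_{d-1}}}.$$
   Context: $K_{s_{1},\ldots,s_{d}}^{(d)}$ denotes the complete $d$-partite $d$-uniform hypergraph with parts of sizes $s_1,\ldots,s_d$ (vertex sets $V_1,\ldots,V_d$ with $|V_i|=s_i$, and all $d$-sets containing exactly one vertex from each $V_i$ as hyperedges). The paper states the conclusion as $|E(\mathcal H)|=\Omega(N^{d-1/(s_1\cdots s_{d-1})})$. -}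

module Defs where

open import Data.Nat using (ℕ; zero; suc; _*_)
open import Data.Fin using (Fin; zero; suc)
open import Data.Fin.Subset using (Subset; _∈_; ∣_∣)
open import Data.List using (List; length)
open import Data.List.Relation.Unary.All using (All)
open import Data.List.Relation.Unary.Unique.Propositional using (Unique)
import Data.List.Membership.Propositional as LMem
open import Data.Product using (Σ; ∃; _×_)
open import Function.Bundles using (_⇔_)
open import Relation.Binary.PropositionalEquality using (_≡_)

prodFin : (k : ℕ) → (Fin k → ℕ) → ℕ
prodFin zero    f = 1
prodFin (suc k) f = f zero * prodFin k (λ i → f (suc i))

record UniformHypergraph (d N : ℕ) : Set where
  field
    edges    : List (Subset N)
    distinct : Unique edges
    uniform  : All (λ e → ∣ e ∣ ≡ d) edges

open UniformHypergraph public

numEdges : ∀ {d N} → UniformHypergraph d N → ℕ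
numEdges H = length (edges H)

-- H contains a copy of K^{(d)}_{s_1,...,s_d}: an injective embedding of the
-- vertex set V_1 ⊔ ... ⊔ V_d (|V_i| = s i) into Fin N such that every d-set
-- with exactly one vertex from each V_i is mapped onto an edge of H.
ContainsCompletePartite : ∀ {d N} → (s : Fin d → ℕ) → UniformHypergraph d N → Set
ContainsCompletePartite {d} {N} s H =
  Σ ((i : Fin d) → Fin (s i) → Fin N) λ f →
    (∀ i j (a : Fin (s i)) (b : Fin (s j)) → f i a ≡ f j b →
       Σ (i ≡ j) λ { _≡_.refl → a ≡ b })
    × (∀ (x : (i : Fin d) → Fin (s i)) →
         ∃ λ e → e LMem.∈ edges H × (∀ v → (v ∈ e) ⇔ (∃ λ i → f i (x i) ≡ v)))

{-# OPTIONS --safe #-}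
-- The vertices of a part are the pairs (x, y) with x in K = F_Q, Q = q^m, m = s₁⋯s_k - 1, and y a
-- unit of F_q; here d = k + 1 and q is a power of 2.  Let L be the extension of K of degree k and
-- choose ω₀, …, ω_k in L any k of which are independent over K.  The edges are the d-tuples with
-- N(ω₀x₀ + ⋯ + ω_k x_k) = y₀⋯y_k, where N is the norm from L to F_q.
--
-- In a copy of the complete d-partite hypergraph, the class of size s_d yields solutions of m + 1
-- equations N(x + C_i) = c_i y, with distinct C_i in L by independence.  Over L each equation is a
-- product of polynomials of degree k in the conjugates x^(q^l), l < m.  If no two C_i are
-- conjugate over K, these polynomials are coprime, and a Sylvester-type elimination shows that
-- there are at most m! k^m ≤ (k m)! solutions: dividing by a power of x - C₀, all functions on
-- the solution set lie in a space of that dimension.  To exclude conjugate C_i, every element of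
-- L gets a label in such a way that distinct conjugates have different labels, and only the edges with
-- the most popular vector of labels are kept.
--
-- The field with 2^N elements is obtained from the group ring of ℤ/(2^N - 1) over F₂, in which
-- a^(2^N) = a, as the component of a minimal idempotent on which the generator has full order.

module Submission where

open import Defs
open import Algebra.Bundles using (CommutativeSemiring; RawRing)
open import Algebra.Core using (Op₂)
import Algebra.Properties.CommutativeSemiring.Exp as Exp
import Algebra.Solver.Ring
import Algebra.Solver.Ring.AlmostCommutativeRing as ACR
open import Algebra.Structures using (IsCommutativeMonoid; IsCommutativeSemiring)
import Algebra.Structures.Biased as Biased
open import Data.Bool.Base using (Bool; false; true; _xor_; _∧_)
import Data.Bool.Properties as Bool
open import Data.Empty using (⊥; ⊥-elim)
open import Data.Fin.Base as Fin using (Fin; zero; suc; inject₁; fromℕ; punchIn; punchOut; remQuot; combine)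
open import Data.Fin.Permutation using (Permutation; permutation)
import Data.Fin.Properties as Fin
open import Data.Fin.Subset using (Subset; ⁅_⁆; inside; outside) renaming (_∈_ to _∈ₛ_; ∣_∣ to card)
open import Data.Fin.Subset.Properties using (x∈⁅x⁆; x∈⁅y⁆⇒x≡y; ∣⁅x⁆∣≡1)
open import Data.List.Base as List using (List; []; _∷_; _++_; allFin; concatMap; filter; length; map; tabulate; upTo)
import Data.List.Properties as List
open import Data.List.Properties using (length-++; length-map; length-tabulate)
open import Data.List.Membership.Propositional using (_∈_; _∉_)
open import Data.List.Membership.Propositional.Properties using (∈-++⁺ˡ; ∈-++⁺ʳ; ∈-++⁻; ∈-filter⁺; ∈-map⁺; ∈-map⁻; ∈-tabulate⁻; ∈-upTo⁺)
open import Data.List.Relation.Unary.All as All using (All; []; _∷_)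
import Data.List.Relation.Unary.All.Properties as All
open import Data.List.Relation.Unary.AllPairs using ([]; _∷_)
open import Data.List.Relation.Unary.Any using (here; there; _─_)
open import Data.List.Relation.Unary.Unique.Propositional using (Unique)
import Data.List.Relation.Unary.Unique.Propositional.Properties as Unique
open import Data.Maybe.Base using (just; nothing)
open import Data.Nat.Base as ℕ using (ℕ; zero; suc; z≤n; s≤s; _%_; _/_; _!; NonZero)
import Data.Nat.DivMod as ℕ
open import Data.Nat.Divisibility using (_∣_; divides; _∣?_; ∣m∣n⇒∣m+n; ∣m+n∣m⇒∣n; ∣n⇒∣m*n; *-cancelʳ-∣; ∣⇒≤; m%n≡0⇒n∣m; n∣m⇒m%n≡0; m∣m*n; n∣m*n; ∣-refl)
open import Data.Nat.GCD using (gcd; gcd[m,n]∣m; gcd[m,n]∣n; gcd-GCD; module Bézout)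
open import Data.Nat.ListAction using (product)
open import Data.Nat.Primality using (Prime; prime?; prime⇒irreducible; prime⇒nonZero; prime⇒nonTrivial; euclidsLemma)
open import Data.Nat.Primality.Factorisation using (factorise)
import Data.Nat.Properties as ℕ
open import Data.Product using (Σ; ∃; _×_; _,_; proj₁; proj₂)
open import Data.Sum using (_⊎_; inj₁; inj₂; [_,_]′)
open import Data.Vec.Base using ([]; _∷_) renaming (_++_ to _++ᵥ_)
open import Data.Vec.Functional using (insertAt)
open import Data.Vec.Functional.Properties using (insertAt-lookup; insertAt-punchIn)
open import Data.Vec.Properties using ([]=⇒lookup; lookup⇒[]=; lookup-++ˡ; lookup-++ʳ)
open import Function.Base using (id)
open import Function.Bundles using (Equivalence; mk⇔)
open import Level using (0ℓ)
open import Relation.Binary.Definitions using (Decidable; DecidableEquality; WeaklyDecidable; tri<; tri≈; tri>)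
open import Relation.Binary.PropositionalEquality as ≡ using (_≡_; _≢_; refl; cong; cong₂; subst)
open import Relation.Binary.Structures using (IsEquivalence)
open import Relation.Nullary using (¬_; Dec; does; yes; no)
open import Relation.Nullary.Decidable using (does-⇔; map′; _×-dec_; dec-true; dec-false)

-- The exponents fix the shape. Put `P = m + 1`. A part has about `q^P` vertices, and `k` vertices
-- together with the point of the remaining one determine its unit. So there are about `q^(k P + m)`
-- edges, which is the order `N^(d - 1/P)`. The small classes give `P` equations for the `m`
-- conjugates of `x` and the one further unknown `y`. Treating the conjugates as independent
-- variables forgets how they are related, but allows elimination one variable at a time, with
-- linear algebra on the finite set of solutions in place of intersection theory. Eliminating `y`
-- leaves only proportionalities between products; inverting at a root of one product lowers its
-- degree, and this turns them into reduction rules. A copy may send its large class to any part.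
-- This is why any `k` of the `ω` must be independent and why an edge carries one label for each
-- part. The labels are there because the norm of `x + C` cannot tell `C` from its conjugates;
-- fixing them costs the constant factor `k^d`. Since arbitrarily large `N` suffice, `q` may be
-- restricted to powers of 2, where signs disappear.

-- In characteristic 2 the identity serves as negation, and with coefficients in F₂ the solver
-- knows that x + x ≈ 0.
module Char2Solver (S : CommutativeSemiring 0ℓ 0ℓ)
  (char2 : ∀ x → CommutativeSemiring._≈_ S (CommutativeSemiring._+_ S x x) (CommutativeSemiring.0# S)) where

  open CommutativeSemiring S renaming (refl to ≈-refl)

  almostRing : ACR.AlmostCommutativeRing 0ℓ 0ℓ
  almostRing = record
    { -_ = id
    ; isAlmostCommutativeRing = record
      { isCommutativeSemiring = isCommutativeSemiring
      ; -‿cong = id ; -‿*-distribˡ = λ _ _ → ≈-refl ; -‿+-comm = λ _ _ → ≈-refl } }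

  coefficients : RawRing 0ℓ 0ℓ
  coefficients = record
    { Carrier = Bool ; _≈_ = _≡_ ; _+_ = _xor_ ; _*_ = _∧_ ; -_ = id ; 0# = false ; 1# = true }

  embed : Bool → Carrier
  embed false = 0#
  embed true  = 1#

  morphism : coefficients ACR.-Raw-AlmostCommutative⟶ almostRing
  morphism = record
    { ⟦_⟧ = embed
    ; +-homo = λ { false y → sym (+-identityˡ _)
                 ; true false → sym (+-identityʳ _)
                 ; true true → sym (char2 _) }
    ; *-homo = λ { false y → sym (zeroˡ _) ; true y → sym (*-identityˡ _) }
    ; -‿homo = λ _ → ≈-refl
    ; 0-homo = ≈-refl
    ; 1-homo = ≈-refl }

  _coefficient≟_ : WeaklyDecidable (ACR.Induced-equivalence morphism)
  false coefficient≟ false = just ≈-refl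
  true coefficient≟ true = just ≈-refl
  false coefficient≟ true = nothing
  true coefficient≟ false = nothing

  open Algebra.Solver.Ring coefficients almostRing morphism _coefficient≟_ public

record BinaryField : Set₁ where
  infixl 7 _*_
  infixl 6 _+_
  field
    Carrier : Set
    _+_ _*_ : Op₂ Carrier
    0# 1# : Carrier
    isCommutativeSemiring : IsCommutativeSemiring _≡_ _+_ _*_ 0# 1#
    char2 : ∀ x → x + x ≡ 0#
    _⁻¹ : Carrier → Carrier
    inverseʳ : ∀ {x} → x ≢ 0# → x * x ⁻¹ ≡ 1#
    0≢1 : 0# ≢ 1#
    _≟_ : DecidableEquality Carrier

  commutativeSemiring : CommutativeSemiring 0ℓ 0ℓ
  commutativeSemiring = record { isCommutativeSemiring = isCommutativeSemiring }

-- Polynomials in characteristic 2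

module Char2 (S : CommutativeSemiring 0ℓ 0ℓ)
  (char2 : ∀ x → CommutativeSemiring._≈_ S (CommutativeSemiring._+_ S x x) (CommutativeSemiring.0# S)) where

  open CommutativeSemiring S hiding (zero) renaming (refl to ≈-refl)
  open Char2Solver S char2 using (solve; _:=_; _:+_; _:*_; con)
  open import Algebra.Properties.CommutativeSemiring.Exp S
  open import Relation.Binary.Reasoning.Setoid setoid

  x+y≈0⇒x≈y : ∀ {x y} → x + y ≈ 0# → x ≈ y
  x+y≈0⇒x≈y {x} {y} eq = begin
    x           ≈⟨ solve 2 (λ x y → x := x :+ y :+ y) ≈-refl x y ⟩
    x + y + y   ≈⟨ +-congʳ eq ⟩
    0# + y      ≈⟨ +-identityˡ y ⟩
    y           ∎

  frobenius : ∀ n x y → (x + y) ^ (2 ℕ.^ n) ≈ x ^ (2 ℕ.^ n) + y ^ (2 ℕ.^ n)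
  frobenius zero x y = distribʳ 1# x y
  frobenius (suc n) x y = begin
    (x + y) ^ (2 ℕ.* 2 ℕ.^ n)          ≈⟨ square (x + y) ⟩
    (x + y) ^ q * (x + y) ^ q          ≈⟨ *-cong (frobenius n x y) (frobenius n x y) ⟩
    (x ^ q + y ^ q) * (x ^ q + y ^ q)  ≈⟨ solve 2 (λ a b → (a :+ b) :* (a :+ b) := a :* a :+ b :* b)
                                            ≈-refl (x ^ q) (y ^ q) ⟩
    x ^ q * x ^ q + y ^ q * y ^ q      ≈⟨ +-cong (square x) (square y) ⟨
    x ^ (2 ℕ.* q) + y ^ (2 ℕ.* q)      ∎
    where
    q = 2 ℕ.^ n
    square : ∀ z → z ^ (2 ℕ.* q) ≈ z ^ q * z ^ q
    square z = trans (^-congʳ z (cong (q ℕ.+_) (ℕ.+-identityʳ q))) (^-homo-* z q q)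

  horner : ∀ n → (Fin n → Carrier) → Carrier → Carrier
  horner zero p x = 0#
  horner (suc n) p x = p zero + x * horner n (λ i → p (suc i)) x

  -- Synthetic division by `x + r`: each coefficient is the value at `r` of the part of `p` above
  -- it.
  quotient : ∀ n → (Fin (suc n) → Carrier) → Carrier → Fin n → Carrier
  quotient (suc n) p r zero = horner (suc n) (λ i → p (suc i)) r
  quotient (suc n) p r (suc i) = quotient n (λ i → p (suc i)) r i

  horner-quotient : ∀ n p x r → horner (suc n) p x ≈ horner (suc n) p r + (x + r) * horner n (quotient n p r) x
  horner-quotient zero p x r = solve 3 (λ p x r → p :+ x :* con false := (p :+ r :* con false) :+ (x :+ r) :* con false)
    ≈-refl (p zero) x r
  horner-quotient (suc n) p x r = trans (+-congˡ (*-congˡ (horner-quotient n (λ i → p (suc i)) x r)))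
    (solve 5 (λ p x r h Q → p :+ x :* (h :+ (x :+ r) :* Q) := (p :+ r :* h) :+ (x :+ r) :* (h :+ x :* Q))
      ≈-refl (p zero) x r (horner (suc n) (λ i → p (suc i)) r) (horner n (quotient n (λ i → p (suc i)) r) x))

  horner-zero : ∀ n p x → (∀ i → p i ≈ 0#) → horner n p x ≈ 0#
  horner-zero zero p x _ = ≈-refl
  horner-zero (suc n) p x eq = trans (+-cong (eq zero) (*-congˡ (horner-zero n _ x (λ i → eq (suc i)))))
    (trans (+-identityˡ _) (zeroʳ x))

  horner-constant : ∀ n p x → (∀ i → p (suc i) ≈ 0#) → horner (suc n) p x ≈ p zero
  horner-constant n p x eq = trans (+-congˡ (trans (*-congˡ (horner-zero n _ x eq)) (zeroʳ x))) (+-identityʳ _)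

  quotient-zero : ∀ n p r → (∀ i → quotient n p r i ≈ 0#) → ∀ i → p (suc i) ≈ 0#
  quotient-zero (suc n) p r eq (suc i) = quotient-zero n _ r (λ i → eq (suc i)) i
  quotient-zero (suc n) p r eq zero =
    trans (sym (horner-constant n (λ i → p (suc i)) r (quotient-zero n (λ i → p (suc i)) r (λ i → eq (suc i))))) (eq zero)

  -- Dividing by the linear factor of the first root leaves a quotient that vanishes at the others.
  -- The setting is a ring without zero divisors, since a component of the group ring is treated
  -- before it has become a `BinaryField`.
  rootBound : (∀ {x y} → x * y ≈ 0# → ¬ x ≈ 0# → y ≈ 0#) →
    ∀ n p (r : Fin n → Carrier) → (∀ {i j} → r i ≈ r j → i ≡ j) →
    (∀ i → horner n p (r i) ≈ 0#) → ∀ i → p i ≈ 0#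
  rootBound integral (suc n) p r inj roots = λ { zero → head ; (suc i) → tail i }
    where
    tail : ∀ i → p (suc i) ≈ 0#
    tail = quotient-zero n p (r zero)
      (rootBound integral n (quotient n p (r zero)) (λ i → r (suc i)) (λ eq → Fin.suc-injective (inj eq))
        (λ i → integral (begin
            (r (suc i) + r zero) * horner n (quotient n p (r zero)) (r (suc i))
              ≈⟨ +-identityˡ _ ⟨
            0# + (r (suc i) + r zero) * horner n (quotient n p (r zero)) (r (suc i))
              ≈⟨ +-congʳ (roots zero) ⟨
            horner (suc n) p (r zero) + (r (suc i) + r zero) * horner n (quotient n p (r zero)) (r (suc i))
              ≈⟨ horner-quotient n p (r (suc i)) (r zero) ⟨
            horner (suc n) p (r (suc i))
              ≈⟨ roots (suc i) ⟩
            0# ∎)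
          (λ eq → case (inj {suc i} {zero} (x+y≈0⇒x≈y eq)))))
      where
      case : ∀ {i : Fin n} → suc i ≡ zero → ⊥
      case ()

    head : p zero ≈ 0#
    head = trans (sym (horner-constant n p (r zero) tail)) (roots zero)

-- Construction of the field with 2^N elements

-- The group ring of ℤ/e over F₂: a list of exponents stands for the sum of the corresponding
-- powers of the generator, and δ c extracts the coefficient of the c-th power.
module GroupRing (e' : ℕ) where

  e : ℕ
  e = suc e'

  ⟪_,_⟫ : List ℕ → (ℕ → Bool) → Bool
  ⟪ [] , h ⟫ = false
  ⟪ i ∷ a , h ⟫ = h i xor ⟪ a , h ⟫

  infixl 7 _⊗_
  _⊗_ : List ℕ → List ℕ → List ℕ
  [] ⊗ b = []
  (i ∷ a) ⊗ b = map (i ℕ.+_) b ++ a ⊗ b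

  δ : ℕ → ℕ → Bool
  δ c j = does (j % e ℕ.≟ c % e)

  infix 4 _≈_
  record _≈_ (a b : List ℕ) : Set where
    constructor mk
    field coefficients : ∀ c → ⟪ a , δ c ⟫ ≡ ⟪ b , δ c ⟫
  open _≈_ public

  pair-cong : ∀ a {g h} → (∀ i → g i ≡ h i) → ⟪ a , g ⟫ ≡ ⟪ a , h ⟫
  pair-cong [] eq = refl
  pair-cong (i ∷ a) eq = cong₂ _xor_ (eq i) (pair-cong a eq)

  pair-++ : ∀ a b h → ⟪ a ++ b , h ⟫ ≡ ⟪ a , h ⟫ xor ⟪ b , h ⟫
  pair-++ [] b h = refl
  pair-++ (i ∷ a) b h = ≡.trans (cong (h i xor_) (pair-++ a b h)) (≡.sym (Bool.xor-assoc (h i) _ _))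

  pair-map : ∀ i b h → ⟪ map (i ℕ.+_) b , h ⟫ ≡ ⟪ b , (λ j → h (i ℕ.+ j)) ⟫
  pair-map i [] h = refl
  pair-map i (j ∷ b) h = cong (h (i ℕ.+ j) xor_) (pair-map i b h)

  pair-⊗ : ∀ a b h → ⟪ a ⊗ b , h ⟫ ≡ ⟪ a , (λ i → ⟪ b , (λ j → h (i ℕ.+ j)) ⟫) ⟫
  pair-⊗ [] b h = refl
  pair-⊗ (i ∷ a) b h = ≡.trans (pair-++ (map (i ℕ.+_) b) (a ⊗ b) h) (cong₂ _xor_ (pair-map i b h) (pair-⊗ a b h))

  pair-false : ∀ a → ⟪ a , (λ _ → false) ⟫ ≡ false
  pair-false [] = refl
  pair-false (i ∷ a) = pair-false a

  pair-xor : ∀ a g h → ⟪ a , (λ i → g i xor h i) ⟫ ≡ ⟪ a , g ⟫ xor ⟪ a , h ⟫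
  pair-xor [] g h = refl
  pair-xor (i ∷ a) g h = ≡.trans (cong ((g i xor h i) xor_) (pair-xor a g h)) (interchange (g i) (h i) _ _)
    where
    interchange : ∀ x y z w → (x xor y) xor (z xor w) ≡ (x xor z) xor (y xor w)
    interchange x y z w = ≡.trans (Bool.xor-assoc x y (z xor w)) (≡.trans
      (cong (x xor_) (≡.trans (≡.sym (Bool.xor-assoc y z w)) (≡.trans (cong (_xor w) (Bool.xor-comm y z)) (Bool.xor-assoc z y w))))
      (≡.sym (Bool.xor-assoc x z (y xor w))))

  pair-swap : ∀ a b (g : ℕ → ℕ → Bool) → ⟪ a , (λ i → ⟪ b , g i ⟫) ⟫ ≡ ⟪ b , (λ j → ⟪ a , (λ i → g i j) ⟫) ⟫
  pair-swap [] b g = ≡.sym (pair-false b)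
  pair-swap (i ∷ a) b g = ≡.trans (cong (⟪ b , g i ⟫ xor_) (pair-swap a b g)) (≡.sym (pair-xor b (g i) _))

  -- As `e' ≡ -1` modulo `e`, adding `e' * i` subtracts `i`. Moving a factor of a product into the
  -- functional in this way shows that `⊗` respects `≈`.
  δ-shift : ∀ c i j → δ c (i ℕ.+ j) ≡ δ (c ℕ.+ e' ℕ.* i) j
  δ-shift c i j = does-⇔ (mk⇔ to from) ((i ℕ.+ j) % e ℕ.≟ c % e) (j % e ℕ.≟ (c ℕ.+ e' ℕ.* i) % e)
    where
    open ≡.≡-Reasoning
    to : (i ℕ.+ j) % e ≡ c % e → j % e ≡ (c ℕ.+ e' ℕ.* i) % e
    to eq = begin
      j % e ≡⟨ ℕ.[m+kn]%n≡m%n j i e ⟨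
      (j ℕ.+ i ℕ.* e) % e ≡⟨ cong (_% e) (rearrange i j) ⟩
      (i ℕ.+ j ℕ.+ e' ℕ.* i) % e ≡⟨ ℕ.%-distribˡ-+ (i ℕ.+ j) (e' ℕ.* i) e ⟩
      ((i ℕ.+ j) % e ℕ.+ (e' ℕ.* i) % e) % e ≡⟨ cong (λ r → (r ℕ.+ (e' ℕ.* i) % e) % e) eq ⟩
      (c % e ℕ.+ (e' ℕ.* i) % e) % e ≡⟨ ℕ.%-distribˡ-+ c (e' ℕ.* i) e ⟨
      (c ℕ.+ e' ℕ.* i) % e ∎
      where
      rearrange : ∀ i j → j ℕ.+ i ℕ.* e ≡ i ℕ.+ j ℕ.+ e' ℕ.* i
      rearrange i j = ≡.trans (cong (j ℕ.+_) (ℕ.*-comm i e)) (≡.trans (≡.sym (ℕ.+-assoc j i _)) (cong (ℕ._+ e' ℕ.* i) (ℕ.+-comm j i)))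
    from : j % e ≡ (c ℕ.+ e' ℕ.* i) % e → (i ℕ.+ j) % e ≡ c % e
    from eq = begin
      (i ℕ.+ j) % e ≡⟨ ℕ.%-distribˡ-+ i j e ⟩
      (i % e ℕ.+ j % e) % e ≡⟨ cong (λ r → (i % e ℕ.+ r) % e) eq ⟩
      (i % e ℕ.+ (c ℕ.+ e' ℕ.* i) % e) % e ≡⟨ ℕ.%-distribˡ-+ i (c ℕ.+ e' ℕ.* i) e ⟨
      (i ℕ.+ (c ℕ.+ e' ℕ.* i)) % e ≡⟨ cong (_% e) rearrange ⟩
      (c ℕ.+ i ℕ.* e) % e ≡⟨ ℕ.[m+kn]%n≡m%n c i e ⟩
      c % e ∎
      where
      rearrange : i ℕ.+ (c ℕ.+ e' ℕ.* i) ≡ c ℕ.+ i ℕ.* e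
      rearrange = ≡.trans (≡.sym (ℕ.+-assoc i c _)) (≡.trans (cong (ℕ._+ e' ℕ.* i) (ℕ.+-comm i c))
        (≡.trans (ℕ.+-assoc c i _) (cong (c ℕ.+_) (ℕ.*-comm e i))))

  ≈-equivalence : IsEquivalence _≈_
  ≈-equivalence = record
    { refl = mk λ _ → refl
    ; sym = λ p → mk λ c → ≡.sym (coefficients p c)
    ; trans = λ p q → mk λ c → ≡.trans (coefficients p c) (coefficients q c) }

  ++-cong : ∀ {a a' b b'} → a ≈ a' → b ≈ b' → a ++ b ≈ a' ++ b'
  ++-cong {a} {a'} {b} {b'} p q = mk λ c → ≡.trans (pair-++ a b (δ c))
    (≡.trans (cong₂ _xor_ (coefficients p c) (coefficients q c)) (≡.sym (pair-++ a' b' (δ c))))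

  ⊗-comm : ∀ a b → a ⊗ b ≈ b ⊗ a
  ⊗-comm a b = mk λ c → ≡.trans (pair-⊗ a b (δ c)) (≡.trans (pair-swap a b (λ i j → δ c (i ℕ.+ j)))
    (≡.trans (pair-cong b (λ j → pair-cong a (λ i → cong (δ c) (ℕ.+-comm i j)))) (≡.sym (pair-⊗ b a (δ c)))))

  ⊗-congˡ : ∀ a {b b'} → b ≈ b' → a ⊗ b ≈ a ⊗ b'
  ⊗-congˡ a {b} {b'} p = mk λ c → ≡.trans (pair-⊗ a b (δ c)) (≡.trans
    (pair-cong a (λ i → ≡.trans (pair-cong b (δ-shift c i))
      (≡.trans (coefficients p (c ℕ.+ e' ℕ.* i)) (≡.sym (pair-cong b' (δ-shift c i))))))
    (≡.sym (pair-⊗ a b' (δ c))))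

  private module E = IsEquivalence ≈-equivalence

  ⊗-cong : ∀ {a a' b b'} → a ≈ a' → b ≈ b' → a ⊗ b ≈ a' ⊗ b'
  ⊗-cong {a} {a'} {b} {b'} p q = E.trans (⊗-congˡ a q)
    (E.trans (⊗-comm a b') (E.trans (⊗-congˡ b' p) (⊗-comm b' a')))

  ⊗-assoc : ∀ a b c → (a ⊗ b) ⊗ c ≈ a ⊗ (b ⊗ c)
  ⊗-assoc a b c = mk λ k → ≡.trans (pair-⊗ (a ⊗ b) c (δ k)) (≡.trans (pair-⊗ a b _)
    (≡.trans (pair-cong a (λ i → ≡.trans
        (pair-cong b (λ j → pair-cong c (λ l → cong (δ k) (ℕ.+-assoc i j l))))
        (≡.sym (pair-⊗ b c (λ m → δ k (i ℕ.+ m))))))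
      (≡.sym (pair-⊗ a (b ⊗ c) (δ k)))))

  ⊗-identityˡ : ∀ a → (0 ∷ []) ⊗ a ≈ a
  ⊗-identityˡ a = mk λ c → ≡.trans (pair-⊗ (0 ∷ []) a (δ c)) (Bool.xor-identityʳ _)

  ++-comm : ∀ a b → a ++ b ≈ b ++ a
  ++-comm a b = mk λ c → ≡.trans (pair-++ a b (δ c)) (≡.trans (Bool.xor-comm ⟪ a , δ c ⟫ _) (≡.sym (pair-++ b a (δ c))))

  ++-assoc : ∀ a b c → (a ++ b) ++ c ≈ a ++ (b ++ c)
  ++-assoc a b c = mk λ k → cong (⟪_, δ k ⟫) (List.++-assoc a b c)

  ⊗-distribʳ : ∀ c a b → (a ++ b) ⊗ c ≈ a ⊗ c ++ b ⊗ c
  ⊗-distribʳ c a b = mk λ k → ≡.trans (pair-⊗ (a ++ b) c (δ k)) (≡.trans (pair-++ a b _)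
    (≡.sym (≡.trans (pair-++ (a ⊗ c) (b ⊗ c) (δ k)) (cong₂ _xor_ (pair-⊗ a c (δ k)) (pair-⊗ b c (δ k))))))

  +-isCommutativeMonoid : IsCommutativeMonoid _≈_ _++_ []
  +-isCommutativeMonoid = Biased.isCommutativeMonoidˡ record
    { isSemigroup = record { isMagma = record { isEquivalence = ≈-equivalence ; ∙-cong = ++-cong } ; assoc = ++-assoc }
    ; identityˡ = λ _ → E.refl ; comm = ++-comm }

  *-isCommutativeMonoid : IsCommutativeMonoid _≈_ _⊗_ (0 ∷ [])
  *-isCommutativeMonoid = Biased.isCommutativeMonoidˡ record
    { isSemigroup = record { isMagma = record { isEquivalence = ≈-equivalence ; ∙-cong = ⊗-cong } ; assoc = ⊗-assoc }
    ; identityˡ = ⊗-identityˡ ; comm = ⊗-comm }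

  groupRing : CommutativeSemiring 0ℓ 0ℓ
  groupRing = record { isCommutativeSemiring = Biased.isCommutativeSemiringˡ record
    { +-isCommutativeMonoid = +-isCommutativeMonoid
    ; *-isCommutativeMonoid = *-isCommutativeMonoid
    ; distribʳ = ⊗-distribʳ
    ; zeroˡ = λ _ → E.refl } }

  char2 : ∀ a → a ++ a ≈ []
  char2 a = mk λ c → ≡.trans (pair-++ a a (δ c)) (Bool.xor-same ⟪ a , δ c ⟫)

  monomial-cong : ∀ {i j} → i % e ≡ j % e → (i ∷ []) ≈ (j ∷ [])
  monomial-cong eq = mk λ c → cong (λ r → does (r ℕ.≟ c % e) xor false) eq

  _≈?_ : Decidable _≈_
  a ≈? b = map′ (λ f → mk λ c → ≡.trans (δ-mod a c) (≡.trans (f (ℕ._mod_ c e)) (≡.sym (δ-mod b c))))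
                (λ p i → coefficients p (Fin.toℕ i))
                (Fin.all? (λ (i : Fin e) → ⟪ a , δ (Fin.toℕ i) ⟫ Bool.≟ ⟪ b , δ (Fin.toℕ i) ⟫))
    where
    δ-mod : ∀ a c → ⟪ a , δ c ⟫ ≡ ⟪ a , δ (Fin.toℕ (c ℕ.mod e)) ⟫
    δ-mod a c = pair-cong a (λ j → cong (λ r → does (j % e ℕ.≟ r))
      (≡.trans (≡.sym (ℕ.m%n%n≡m%n c e)) (cong (_% e) (≡.sym (Fin.toℕ-fromℕ< (ℕ.m%n<n c e))))))

  -- For `n = e` these represent the whole ring: exponents reduce modulo `e`, and equal ones cancel
  -- in pairs. The search for a minimal idempotent runs through this list.
  subsetsBelow : ℕ → List (List ℕ)
  subsetsBelow zero = [] ∷ []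
  subsetsBelow (suc n) = subsetsBelow n ++ map (n ∷_) (subsetsBelow n)

  private
    swap : ∀ i j a → (i ∷ j ∷ a) ≈ (j ∷ i ∷ a)
    swap i j a = ++-cong {i ∷ j ∷ []} {j ∷ i ∷ []} (++-comm (i ∷ []) (j ∷ [])) E.refl

    insert : ∀ n {i a} → i ℕ.< n → a ∈ subsetsBelow n → ∃ λ b → b ∈ subsetsBelow n × (i ∷ a) ≈ b
    insert (suc n) {i} {a} i< a∈ with ℕ.m<1+n⇒m<n∨m≡n i< | ∈-++⁻ (subsetsBelow n) a∈
    ... | inj₁ lt | inj₁ a∈ˡ with b , b∈ , eq ← insert n lt a∈ˡ = b , ∈-++⁺ˡ b∈ , eq
    ... | inj₂ refl | inj₁ a∈ˡ = n ∷ a , ∈-++⁺ʳ _ (∈-map⁺ (n ∷_) a∈ˡ) , E.refl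
    ... | inj₁ lt | inj₂ a∈ʳ with a₀ , a₀∈ , refl ← ∈-map⁻ (n ∷_) a∈ʳ
                             with b , b∈ , eq ← insert n lt a₀∈ =
      n ∷ b , ∈-++⁺ʳ _ (∈-map⁺ (n ∷_) b∈) , E.trans (swap i n a₀) (++-cong {n ∷ []} E.refl eq)
    -- The exponent `n` is already present, and the two occurrences cancel.
    ... | inj₂ refl | inj₂ a∈ʳ with a₀ , a₀∈ , refl ← ∈-map⁻ (n ∷_) a∈ʳ =
      a₀ , ∈-++⁺ˡ a₀∈ , ++-cong {n ∷ n ∷ []} {[]} (char2 (n ∷ [])) E.refl

    []∈ : ∀ n → [] ∈ subsetsBelow n
    []∈ zero = here refl
    []∈ (suc n) = ∈-++⁺ˡ ([]∈ n)

  complete : ∀ a → ∃ λ b → b ∈ subsetsBelow e × a ≈ b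
  complete [] = [] , []∈ e , E.refl
  complete (i ∷ a) with b , b∈ , eq ← complete a with b' , b'∈ , eq' ← insert e (ℕ.m%n<n i e) b∈ =
    b' , b'∈ , E.trans (++-cong {i ∷ []} (monomial-cong (≡.sym (ℕ.m%n%n≡m%n i e))) eq) eq'

  module Powers (N : ℕ) (2^N≡1+e : 2 ℕ.^ N ≡ suc e) where
    open import Algebra.Properties.CommutativeSemiring.Exp groupRing using (_^_)

    monomial-^ : ∀ i n → (i ∷ []) ^ n ≡ (n ℕ.* i ∷ [])
    monomial-^ i zero = refl
    monomial-^ i (suc n) = cong ((i ∷ []) ⊗_) (monomial-^ i n)

    -- The Frobenius map is additive, so only powers of the generator matter, and `2 ^ N` is `1`
    -- modulo `e`.
    power-fixed : ∀ a → a ^ (2 ℕ.^ N) ≈ a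
    power-fixed [] = subst (λ n → [] ^ n ≈ []) (≡.sym 2^N≡1+e) E.refl
    power-fixed (i ∷ a) = E.trans (Char2.frobenius groupRing char2 N (i ∷ []) a)
      (++-cong {(i ∷ []) ^ (2 ℕ.^ N)} {i ∷ []}
        (E.trans (E.reflexive (monomial-^ i (2 ℕ.^ N)))
          (monomial-cong (≡.trans (cong (λ n → (n ℕ.* i) % e) 2^N≡1+e)
            (≡.trans (cong (λ n → (i ℕ.+ n) % e) (ℕ.*-comm e i)) (ℕ.[m+kn]%n≡m%n i i e)))))
        (power-fixed a))

-- Every a^e is idempotent, and multiplying ε in turn by each a^e for which the product does not
-- vanish leads to a minimal idempotent, i.e. to one which generates a field.
module MinimalIdempotent (S : CommutativeSemiring 0ℓ 0ℓ) (e' : ℕ)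
  (_≈?_ : Decidable (CommutativeSemiring._≈_ S))
  (elements : List (CommutativeSemiring.Carrier S))
  (complete : ∀ a → ∃ λ b → b ∈ elements × CommutativeSemiring._≈_ S a b) where

  open CommutativeSemiring S hiding (zero; refl)
  open import Algebra.Properties.CommutativeSemiring.Exp S
  open import Algebra.Solver.Ring.NaturalCoefficients.Default S using (solve; _:=_; _:*_)
  open import Relation.Binary.Reasoning.Setoid setoid
  private module S = CommutativeSemiring S

  -- In the component of `ε`, the element `c` is zero or has the inverse `c ^ e'`.
  Decided : Carrier → Carrier → Set
  Decided ε c = ε * c ≈ 0# ⊎ ε * c ^ suc e' ≈ ε

  Decided-resp : ∀ {ε ε' c c'} → ε ≈ ε' → c ≈ c' → Decided ε c → Decided ε' c'
  Decided-resp p q (inj₁ z) = inj₁ (trans (sym (*-cong p q)) z)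
  Decided-resp p q (inj₂ z) = inj₂ (trans (sym (*-cong p (^-congˡ (suc e') q))) (trans z p))

  module _ (power-fixed : ∀ a → a ^ suc (suc e') ≈ a) where

    idempotent : ∀ c → c ^ suc e' * c ^ suc e' ≈ c ^ suc e'
    idempotent c = begin
      c * c ^ e' * (c * c ^ e') ≈⟨ solve 2 (λ c d → c :* d :* (c :* d) := c :* (c :* d) :* d) S.refl c (c ^ e') ⟩
      c ^ suc (suc e') * c ^ e' ≈⟨ *-congʳ (power-fixed c) ⟩
      c * c ^ e'                ∎

    -- What is settled for an element stays settled when `ε` is replaced by a multiple, so the
    -- factors of all steps can be collected in `w`.
    shrink : ∀ cs ε → ¬ ε ≈ 0# → ∃ λ w → ¬ ε * w ≈ 0# × All (Decided (ε * w)) cs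
    shrink [] ε ε≉0 = 1# , (λ eq → ε≉0 (trans (sym (*-identityʳ ε)) eq)) , []
    shrink (c ∷ cs) ε ε≉0 with (ε * c ^ suc e') ≈? 0#
    ... | yes z with w , nz , all ← shrink cs ε ε≉0 = w , nz , inj₁ (begin
            ε * w * c                 ≈⟨ *-congˡ (power-fixed c) ⟨
            ε * w * (c * c ^ suc e')  ≈⟨ solve 4 (λ ε w c d → ε :* w :* (c :* d) := w :* c :* (ε :* d)) S.refl ε w c (c ^ suc e') ⟩
            w * c * (ε * c ^ suc e')  ≈⟨ *-congˡ z ⟩
            w * c * 0#                ≈⟨ zeroʳ _ ⟩
            0#                        ∎) ∷ all
    ... | no nz with w , nz' , all ← shrink cs (ε * c ^ suc e') nz =
      c ^ suc e' * w , (λ eq → nz' (trans (*-assoc _ _ _) eq)) , inj₂ (begin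
            ε * (c ^ suc e' * w) * c ^ suc e'
              ≈⟨ solve 3 (λ ε d w → ε :* (d :* w) :* d := ε :* w :* (d :* d)) S.refl ε (c ^ suc e') w ⟩
            ε * w * (c ^ suc e' * c ^ suc e')
              ≈⟨ *-congˡ (idempotent c) ⟩
            ε * w * c ^ suc e'
              ≈⟨ solve 3 (λ ε d w → ε :* w :* d := ε :* (d :* w)) S.refl ε (c ^ suc e') w ⟩
            ε * (c ^ suc e' * w) ∎) ∷
          All.map (Decided-resp (*-assoc _ _ _) S.refl) all

    minimal : ∀ u → ¬ u ≈ 0# → ∃ λ w → ¬ u * w ≈ 0# × (∀ c → Decided (u * w) c)
    minimal u u≉0 with w , nz , all ← shrink elements u u≉0 = w , nz , λ c →
      let b , b∈ , c≈b = complete c in Decided-resp S.refl (sym c≈b) (All.lookup all b∈)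

  module Component (ε : Carrier) where

    infix 4 _~_
    -- Congruence modulo the annihilator of `ε`: the component appears as a quotient of the ring,
    -- with the same carrier and operations.
    record _~_ (a b : Carrier) : Set where
      constructor mk
      field component : ε * a ≈ ε * b
    open _~_ public

    lift : ∀ {a b} → a ≈ b → a ~ b
    lift p = mk (*-congˡ p)

    ~-equivalence : IsEquivalence _~_
    ~-equivalence = record
      { refl = mk S.refl ; sym = λ p → mk (sym (component p)) ; trans = λ p q → mk (trans (component p) (component q)) }

    componentRing : CommutativeSemiring 0ℓ 0ℓ
    componentRing = record { isCommutativeSemiring = Biased.isCommutativeSemiringˡ record
      { +-isCommutativeMonoid = Biased.isCommutativeMonoidˡ record
        { isSemigroup = record
          { isMagma = record
            { isEquivalence = ~-equivalence
            ; ∙-cong = λ p q → mk (trans (distribˡ ε _ _) (trans (+-cong (component p) (component q)) (sym (distribˡ ε _ _)))) }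
          ; assoc = λ a b c → lift (+-assoc a b c) }
        ; identityˡ = λ a → lift (+-identityˡ a)
        ; comm = λ a b → lift (+-comm a b) }
      ; *-isCommutativeMonoid = Biased.isCommutativeMonoidˡ record
        { isSemigroup = record
          { isMagma = record
            { isEquivalence = ~-equivalence
            ; ∙-cong = λ {a} {a'} {b} {b'} p q → mk (begin
                ε * (a * b)   ≈⟨ *-assoc ε a b ⟨
                ε * a * b     ≈⟨ *-congʳ (component p) ⟩
                ε * a' * b    ≈⟨ solve 3 (λ ε a b → ε :* a :* b := a :* (ε :* b)) S.refl ε a' b ⟩
                a' * (ε * b)  ≈⟨ *-congˡ (component q) ⟩
                a' * (ε * b') ≈⟨ solve 3 (λ ε a b → a :* (ε :* b) := ε :* (a :* b)) S.refl ε a' b' ⟩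
                ε * (a' * b') ∎) }
          ; assoc = λ a b c → lift (*-assoc a b c) }
        ; identityˡ = λ a → lift (*-identityˡ a)
        ; comm = λ a b → lift (*-comm a b) }
      ; distribʳ = λ c a b → lift (distribʳ c a b)
      ; zeroˡ = λ a → lift (zeroˡ a) } }

module PrimitiveElement (e' : ℕ) where
  open GroupRing e'

  cofactor : ℕ → ℕ
  cofactor zero = 0
  cofactor (suc l) = e / suc l

  cofactor-* : ∀ {l} → NonZero l → l ∣ e → cofactor l ℕ.* l ≡ e
  cofactor-* {suc l} _ d = ℕ.m/n*n≡m d

  primeDivisors : List ℕ
  primeDivisors = filter (λ l → prime? l ×-dec l ∣? e) (upTo (suc e))

  -- The product of the X^(e/l) - 1; in a field where it does not vanish, X has order e.
  cyclotomic : List ℕ → List ℕ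
  cyclotomic [] = 0 ∷ []
  cyclotomic (l ∷ ls) = (0 ∷ cofactor l ∷ []) ⊗ cyclotomic ls

  private
    prime∤product : ∀ {l ls} → Prime l → l ∉ ls → All Prime ls → ¬ l ∣ product ls
    prime∤product {l} {[]} pl _ _ d with prime⇒nonTrivial pl
    ... | nt = ℕ.<-irrefl refl (ℕ.≤-trans (ℕ.nonTrivial⇒n>1 l ⦃ nt ⦄) (∣⇒≤ d))
    prime∤product {l} {l' ∷ ls} pl l∉ (pl' ∷ pls) d with euclidsLemma l' (product ls) pl d
    ... | inj₂ d' = prime∤product pl (λ l∈ → l∉ (there l∈)) pls d'
    ... | inj₁ d' with prime⇒irreducible pl' d'
    ...   | inj₂ l≡l' = l∉ (here l≡l')
    ...   | inj₁ refl = ℕ.<-irrefl refl (ℕ.nonTrivial⇒n>1 1 ⦃ prime⇒nonTrivial pl ⦄)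

    δ₀-false : ∀ {a} → ¬ e ∣ a → δ 0 a ≡ false
    δ₀-false {a} ∤ = dec-false (a % e ℕ.≟ 0 % e) (λ eq → ∤ (m%n≡0⇒n∣m a e eq))

    pair-allFalse : ∀ a {h} → All (λ i → h i ≡ false) a → ⟪ a , h ⟫ ≡ false
    pair-allFalse [] [] = refl
    pair-allFalse (i ∷ a) (p ∷ ps) = cong₂ _xor_ p (pair-allFalse a ps)

    -- Each exponent is a sum of numbers `e / l` with `l` in `ls`, and `product ls` clears these
    -- denominators.
    exponents : ∀ ls → All (λ l → Prime l × l ∣ e) ls → All (λ i → e ∣ product ls ℕ.* i) (cyclotomic ls)
    exponents [] [] = ∣n⇒∣m*n 1 (divides 0 refl) ∷ []
    exponents (l ∷ ls) ((pl , l∣e) ∷ all) =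
      All.++⁺ (All.map⁺ (All.map (λ {i} d → subst (e ∣_) (≡.sym (ℕ.*-assoc l (product ls) i)) (∣n⇒∣m*n l d)) rec))
        (All.++⁺ (All.map⁺ (All.map (λ {i} d → subst (e ∣_) (≡.sym (expand i))
            (∣m∣n⇒∣m+n (∣n⇒∣m*n (product ls) ∣-refl) (∣n⇒∣m*n l d))) rec)) [])
      where
      rec = exponents ls all
      open ≡.≡-Reasoning
      expand : ∀ i → l ℕ.* product ls ℕ.* (cofactor l ℕ.+ i) ≡ product ls ℕ.* e ℕ.+ l ℕ.* (product ls ℕ.* i)
      expand i = begin
        l ℕ.* P ℕ.* (c ℕ.+ i)                       ≡⟨ ℕ.*-distribˡ-+ (l ℕ.* P) c i ⟩
        l ℕ.* P ℕ.* c ℕ.+ l ℕ.* P ℕ.* i             ≡⟨ cong₂ ℕ._+_ (cong (ℕ._* c) (ℕ.*-comm l P)) (ℕ.*-assoc l P i) ⟩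
        P ℕ.* l ℕ.* c ℕ.+ l ℕ.* (P ℕ.* i)           ≡⟨ cong (ℕ._+ l ℕ.* (P ℕ.* i)) (ℕ.*-assoc P l c) ⟩
        P ℕ.* (l ℕ.* c) ℕ.+ l ℕ.* (P ℕ.* i)         ≡⟨ cong (λ t → P ℕ.* t ℕ.+ l ℕ.* (P ℕ.* i)) (≡.trans (ℕ.*-comm l c) (cofactor-* (prime⇒nonZero pl) l∣e)) ⟩
        P ℕ.* e ℕ.+ l ℕ.* (P ℕ.* i)                 ∎
        where
        P = product ls
        c = cofactor l

    -- The only exponent divisible by `e` comes from taking `1` in every factor. If `e` divides
    -- `e / l + i`, where it also divides `P * i`, then it divides `P * (e / l)`, so that `l`
    -- divides the product `P` of other primes.
    constantTerm : ∀ ls → Unique ls → All (λ l → Prime l × l ∣ e) ls → ⟪ cyclotomic ls , δ 0 ⟫ ≡ true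
    constantTerm [] _ _ = cong (_xor false) (dec-true (0 % e ℕ.≟ 0 % e) refl)
    constantTerm (l ∷ ls) (l∉ls ∷ uls) ((pl , l∣e) ∷ all) =
      ≡.trans (pair-++ (map (0 ℕ.+_) U) (map (cofactor l ℕ.+_) U ++ []) (δ 0))
        (cong₂ _xor_
          (≡.trans (pair-map 0 U (δ 0)) (constantTerm ls uls all))
          (pair-allFalse _ (All.++⁺ (All.map⁺ (All.map shifted (exponents ls all))) [])))
      where
      U = cyclotomic ls
      P = product ls
      shifted : ∀ {i} → e ∣ P ℕ.* i → δ 0 (cofactor l ℕ.+ i) ≡ false
      shifted {i} d = δ₀-false (λ d' → prime∤product pl (λ l∈ → All.lookup l∉ls l∈ refl) (All.map proj₁ all)
        (*-cancelʳ-∣ {l} {P} (cofactor l) ⦃ cofactor-nonZero ⦄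
          (subst (_∣ P ℕ.* cofactor l) (≡.trans (≡.sym (cofactor-* (prime⇒nonZero pl) l∣e)) (ℕ.*-comm (cofactor l) l))
            (∣m+n∣m⇒∣n (subst (e ∣_) (≡.trans (ℕ.*-distribˡ-+ P (cofactor l) i) (ℕ.+-comm (P ℕ.* cofactor l) _)) (∣n⇒∣m*n P d')) d))))
        where
        cofactor-nonZero : NonZero (cofactor l)
        cofactor-nonZero with cofactor l | cofactor-* (prime⇒nonZero pl) l∣e
        ... | suc _ | _ = _

  primeDivisors-sound : All (λ l → Prime l × l ∣ e) primeDivisors
  primeDivisors-sound = All.all-filter (λ l → prime? l ×-dec l ∣? e) (upTo (suc e))

  cyclotomic≉0 : ¬ cyclotomic primeDivisors ≈ []
  cyclotomic≉0 eq with () ← ≡.trans (≡.sym (constantTerm primeDivisors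
    (Unique.filter⁺ (λ l → prime? l ×-dec l ∣? e) (Unique.upTo⁺ (suc e))) primeDivisors-sound)) (coefficients eq 0)

  private module R = CommutativeSemiring groupRing

  cyclotomic-factor : ∀ {l ls} → l ∈ ls → ∃ λ v → cyclotomic ls ≈ (0 ∷ cofactor l ∷ []) ⊗ v
  cyclotomic-factor {ls = l ∷ ls} (here refl) = cyclotomic ls , R.refl
  cyclotomic-factor {l} {l' ∷ ls} (there l∈) with v , eq ← cyclotomic-factor l∈ =
    (0 ∷ cofactor l' ∷ []) ⊗ v , R.trans (R.*-congˡ {0 ∷ cofactor l' ∷ []} eq)
      (R.trans (R.sym (R.*-assoc (0 ∷ cofactor l' ∷ []) (0 ∷ cofactor l ∷ []) v))
        (R.trans (R.*-congʳ {v} (R.*-comm (0 ∷ cofactor l' ∷ []) (0 ∷ cofactor l ∷ [])))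
          (R.*-assoc (0 ∷ cofactor l ∷ []) (0 ∷ cofactor l' ∷ []) v)))

record CyclicField (e : ℕ) : Set₁ where
  field
    field₂ : BinaryField
  open BinaryField field₂ public
  open Exp commutativeSemiring using (_^_) public
  field
    ζ : Carrier
    ζ^e≡1 : ζ ^ e ≡ 1#
    ζ-injective : ∀ {i j} → i ℕ.< e → j ℕ.< e → ζ ^ i ≡ ζ ^ j → i ≡ j
    log : ∀ {u} → u ≢ 0# → ∃ λ t → u ≡ ζ ^ t

module Construction (N e' : ℕ) (2^N≡ : 2 ℕ.^ N ≡ suc (suc e')) where
  open GroupRing e'
  open PrimitiveElement e'
  private
    module R = CommutativeSemiring groupRing
    module RE where
      open import Algebra.Properties.CommutativeSemiring.Exp groupRing public

  open MinimalIdempotent groupRing e' _≈?_ (subsetsBelow e) complete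

  power-fixed : ∀ a → a RE.^ suc (suc e') ≈ a
  power-fixed a = subst (λ n → a RE.^ n ≈ a) 2^N≡ (Powers.power-fixed N 2^N≡ a)

  private
    u = cyclotomic primeDivisors
    minimal-u = minimal power-fixed u cyclotomic≉0
    w = proj₁ minimal-u

  -- Starting from `u` instead of `1` selects a component in which the cyclotomic product survives.
  ε : List ℕ
  ε = u ⊗ w

  ε≉0 : ¬ ε ≈ []
  ε≉0 = proj₁ (proj₂ minimal-u)

  open Component ε
  open CommutativeSemiring componentRing hiding (_≈_; zero; refl; Carrier)
  private module C = CommutativeSemiring componentRing
  open import Algebra.Properties.CommutativeSemiring.Exp componentRing
  open import Relation.Binary.Reasoning.Setoid setoid

  X : ℕ → List ℕ
  X i = i ∷ []

  1≁0 : ¬ X 0 ~ []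
  1≁0 p = ε≉0 (R.trans (R.sym (R.*-identityʳ ε)) (R.trans (component p) (R.zeroʳ ε)))

  _~?_ : Decidable _~_
  a ~? b = map′ mk component ((ε ⊗ a) ≈? (ε ⊗ b))

  ^-same : ∀ c n → c RE.^ n ≡ c ^ n
  ^-same c zero = refl
  ^-same c (suc n) = cong (c ⊗_) (^-same c n)

  zero-or-unit : ∀ c → c ~ [] ⊎ c ^ e ~ X 0
  zero-or-unit c with proj₂ (proj₂ minimal-u) c
  ... | inj₁ z = inj₁ (mk (R.trans z (R.sym (R.zeroʳ ε))))
  ... | inj₂ p = inj₂ (mk (R.trans (subst (λ d → ε ⊗ d ≈ ε) (^-same c e) p) (R.sym (R.*-identityʳ ε))))

  integral : ∀ {a b} → a ⊗ b ~ [] → ¬ a ~ [] → b ~ []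
  integral {a} {b} ab~0 a≁0 with zero-or-unit a
  ... | inj₁ z = ⊥-elim (a≁0 z)
  ... | inj₂ p = begin
    b ≈⟨ *-identityˡ b ⟨
    X 0 ⊗ b ≈⟨ *-congʳ {b} p ⟨
    (a ⊗ a ^ e') ⊗ b ≈⟨ *-congʳ {b} (*-comm a (a ^ e')) ⟩
    (a ^ e' ⊗ a) ⊗ b ≈⟨ *-assoc (a ^ e') a b ⟩
    a ^ e' ⊗ (a ⊗ b) ≈⟨ *-congˡ {a ^ e'} ab~0 ⟩
    a ^ e' ⊗ [] ≈⟨ zeroʳ (a ^ e') ⟩
    [] ∎

  X-* : ∀ i n → X i ~ X 0 → X (n ℕ.* i) ~ X 0
  X-* i zero p = C.refl
  X-* i (suc n) p = C.trans (*-cong {X i} {X 0} {X (n ℕ.* i)} {X 0} p (X-* i n p)) (*-identityˡ (X 0))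

  X-multiple : ∀ {i} → e ∣ i → X i ~ X 0
  X-multiple {i} d = lift (monomial-cong (n∣m⇒m%n≡0 i e d))

  X-^ : ∀ i n → X i ^ n ≡ X (n ℕ.* i)
  X-^ i zero = refl
  X-^ i (suc n) = cong (X i ⊗_) (X-^ i n)

  X-cancelʳ : ∀ i j → X j ~ X 0 → X (i ℕ.+ j) ~ X i
  X-cancelʳ i j p = C.trans (*-congˡ {X i} p) (*-identityʳ (X i))

  -- The cyclotomic factor X^(e/l) - 1 divides u, and u is a unit in the component of ε.
  X-cofactor : ∀ {l} → l ∈ primeDivisors → ¬ X (cofactor l) ~ X 0
  X-cofactor {l} l∈ p with v , u≈Fv ← cyclotomic-factor l∈ = ε≉0 (R.trans ε≈ (R.*-congʳ {u RE.^ e'} ε*u≈0))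
    where
    F = 0 ∷ cofactor l ∷ []
    ε*F≈0 : ε ⊗ F ≈ []
    ε*F≈0 = R.trans (R.distribˡ ε (X 0) (X (cofactor l)))
      (R.trans (R.+-congˡ {ε ⊗ X 0} (component p)) (char2 (ε ⊗ X 0)))
    ε*u≈0 : ε ⊗ u ≈ []
    ε*u≈0 = R.trans (R.*-congˡ {ε} u≈Fv) (R.trans (R.sym (R.*-assoc ε F v)) (R.*-congʳ {v} ε*F≈0))
    ε≈ : ε ≈ (ε ⊗ u) ⊗ u RE.^ e'
    ε≈ = R.trans (R.*-congʳ {w} (R.sym (power-fixed u)))
      (R.trans (R.*-congʳ {w} (R.*-congˡ {u} (R.refl {u ⊗ u RE.^ e'})))
        (R.trans (R.*-assoc u (u ⊗ u RE.^ e') w)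
        (R.trans (R.*-congˡ {u} (R.*-comm (u ⊗ u RE.^ e') w))
        (R.trans (R.sym (R.*-assoc u w (u ⊗ u RE.^ e')))
          (R.sym (R.*-assoc ε u (u RE.^ e')))))))

  private
    primeFactor : ∀ {n} → 1 ℕ.< n → ∃ λ l → Prime l × l ∣ n
    primeFactor {n@(suc _)} 1<n with factorise n
    ... | record { factors = [] ; isFactorisation = eq } = ⊥-elim (ℕ.<-irrefl (≡.sym eq) 1<n)
    ... | record { factors = l ∷ ls ; isFactorisation = eq ; factorsPrime = pl ∷ _ } =
      l , pl , subst (l ∣_) (≡.sym eq) (m∣m*n (product ls))

  -- By Bézout, `X` is trivial at `g = gcd i e`. If `g` is a proper divisor of `e`, some prime `l`
  -- divides `e / g`, and `e / l` is a multiple of `g`, contrary to `X-cofactor`.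
  X-order : ∀ {i} → X i ~ X 0 → e ∣ i
  X-order {i} p with gcd[m,n]∣n i e
  ... | divides h e≡hg with h ℕ.≤? 1
  ...   | yes h≤1 = subst (_∣ i) (g≡e h h≤1 e≡hg) (gcd[m,n]∣m i e)
    where
    g≡e : ∀ h → h ℕ.≤ 1 → e ≡ h ℕ.* gcd i e → gcd i e ≡ e
    g≡e 1 _ eq = ≡.sym (≡.trans eq (ℕ.+-identityʳ _))
    g≡e (suc (suc _)) (s≤s ()) _
  ...   | no h≰1 with l , pl , divides h' h≡h'l ← primeFactor (ℕ.≰⇒> h≰1) =
    ⊥-elim (X-cofactor l∈ (subst (λ n → X n ~ X 0) (≡.sym cofactor≡) (X-* g h' Xg~1)))
    where
    g = gcd i e
    Xg~1 : X g ~ X 0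
    Xg~1 with Bézout.identity (gcd-GCD i e)
    ... | Bézout.+- x y eq = C.trans (C.sym (X-cancelʳ g (y ℕ.* e) (X-multiple (n∣m*n y))))
            (subst (λ n → X n ~ X 0) (≡.sym eq) (X-* i x p))
    ... | Bézout.-+ x y eq = C.trans (C.sym (X-cancelʳ g (x ℕ.* i) (X-* i x p)))
            (subst (λ n → X n ~ X 0) (≡.sym eq) (X-multiple (n∣m*n y)))
    e≡ : e ≡ h' ℕ.* g ℕ.* l
    e≡ = ≡.trans e≡hg (≡.trans (cong (ℕ._* g) h≡h'l) (≡.trans (ℕ.*-assoc h' l g)
      (≡.trans (cong (h' ℕ.*_) (ℕ.*-comm l g)) (≡.sym (ℕ.*-assoc h' g l)))))
    l∣e : l ∣ e
    l∣e = divides (h' ℕ.* g) e≡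
    l∈ : l ∈ primeDivisors
    l∈ = ∈-filter⁺ (λ l → prime? l ×-dec l ∣? e) (∈-upTo⁺ (s≤s (∣⇒≤ l∣e))) (pl , l∣e)
    cofactor≡ : cofactor l ≡ h' ℕ.* g
    cofactor≡ = ℕ.*-cancelʳ-≡ (cofactor l) (h' ℕ.* g) l ⦃ prime⇒nonZero pl ⦄
      (≡.trans (cofactor-* (prime⇒nonZero pl) l∣e) e≡)

  e∣e*_ : ∀ i → e ∣ i ℕ.+ e' ℕ.* i
  e∣e* i = m∣m*n i

  X-injective : ∀ {i j} → i ℕ.< e → j ℕ.< e → X i ~ X j → i ≡ j
  X-injective {i} {j} i<e j<e p = ≡.trans (≡.sym (ℕ.m<n⇒m%n≡m i<e)) (≡.trans mod-equal (ℕ.m<n⇒m%n≡m j<e))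
    where
    module P = ≡.≡-Reasoning
    -- Modulo `e`, the sum is `i - j`.
    d : e ∣ i ℕ.+ e' ℕ.* j
    d = X-order (C.trans (*-congʳ {X (e' ℕ.* j)} p) (X-multiple (e∣e* j)))
    mod-equal : i % e ≡ j % e
    mod-equal = P.begin
      i % e P.≡⟨ ℕ.[m+kn]%n≡m%n i j e ⟨
      (i ℕ.+ j ℕ.* e) % e P.≡⟨ cong (λ t → (i ℕ.+ t) % e) (≡.trans (ℕ.*-comm j e) (ℕ.+-comm j (e' ℕ.* j))) ⟩
      (i ℕ.+ (e' ℕ.* j ℕ.+ j)) % e P.≡⟨ cong (_% e) (≡.sym (ℕ.+-assoc i (e' ℕ.* j) j)) ⟩
      (i ℕ.+ e' ℕ.* j ℕ.+ j) % e P.≡⟨ ℕ.%-distribˡ-+ (i ℕ.+ e' ℕ.* j) j e ⟩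
      ((i ℕ.+ e' ℕ.* j) % e ℕ.+ j % e) % e P.≡⟨ cong (λ t → (t ℕ.+ j % e) % e) (n∣m⇒m%n≡0 (i ℕ.+ e' ℕ.* j) e d) ⟩
      (j % e) % e P.≡⟨ ℕ.m%n%n≡m%n j e ⟩
      j % e P.∎

  X≁0 : ∀ i → ¬ X i ~ []
  X≁0 i p = 1≁0 (C.trans (C.sym (X-multiple (e∣e* i))) (*-congʳ {X (e' ℕ.* i)} p))

  value : Fin (suc e) → List ℕ
  value zero = []
  value (suc i) = X (Fin.toℕ i)

  value-injective : ∀ {i j} → value i ~ value j → i ≡ j
  value-injective {zero} {zero} p = refl
  value-injective {zero} {suc j} p = ⊥-elim (X≁0 _ (C.sym p))
  value-injective {suc i} {zero} p = ⊥-elim (X≁0 _ p)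
  value-injective {suc i} {suc j} p = cong suc (Fin.toℕ-injective (X-injective (Fin.toℕ<n i) (Fin.toℕ<n j) p))

  char2~ : ∀ a → a ++ a ~ []
  char2~ a = lift (char2 a)

  open Char2 componentRing char2~ using (horner; rootBound)

  private
    monomial : ∀ n → Fin (suc n) → List ℕ
    monomial zero _ = X 0
    monomial (suc n) zero = []
    monomial (suc n) (suc i) = monomial n i

    horner-monomial : ∀ n c → horner (suc n) (monomial n) c ~ c ^ n
    horner-monomial zero c = C.trans (+-congˡ {X 0} (zeroʳ c)) (+-identityʳ (X 0))
    horner-monomial (suc n) c = *-congˡ {c} (horner-monomial n c)

  -- The powers of `X` are already `e` roots of `x ^ e + 1`; a further nonzero element of the
  -- component would be one root too many.
  value-surjective : ∀ c → ∃ λ i → value i ~ c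
  value-surjective c with Fin.any? (λ i → value i ~? c)
  ... | yes p = p
  ... | no none = ⊥-elim (1≁0 (rootBound integral (suc e) poly points points-distinct roots zero))
    where
    poly : Fin (suc e) → List ℕ
    poly zero = X 0
    poly (suc i) = monomial e' i

    points : Fin (suc e) → List ℕ
    points zero = c
    points (suc i) = X (Fin.toℕ i)

    points-distinct : ∀ {i j} → points i ~ points j → i ≡ j
    points-distinct {zero} {zero} p = refl
    points-distinct {zero} {suc j} p = ⊥-elim (none (suc j , C.sym p))
    points-distinct {suc i} {zero} p = ⊥-elim (none (suc i , p))
    points-distinct {suc i} {suc j} p = value-injective p

    unit : ∀ i → points i ^ e ~ X 0
    unit zero with zero-or-unit c
    ... | inj₁ z = ⊥-elim (none (zero , C.sym z))
    ... | inj₂ p = p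
    unit (suc i) = C.trans (C.reflexive (X-^ (Fin.toℕ i) e)) (X-multiple (m∣m*n (Fin.toℕ i)))

    roots : ∀ i → horner (suc e) poly (points i) ~ []
    roots i = C.trans (+-congˡ {X 0} (C.trans (*-congˡ {points i} (horner-monomial e' (points i))) (unit i))) (char2~ (X 0))

  private
    F = Fin (suc e)

  -- The field is transported along `value` to `Fin (suc e)`, where equality is propositional and
  -- decidable.
  index : List ℕ → F
  index c = proj₁ (value-surjective c)

  value-index : ∀ c → value (index c) ~ c
  value-index c = proj₂ (value-surjective c)

  infixl 6 _⊞_
  infixl 7 _⊠_
  _⊞_ _⊠_ : F → F → F
  a ⊞ b = index (value a ++ value b)
  a ⊠ b = index (value a ⊗ value b)

  value-⊞ : ∀ a b → value (a ⊞ b) ~ value a ++ value b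
  value-⊞ a b = value-index _

  value-⊠ : ∀ a b → value (a ⊠ b) ~ value a ⊗ value b
  value-⊠ a b = value-index _

  one : F
  one = index (X 0)

  isCommutativeSemiringF : IsCommutativeSemiring _≡_ _⊞_ _⊠_ zero one
  isCommutativeSemiringF = Biased.isCommutativeSemiringˡ record
    { +-isCommutativeMonoid = Biased.isCommutativeMonoidˡ record
      { isSemigroup = record
        { isMagma = record { isEquivalence = ≡.isEquivalence ; ∙-cong = cong₂ _⊞_ }
        ; assoc = λ a b c → value-injective (begin
            value (a ⊞ b ⊞ c) ≈⟨ value-⊞ (a ⊞ b) c ⟩
            value (a ⊞ b) ++ value c ≈⟨ +-congʳ {value c} (value-⊞ a b) ⟩
            (value a ++ value b) ++ value c ≈⟨ +-assoc (value a) (value b) (value c) ⟩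
            value a ++ (value b ++ value c) ≈⟨ +-congˡ {value a} (value-⊞ b c) ⟨
            value a ++ value (b ⊞ c) ≈⟨ value-⊞ a (b ⊞ c) ⟨
            value (a ⊞ (b ⊞ c)) ∎) }
      ; identityˡ = λ a → value-injective (value-⊞ zero a)
      ; comm = λ a b → value-injective
          (C.trans (value-⊞ a b) (C.trans (+-comm (value a) (value b)) (C.sym (value-⊞ b a)))) }
    ; *-isCommutativeMonoid = Biased.isCommutativeMonoidˡ record
      { isSemigroup = record
        { isMagma = record { isEquivalence = ≡.isEquivalence ; ∙-cong = cong₂ _⊠_ }
        ; assoc = λ a b c → value-injective (begin
            value (a ⊠ b ⊠ c) ≈⟨ value-⊠ (a ⊠ b) c ⟩
            value (a ⊠ b) ⊗ value c ≈⟨ *-congʳ {value c} (value-⊠ a b) ⟩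
            (value a ⊗ value b) ⊗ value c ≈⟨ *-assoc (value a) (value b) (value c) ⟩
            value a ⊗ (value b ⊗ value c) ≈⟨ *-congˡ {value a} (value-⊠ b c) ⟨
            value a ⊗ value (b ⊠ c) ≈⟨ value-⊠ a (b ⊠ c) ⟨
            value (a ⊠ (b ⊠ c)) ∎) }
      ; identityˡ = λ a → value-injective
          (C.trans (value-⊠ one a) (C.trans (*-congʳ {value a} (value-index (X 0))) (*-identityˡ (value a))))
      ; comm = λ a b → value-injective
          (C.trans (value-⊠ a b) (C.trans (*-comm (value a) (value b)) (C.sym (value-⊠ b a)))) }
    ; distribʳ = λ c a b → value-injective (begin
        value ((a ⊞ b) ⊠ c) ≈⟨ value-⊠ (a ⊞ b) c ⟩
        value (a ⊞ b) ⊗ value c ≈⟨ *-congʳ {value c} (value-⊞ a b) ⟩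
        (value a ++ value b) ⊗ value c ≈⟨ distribʳ (value c) (value a) (value b) ⟩
        value a ⊗ value c ++ value b ⊗ value c ≈⟨ +-cong (value-⊠ a c) (value-⊠ b c) ⟨
        value (a ⊠ c) ++ value (b ⊠ c) ≈⟨ value-⊞ (a ⊠ c) (b ⊠ c) ⟨
        value (a ⊠ c ⊞ b ⊠ c) ∎)
    ; zeroˡ = λ a → value-injective (value-⊠ zero a) }

  binaryField : BinaryField
  binaryField = record
    { isCommutativeSemiring = isCommutativeSemiringF
    ; char2 = λ a → value-injective (C.trans (value-⊞ a a) (char2~ (value a)))
    ; _⁻¹ = λ a → index (value a ^ e')
    ; inverseʳ = λ {a} a≢0 → value-injective (C.trans (value-⊠ a _)
        (C.trans (*-congˡ {value a} (value-index (value a ^ e')))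
          (C.trans ([ (λ z → ⊥-elim (a≢0 (value-injective z))) , (λ p → p) ]′ (zero-or-unit (value a)))
            (C.sym (value-index (X 0))))))
    ; 0≢1 = λ eq → 1≁0 (C.trans (C.sym (value-index (X 0))) (C.reflexive (cong value (≡.sym eq))))
    ; _≟_ = Fin._≟_ }

  cyclicField : CyclicField e
  cyclicField = record
    { field₂ = binaryField
    ; ζ = ζ
    ; ζ^e≡1 = value-injective (C.trans (value-ζ^ e) (C.trans (X-multiple ∣-refl) (C.sym (value-index (X 0)))))
    ; ζ-injective = λ {i} {j} i<e j<e eq → X-injective i<e j<e
        (C.trans (C.sym (value-ζ^ i)) (C.trans (C.reflexive (cong value eq)) (value-ζ^ j)))
    ; log = λ { {zero} u≢0 → ⊥-elim (u≢0 refl)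
              ; {suc i} _ → Fin.toℕ i , value-injective (C.sym (value-ζ^ (Fin.toℕ i))) } }
    where
    module L where
      open import Algebra.Properties.CommutativeSemiring.Exp (BinaryField.commutativeSemiring binaryField) public
    ζ = index (X 1)
    value-ζ^ : ∀ n → value (ζ L.^ n) ~ X n
    value-ζ^ zero = value-index (X 0)
    value-ζ^ (suc n) = C.trans (value-⊠ ζ (ζ L.^ n)) (*-cong {value ζ} {X 1} {value (ζ L.^ n)} {X n} (value-index (X 1)) (value-ζ^ n))

-- Counting solutions of product equations

open ≡ using (sym; trans; module ≡-Reasoning)

module FieldProperties (F : BinaryField) where
  open BinaryField F
  open CommutativeSemiring commutativeSemiring using (*-identityˡ; zeroʳ; *-assoc)
  open Char2Solver commutativeSemiring char2 using (solve; _:=_; _:*_)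

  noZeroDivisors : ∀ {a b} → a ≢ 0# → b ≢ 0# → a * b ≢ 0#
  noZeroDivisors {a} {b} a≢0 b≢0 ab≡0 = b≢0
    (trans (sym (*-identityˡ b)) (trans (cong (_* b) (sym (inverseʳ a≢0)))
      (trans (solve 3 (λ a a' b → a :* a' :* b := a' :* (a :* b)) refl a (a ⁻¹) b)
        (trans (cong (a ⁻¹ *_) ab≡0) (zeroʳ _)))))

  rootProd : List Carrier → Carrier → Carrier
  rootProd [] v = 1#
  rootProd (ρ ∷ ρs) v = (v + ρ) * rootProd ρs v

  rootProd-++ : ∀ ρs γs v → rootProd (ρs ++ γs) v ≡ rootProd ρs v * rootProd γs v
  rootProd-++ [] γs v = sym (*-identityˡ _)
  rootProd-++ (ρ ∷ ρs) γs v = trans (cong ((v + ρ) *_) (rootProd-++ ρs γs v)) (sym (*-assoc _ _ _))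

  -- The variables are those with indices from `1` to `t`. The one with index `0` is kept apart,
  -- since it alone is later replaced by a reciprocal.
  factorProd : {Ix S : Set} → (ℕ → S → Carrier) → (ℕ → Ix → List Carrier) → ℕ → Ix → S → Carrier
  factorProd x roots zero i p = 1#
  factorProd x roots (suc t) i p = rootProd (roots (suc t) i) (x (suc t) p) * factorProd x roots t i p

-- Spaces of polynomial functions on the solution set

module Spaces (F : BinaryField) (S : Set) where
  open BinaryField F
  open CommutativeSemiring commutativeSemiring
    using (+-identityˡ; *-identityˡ; zeroʳ; *-assoc; distribˡ)
  open Char2Solver commutativeSemiring char2 using (solve; _:=_; _:+_; _:*_; con)
  open import Algebra.Properties.CommutativeSemiring.Exp commutativeSemiring using (_^_)
  open FieldProperties F using (noZeroDivisors; rootProd; rootProd-++; factorProd)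

  Fun : Set
  Fun = S → Carrier

  record Subspace (Z : Fun → Set) : Set where
    field
      resp : ∀ {f g} → (∀ p → f p ≡ g p) → Z f → Z g
      null : Z (λ _ → 0#)
      add : ∀ {f g} → Z f → Z g → Z (λ p → f p + g p)
      scale : ∀ {f} a → Z f → Z (λ p → a * f p)

  open Subspace

  -- Inductions over products pass from `Z` to such a preimage in order to split off a factor common
  -- to all generators.
  preimage : ∀ {Z} (h : Fun) → Subspace Z → Subspace (λ f → Z (λ p → h p * f p))
  preimage h subZ .resp e = subZ .resp (λ p → cong (h p *_) (e p))
  preimage h subZ .null = subZ .resp (λ p → sym (zeroʳ (h p))) (subZ .null)
  preimage h subZ .add u v = subZ .resp (λ p → sym (distribˡ (h p) _ _)) (subZ .add u v)
  preimage h subZ .scale a u =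
    subZ .resp (λ p → solve 3 (λ a h f → a :* (h :* f) := h :* (a :* f)) refl a (h p) _) (subZ .scale a u)

  -- These are functions on the solution set and not formal polynomials: coefficients need not be
  -- unique, and dimensions are only bounded from above.
  data Poly (x : Fun) (A : Fun → Set) : ℕ → Fun → Set where
    nil : ∀ {f} → (∀ p → f p ≡ 0#) → Poly x A 0 f
    cons : ∀ {D a g f} → A a → Poly x A D g → (∀ p → f p ≡ a p + x p * g p) → Poly x A (suc D) f

  module _ {x : Fun} {A : Fun → Set} (subA : Subspace A) where

    polySubspace : ∀ D → Subspace (Poly x A D)
    polySubspace zero .resp e (nil z) = nil (λ p → trans (sym (e p)) (z p))
    polySubspace (suc D) .resp e (cons Aa Pg h) = cons Aa Pg (λ p → trans (sym (e p)) (h p))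
    polySubspace zero .null = nil (λ _ → refl)
    polySubspace (suc D) .null = cons (subA .null) (polySubspace D .null)
      (λ p → solve 1 (λ x → con false := con false :+ x :* con false) refl (x p))
    polySubspace zero .add (nil z) (nil z') = nil (λ p → trans (cong₂ _+_ (z p) (z' p)) (+-identityˡ _))
    polySubspace (suc D) .add (cons Aa Pg h) (cons Aa' Pg' h') =
      cons (subA .add Aa Aa') (polySubspace D .add Pg Pg')
        (λ p → trans (cong₂ _+_ (h p) (h' p))
          (solve 5 (λ a g a' g' x → (a :+ x :* g) :+ (a' :+ x :* g') := (a :+ a') :+ x :* (g :+ g'))
            refl _ _ _ _ (x p)))
    polySubspace zero .scale a (nil z) = nil (λ p → trans (cong (a *_) (z p)) (zeroʳ a))
    polySubspace (suc D) .scale b (cons Aa Pg h) =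
      cons (subA .scale b Aa) (polySubspace D .scale b Pg)
        (λ p → trans (cong (b *_) (h p))
          (solve 4 (λ a g b x → b :* (a :+ x :* g) := b :* a :+ x :* (b :* g)) refl _ _ b (x p)))

    constant : ∀ {D a} → A a → Poly x A (suc D) a
    constant {D} Aa = cons Aa (polySubspace D .null)
      (λ p → solve 2 (λ a x → a := a :+ x :* con false) refl _ (x p))

    weaken : ∀ {D D' f} → D ℕ.≤ D' → Poly x A D f → Poly x A D' f
    weaken {D' = D'} z≤n (nil z) = polySubspace D' .resp (λ p → sym (z p)) (polySubspace D' .null)
    weaken (s≤s le) (cons Aa Pg h) = cons Aa (weaken le Pg) h

    shift : ∀ {D f} → Poly x A D f → Poly x A (suc D) (λ p → x p * f p)
    shift Pf = cons (subA .null) Pf (λ p → sym (+-identityˡ _))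

    linear : ∀ {D f} ρ → Poly x A D f → Poly x A (suc D) (λ p → (x p + ρ) * f p)
    linear {D} ρ Pf = polySubspace (suc D) .resp
      (λ p → solve 3 (λ x f ρ → x :* f :+ ρ :* f := (x :+ ρ) :* f) refl (x p) _ ρ)
      (polySubspace (suc D) .add (shift Pf) (polySubspace (suc D) .scale ρ (weaken (ℕ.n≤1+n D) Pf)))

    rootDivision : ∀ {D f} ρ → Poly x A (suc D) f →
      ∃ λ c → A c × ∃ λ h → Poly x A D h × (∀ p → f p ≡ c p + (x p + ρ) * h p)
    rootDivision ρ (cons {a = a} Aa (nil z) e) =
      a , Aa , _ , nil (λ _ → refl) ,
      (λ p → trans (e p) (trans (cong (λ g → a p + x p * g) (z p))
        (solve 3 (λ a x ρ → a :+ x :* con false := a :+ (x :+ ρ) :* con false) refl (a p) (x p) ρ)))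
    rootDivision ρ (cons {a = a} Aa Pg@(cons _ _ _) e)
      with c , Ac , h , Ph , e' ← rootDivision ρ Pg =
      _ , subA .add Aa (subA .scale ρ Ac) , _ , cons Ac Ph (λ _ → refl) ,
      (λ p → trans (e p) (trans (cong (λ g → a p + x p * g) (e' p))
        (solve 5 (λ a x ρ c h → a :+ x :* (c :+ (x :+ ρ) :* h) := (a :+ ρ :* c) :+ (x :+ ρ) :* (c :+ x :* h))
          refl (a p) (x p) ρ (c p) (h p))))

    monomial : ∀ {k a} e → e ℕ.< k → A a → Poly x A k (λ p → x p ^ e * a p)
    monomial {suc k} zero _ Aa = polySubspace (suc k) .resp (λ p → sym (*-identityˡ _)) (constant Aa)
    monomial {suc k} (suc e) (s≤s lt) Aa =
      polySubspace (suc k) .resp (λ p → sym (*-assoc (x p) _ _)) (shift (monomial e lt Aa))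

    polyIn : ∀ {Z k f} → Subspace Z →
      (∀ {a} e → e ℕ.< k → A a → Z (λ p → x p ^ e * a p)) → Poly x A k f → Z f
    polyIn subZ hyp (nil z) = subZ .resp (λ p → sym (z p)) (subZ .null)
    polyIn subZ hyp (cons Aa Pg e) = subZ .resp (λ p → sym (e p))
      (subZ .add
        (subZ .resp (λ p → *-identityˡ _) (hyp 0 (s≤s z≤n) Aa))
        (polyIn (preimage x subZ)
          (λ e' lt Aa' → subZ .resp (λ p → *-assoc (x p) _ _) (hyp (suc e') (s≤s lt) Aa')) Pg))

  polyMap : ∀ {x A B D f} (h : Fun) → (∀ {a} → A a → B (λ p → h p * a p)) →
    Poly x A D f → Poly x B D (λ p → h p * f p)
  polyMap h hyp (nil z) = nil (λ p → trans (cong (h p *_) (z p)) (zeroʳ (h p)))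
  polyMap {x = x} h hyp (cons Aa Pg e) = cons (hyp Aa) (polyMap h hyp Pg)
    (λ p → trans (cong (h p *_) (e p))
      (solve 4 (λ h a x g → h :* (a :+ x :* g) := h :* a :+ x :* (h :* g)) refl (h p) _ (x p) _))

  module _ {x : Fun} {A : Fun → Set} (subA : Subspace A) where

    private
      subP = polySubspace {x} subA

    polyRoots : ∀ {D f} ρs → Poly x A D f → Poly x A (length ρs ℕ.+ D) (λ p → rootProd ρs (x p) * f p)
    polyRoots {D} [] Pf = subP D .resp (λ p → sym (*-identityˡ _)) Pf
    polyRoots {D} (ρ ∷ ρs) Pf =
      subP (suc (length ρs ℕ.+ D)) .resp (λ p → sym (*-assoc _ _ _)) (linear subA ρ (polyRoots ρs Pf))

    -- The function `c` is carried along because the remainder of `v` in `twoFactors` lies in `A`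
    -- and need not be a scalar.
    rootRemainder : ∀ {c} ρ γs → A c →
      ∃ λ h → Poly x A (length γs) h ×
        (∀ p → rootProd γs (x p) * c p ≡ rootProd γs ρ * c p + (x p + ρ) * h p)
    rootRemainder {c} ρ [] Ac = _ , nil (λ _ → refl) ,
      (λ p → solve 3 (λ c x ρ → con true :* c := con true :* c :+ (x :+ ρ) :* con false) refl (c p) (x p) ρ)
    rootRemainder {c} ρ (γ ∷ γs) Ac with h , Ph , e ← rootRemainder ρ γs Ac =
      _ , subP (suc (length γs)) .add (constant subA (subA .scale (rootProd γs ρ) Ac)) (linear subA γ Ph) ,
      (λ p → trans (*-assoc _ _ _) (trans (cong ((x p + γ) *_) (e p))
        (solve 6 (λ x γ ρ g c h → (x :+ γ) :* (g :* c :+ (x :+ ρ) :* h) :=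
            (ρ :+ γ) :* g :* c :+ (x :+ ρ) :* (g :* c :+ (x :+ γ) :* h))
          refl (x p) γ ρ (rootProd γs ρ) (c p) (h p))))

    -- Every polynomial of degree below deg R + deg G is a combination of R and G when R and G are coprime.
    twoFactors : ∀ {Z v} ρs γs → All (λ ρ → rootProd γs ρ ≢ 0#) ρs → Subspace Z →
      (∀ {a} → Poly x A (length ρs) a → Z (λ p → rootProd γs (x p) * a p)) →
      (∀ {b} → Poly x A (length γs) b → Z (λ p → rootProd ρs (x p) * b p)) →
      Poly x A (length ρs ℕ.+ length γs) v → Z v
    twoFactors [] γs _ subZ hγ hρ Pv = subZ .resp (λ p → *-identityˡ _) (hρ Pv)
    twoFactors {Z} {v} (ρ ∷ ρs) γs (nz ∷ nzs) subZ hγ hρ Pv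
      with c , Ac , h , Ph , e ← rootDivision subA ρ Pv
      -- Scaled by the inverse of `rootProd γs ρ`, the second product has the same remainder `c` as
      -- `v`, so the difference is divisible by `x + ρ`.
      with h' , Ph' , e' ← rootRemainder ρ γs (subA .scale (rootProd γs ρ ⁻¹) Ac) =
      subZ .resp split (subZ .add
        (hγ (constant subA (subA .scale (rootProd γs ρ ⁻¹) Ac)))
        (twoFactors ρs γs nzs (preimage (λ p → x p + ρ) subZ)
          (λ Pa → subZ .resp
            (λ p → solve 3 (λ g l a → g :* (l :* a) := l :* (g :* a)) refl (rootProd γs (x p)) (x p + ρ) _)
            (hγ (linear subA ρ Pa)))
          (λ Pb → subZ .resp (λ p → *-assoc _ _ _) (hρ Pb))
          (subP (length ρs ℕ.+ length γs) .add Ph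
            (weaken subA (ℕ.m≤n+m (length γs) (length ρs)) Ph'))))
      where
      split : ∀ p → rootProd γs (x p) * (rootProd γs ρ ⁻¹ * c p) + (x p + ρ) * (h p + h' p) ≡ v p
      split p rewrite e' p | e p =
        trans (solve 6 (λ g g' c l h h' → (g :* (g' :* c) :+ l :* h') :+ l :* (h :+ h') := (g :* g') :* c :+ l :* h)
          refl (rootProd γs ρ) (rootProd γs ρ ⁻¹) (c p) (x p + ρ) (h p) (h' p))
          (trans (cong (λ u → u * c p + (x p + ρ) * h p) (inverseʳ nz))
            (cong (_+ ((x p + ρ) * h p)) (*-identityˡ _)))

    module _ {Ix : Set} {k : ℕ} (roots : Ix → List Carrier) (length-roots : ∀ i → length (roots i) ≡ k)
      (disjoint : ∀ {i j ρ} → i ≢ j → ρ ∈ roots i → rootProd (roots j) ρ ≢ 0#) where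

      length-concat : ∀ I → length (concatMap roots I) ≡ length I ℕ.* k
      length-concat [] = refl
      length-concat (i ∷ I) = trans (length-++ (roots i)) (cong₂ ℕ._+_ (length-roots i) (length-concat I))

      concat-nonzero : ∀ {ρ} I → All (λ j → rootProd (roots j) ρ ≢ 0#) I → rootProd (concatMap roots I) ρ ≢ 0#
      concat-nonzero [] [] eq = 0≢1 (sym eq)
      concat-nonzero {ρ} (j ∷ I) (nz ∷ nzs) eq =
        noZeroDivisors nz (concat-nonzero I nzs) (trans (sym (rootProd-++ (roots j) _ ρ)) eq)

      -- Distinct indices have coprime products, so `twoFactors` splits off one index at a time.
      -- This reduces membership in `Z` to multiples of the product over all indices but one, with
      -- cofactors of degree below `k`.
      partialFractions : ∀ {Z v} I → Unique I → Subspace Z →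
        (∀ {i r} (i∈I : i ∈ I) → Poly x A k r → Z (λ p → rootProd (concatMap roots (I ─ i∈I)) (x p) * r p)) →
        Poly x A (length I ℕ.* k) v → Z v
      partialFractions [] _ subZ hyp (nil z) = subZ .resp (λ p → sym (z p)) (subZ .null)
      partialFractions {Z} {v} (i ∷ I) (i∉I ∷ uI) subZ hyp Pv =
        twoFactors (roots i) (concatMap roots I)
          (All.tabulate λ ρ∈ → concat-nonzero I (All.map (λ i≢j → disjoint i≢j ρ∈) i∉I))
          subZ
          (λ {a} Pa → hyp (here refl) (subst (λ D → Poly x A D a) (length-roots i) Pa))
          (λ {b} Pb → partialFractions I uI (preimage (λ p → rootProd (roots i) (x p)) subZ)
            (λ j∈I Pr → subZ .resp
              (λ p → trans (cong (_* _) (rootProd-++ (roots i) _ (x p))) (*-assoc _ _ _))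
              (hyp (there j∈I) Pr))
            (subst (λ D → Poly x A D b) (length-concat I) Pb))
          (subst (λ D → Poly x A D v) (cong₂ ℕ._+_ (sym (length-roots i)) (sym (length-concat I))) Pv)

  Constant : Fun → Set
  Constant f = ∃ λ c → ∀ p → f p ≡ c

  constantSubspace : Subspace Constant
  constantSubspace .resp e (c , h) = c , λ p → trans (sym (e p)) (h p)
  constantSubspace .null = 0# , λ _ → refl
  constantSubspace .add (c , h) (c' , h') = c + c' , λ p → cong₂ _+_ (h p) (h' p)
  constantSubspace .scale a (c , h) = a * c , λ p → cong (a *_) (h p)

  length-─ : ∀ {I : Set} {i : I} {is n} (i∈ : i ∈ is) → length is ≡ suc n → length (is ─ i∈) ≡ n
  length-─ (here _) eq = ℕ.suc-injective eq
  length-─ {n = zero} (there {xs = _ ∷ _} i∈) ()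
  length-─ {n = suc n} (there i∈) eq = cong suc (length-─ i∈ (ℕ.suc-injective eq))

  All-─ : ∀ {I : Set} {P : I → Set} {i : I} {is} (i∈ : i ∈ is) → All P is → All P (is ─ i∈)
  All-─ (here _) (_ ∷ ps) = ps
  All-─ (there i∈) (p ∷ ps) = p ∷ All-─ i∈ ps

  Unique-─ : ∀ {I : Set} {i : I} {is} (i∈ : i ∈ is) → Unique is → Unique (is ─ i∈)
  Unique-─ (here _) (_ ∷ u) = u
  Unique-─ (there i∈) (n ∷ u) = All-─ i∈ n ∷ Unique-─ i∈ u

  rootProd-─ : ∀ {I : Set} (roots : I → List Carrier) v {i : I} {is} (i∈ : i ∈ is) →
    rootProd (concatMap roots is) v ≡ rootProd (roots i) v * rootProd (concatMap roots (is ─ i∈)) v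
  rootProd-─ roots v (here refl) = rootProd-++ (roots _) _ v
  rootProd-─ roots v {i} {j ∷ is} (there i∈) =
    trans (rootProd-++ (roots j) _ v) (trans (cong (rootProd (roots j) v *_) (rootProd-─ roots v i∈))
      (trans (solve 3 (λ a b c → a :* (b :* c) := b :* (a :* c)) refl
          (rootProd (roots j) v) (rootProd (roots i) v) (rootProd (concatMap roots (is ─ i∈)) v))
        (cong (rootProd (roots i) v *_) (sym (rootProd-++ (roots j) _ v)))))

  module Sylvester {Ix : Set} {k : ℕ} (x : ℕ → Fun) (roots : ℕ → Ix → List Carrier)
    (length-roots : ∀ l i → length (roots l i) ≡ k)
    (disjoint : ∀ l {i j ρ} → i ≢ j → ρ ∈ roots l i → rootProd (roots l j) ρ ≢ 0#) where

    f : ℕ → Ix → Fun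
    f = factorProd x roots

    -- In the variable x l, where 1 ≤ l ≤ t, the degree is below (l + 1) k in V t and below l k in
    -- W t, so that V t has the same dimension as t + 1 copies of W t.
    V W : ℕ → Fun → Set
    V zero = Constant
    V (suc t) = Poly (x (suc t)) (V t) (suc (suc t) ℕ.* k)
    W zero = Constant
    W (suc t) = Poly (x (suc t)) (W t) (suc t ℕ.* k)

    subV : ∀ t → Subspace (V t)
    subV zero = constantSubspace
    subV (suc t) = polySubspace (subV t) _

    subW : ∀ t → Subspace (W t)
    subW zero = constantSubspace
    subW (suc t) = polySubspace (subW t) _

    -- Each factor of `f t i` raises the degree in its own variable by `k`, the difference between
    -- the bounds in `V` and `W`.
    f*W⊆V : ∀ t i {w} → W t w → V t (λ p → f t i p * w p)
    f*W⊆V zero i (c , h) = c , λ p → trans (*-identityˡ _) (h p)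
    f*W⊆V (suc t) i {w} Ww = subV (suc t) .resp (λ p → sym (*-assoc _ _ _))
      (subst (λ D → Poly (x (suc t)) (V t) D (λ p → rootProd (roots (suc t) i) (x (suc t) p) * (f t i p * w p)))
        (cong (ℕ._+ suc t ℕ.* k) (length-roots (suc t) i))
        (polyRoots (subV t) (roots (suc t) i) (polyMap (f t i) (f*W⊆V t i) Ww)))

    one∈V : 1 ℕ.≤ k → ∀ t → V t (λ _ → 1#)
    one∈V k≥1 zero = 1# , λ _ → refl
    one∈V k≥1 (suc t) = weaken (subV t) (ℕ.≤-trans k≥1 (ℕ.m≤m+n k _)) (constant (subV t) {0} (one∈V k≥1 t))

    -- V t is the sum of the f t i * W t over any t + 1 indices i.  By partial fractions in the last
    -- variable it suffices to treat multiples of the factors of all indices but one, and those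
    -- remaining t indices serve for the other variables.
    spanning : ∀ t {Z v} I → Unique I → length I ≡ suc t → Subspace Z →
      (∀ {i w} → i ∈ I → W t w → Z (λ p → f t i p * w p)) → V t v → Z v
    spanning zero (i ∷ []) _ _ subZ hyp Vv = subZ .resp (λ p → *-identityˡ _) (hyp (here refl) Vv)
    spanning (suc t) {Z} {v} I uI lI subZ hyp Vv =
      partialFractions (subV t) (roots (suc t)) (length-roots (suc t)) (disjoint (suc t)) I uI subZ
        (λ j∈I Pr → polyIn (subV t) (preimage _ subZ) (monomials j∈I) Pr)
        (subst (λ n → Poly (x (suc t)) (V t) (n ℕ.* k) v) (sym lI) Vv)
      where
      g : Ix → Fun
      g i p = rootProd (roots (suc t) i) (x (suc t) p)

      G : List Ix → Fun
      G J p = rootProd (concatMap (roots (suc t)) J) (x (suc t) p)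

      monomials : ∀ {j a} (j∈I : j ∈ I) e → e ℕ.< k → V t a →
        Z (λ p → G (I ─ j∈I) p * (x (suc t) p ^ e * a p))
      monomials j∈I e e<k Va = spanning t (I ─ j∈I) (Unique-─ j∈I uI) (length-─ j∈I lI)
        (preimage (λ p → x (suc t) p ^ e) (preimage (G (I ─ j∈I)) subZ)) generator Va
        where
        generator : ∀ {i w} → i ∈ (I ─ j∈I) → W t w →
          Z (λ p → G (I ─ j∈I) p * (x (suc t) p ^ e * (f t i p * w p)))
        generator {i} {w} i∈ Ww = subZ .resp
          (λ p → trans
            (solve 5 (λ g f G y w → g :* f :* (G :* (y :* w)) := g :* G :* (y :* (f :* w))) refl
              (g i p) (f t i p) (G ((I ─ j∈I) ─ i∈) p) (x (suc t) p ^ e) (w p))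
            (cong (_* _) (sym (rootProd-─ (roots (suc t)) (x (suc t) p) i∈))))
          -- Besides `j` and `i` there remain `t` indices; their product times a power below `k` has
          -- degree below `suc t * k`, as `W (suc t)` requires.
          (hyp (∈-─ j∈I i∈)
            (subst (λ D → Poly (x (suc t)) (W t) D (λ p → G ((I ─ j∈I) ─ i∈) p * (x (suc t) p ^ e * w p)))
              (trans (ℕ.+-comm _ k) (cong (k ℕ.+_)
                (trans (length-concat {x (suc t)} (subW t) (roots (suc t)) (length-roots (suc t)) (disjoint (suc t)) ((I ─ j∈I) ─ i∈))
                  (cong (ℕ._* k) (length-─ i∈ (length-─ j∈I lI))))))
              (polyRoots (subW t) (concatMap (roots (suc t)) ((I ─ j∈I) ─ i∈)) (monomial (subW t) e e<k Ww))))
          where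
          ∈-─ : ∀ {I : Set} {i j : I} {is} (j∈ : j ∈ is) → i ∈ (is ─ j∈) → i ∈ is
          ∈-─ (here _) i∈ = there i∈
          ∈-─ (there j∈) (here e) = here e
          ∈-─ (there j∈) (there i∈) = there (∈-─ j∈ i∈)

-- Linear functionals on a finite set

module LinearAlgebra (F : BinaryField) where
  open BinaryField F
  open CommutativeSemiring commutativeSemiring
    using (+-identityˡ; +-identityʳ; *-identityʳ; zeroˡ; zeroʳ; *-comm; *-assoc; distribˡ; distribʳ; semiring)
  open Char2Solver commutativeSemiring char2 using (solve; _:=_; _:+_; _:*_; con)
  open import Algebra.Properties.CommutativeSemiring.Exp commutativeSemiring using (_^_)
  open FieldProperties F using (noZeroDivisors)
  open ≡-Reasoning
  open import Algebra.Properties.Semiring.Sum semiring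
    using (sum; sum-cong-≗; sum-remove; ∑-distrib-+; *-distribˡ-sum; sum-replicate-zero)

  abstract
    ⟨_,_⟩ : ∀ {n} → (Fin n → Carrier) → (Fin n → Carrier) → Carrier
    ⟨ w , g ⟩ = sum (λ p → w p * g p)

    pairing-cong : ∀ {n} (w : Fin n → Carrier) {g h} → (∀ p → g p ≡ h p) → ⟨ w , g ⟩ ≡ ⟨ w , h ⟩
    pairing-cong w e = sum-cong-≗ (λ p → cong (w p *_) (e p))

    pairing-add : ∀ {n} (w g h : Fin n → Carrier) → ⟨ w , (λ p → g p + h p) ⟩ ≡ ⟨ w , g ⟩ + ⟨ w , h ⟩
    pairing-add w g h = trans (sum-cong-≗ (λ p → distribˡ (w p) (g p) (h p))) (∑-distrib-+ (λ p → w p * g p) (λ p → w p * h p))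

    pairing-scale : ∀ {n} a (w g : Fin n → Carrier) → ⟨ w , (λ p → a * g p) ⟩ ≡ a * ⟨ w , g ⟩
    pairing-scale a w g = trans
      (sum-cong-≗ (λ p → solve 3 (λ w a g → w :* (a :* g) := a :* (w :* g)) refl (w p) a (g p)))
      (sym (*-distribˡ-sum a (λ p → w p * g p)))

    pairing-suc : ∀ {n} (w g : Fin (suc n) → Carrier) →
      ⟨ w , g ⟩ ≡ w zero * g zero + ⟨ (λ p → w (suc p)) , (λ p → g (suc p)) ⟩
    pairing-suc w g = refl

    pairing-null : ∀ {n} {w : Fin n → Carrier} g → (∀ p → w p ≡ 0#) → ⟨ w , g ⟩ ≡ 0#
    pairing-null {n} g e = trans (sum-cong-≗ (λ p → trans (cong (_* g p) (e p)) (zeroˡ (g p)))) (sum-replicate-zero n)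

    pairing-move : ∀ {n} (w x g : Fin n → Carrier) → ⟨ w , (λ p → x p * g p) ⟩ ≡ ⟨ (λ p → w p * x p) , g ⟩
    pairing-move w x g = sum-cong-≗ (λ p → sym (*-assoc (w p) (x p) (g p)))

    pairing-comm : ∀ {n} (w g : Fin n → Carrier) → ⟨ w , g ⟩ ≡ ⟨ g , w ⟩
    pairing-comm w g = sum-cong-≗ (λ p → *-comm (w p) (g p))

    pairing-insert : ∀ {n} (w : Fin n → Carrier) i (g : Fin (suc n) → Carrier) →
      ⟨ insertAt w i 0# , g ⟩ ≡ ⟨ w , (λ p → g (punchIn i p)) ⟩
    pairing-insert w i g = trans (sum-remove {i = i} (λ p → insertAt w i 0# p * g p))
      (trans (cong₂ _+_ (trans (cong (_* g i) (insertAt-lookup w i 0#)) (zeroˡ (g i)))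
          (sum-cong-≗ (λ p → cong (_* g (punchIn i p)) (insertAt-punchIn w i 0# p))))
        (+-identityˡ _))

  -- Two solutions for the remaining vectors, with different supports, combine to one which also kills b.
  annihilator : ∀ {n} (B : List (Fin n → Carrier)) → length B ℕ.< n →
    ∃ λ w → (∃ λ p → w p ≢ 0#) × All (λ b → ⟨ w , b ⟩ ≡ 0#) B
  annihilator {suc n} [] _ = (λ _ → 1#) , (zero , λ eq → 0≢1 (sym eq)) , []
  annihilator {suc n} (b ∷ B) (s≤s lt) = result
    where
    without : ∀ i → ∃ λ w → w i ≡ 0# × (∃ λ p → w (punchIn i p) ≢ 0#) × All (λ b → ⟨ w , b ⟩ ≡ 0#) B
    without i with w , (p , wp≢0) , kills ← annihilator (map (λ g p → g (punchIn i p)) B) (subst (ℕ._< n) (sym (length-map _ B)) lt) =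
      insertAt w i 0# , insertAt-lookup w i 0# ,
      (p , λ eq → wp≢0 (trans (sym (insertAt-punchIn w i 0# p)) eq)) ,
      All.map (λ {g} e → trans (pairing-insert w i g) e) (All.map⁻ kills)

    result : ∃ λ w → (∃ λ p → w p ≢ 0#) × All (λ b → ⟨ w , b ⟩ ≡ 0#) (b ∷ B)
    result with u , _ , (p , up≢0) , killsU ← without zero
           with v , vp≡0 , (p' , vp'≢0) , killsV ← without (suc p)
           with ⟨ v , b ⟩ ≟ 0#
    ... | yes e = v , (_ , vp'≢0) , e ∷ killsV
    ... | no β≢0 = w , (suc p , nonzero) ,
          trans (pairing-w b) (solve 2 (λ α β → β :* α :+ α :* β := con false) refl α β) ∷
          All.map (λ {g} (eu , ev) → trans (pairing-w g) (trans (cong₂ (λ a c → β * a + α * c) eu ev)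
              (solve 2 (λ α β → β :* con false :+ α :* con false := con false) refl α β)))
            (All.zip (killsU , killsV))
      where
      α = ⟨ u , b ⟩
      β = ⟨ v , b ⟩

      w : Fin (suc n) → Carrier
      w q = β * u q + α * v q

      pairing-w : ∀ g → ⟨ w , g ⟩ ≡ β * ⟨ u , g ⟩ + α * ⟨ v , g ⟩
      pairing-w g = trans (pairing-comm w g) (trans (pairing-add g (λ q → β * u q) (λ q → α * v q))
        (cong₂ _+_ (trans (pairing-scale β g u) (cong (β *_) (pairing-comm g u)))
                   (trans (pairing-scale α g v) (cong (α *_) (pairing-comm g v)))))

      nonzero : w (suc p) ≢ 0#
      nonzero eq = noZeroDivisors β≢0 up≢0
        (trans (solve 3 (λ β u α → β :* u := β :* u :+ α :* con false) refl β (u (suc p)) α)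
          (trans (cong (λ t → β * u (suc p) + α * t) (sym vp≡0)) eq))

  -- Replacing `w` by `w * (z + z zero)` keeps all moments zero and removes the first point, so the
  -- other weights vanish by induction. The zeroth moment then settles the first.
  vandermonde : ∀ n (w z : Fin n → Carrier) → (∀ {p q} → z p ≡ z q → p ≡ q) →
    (∀ e → ⟨ w , (λ p → z p ^ e) ⟩ ≡ 0#) → ∀ p → w p ≡ 0#
  vandermonde (suc n) w z inj moments = λ { zero → first ; (suc p) → rest p }
    where
    u : Fin (suc n) → Carrier
    u p = w p * (z p + z zero)

    uMoments : ∀ e → ⟨ u , (λ p → z p ^ e) ⟩ ≡ 0#
    uMoments e = begin
      ⟨ u , (λ p → z p ^ e) ⟩
        ≡⟨ pairing-move w (λ p → z p + z zero) (λ p → z p ^ e) ⟨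
      ⟨ w , (λ p → (z p + z zero) * z p ^ e) ⟩
        ≡⟨ pairing-cong w (λ p → distribʳ (z p ^ e) (z p) (z zero)) ⟩
      ⟨ w , (λ p → z p * z p ^ e + z zero * z p ^ e) ⟩
        ≡⟨ pairing-add w (λ p → z p * z p ^ e) (λ p → z zero * z p ^ e) ⟩
      ⟨ w , (λ p → z p ^ suc e) ⟩ + ⟨ w , (λ p → z zero * z p ^ e) ⟩
        ≡⟨ cong₂ _+_ (moments (suc e)) (trans (pairing-scale (z zero) w (λ p → z p ^ e)) (trans (cong (z zero *_) (moments e)) (zeroʳ _))) ⟩
      0# + 0#
        ≡⟨ +-identityˡ 0# ⟩
      0# ∎

    tailMoments : ∀ e → ⟨ (λ p → u (suc p)) , (λ p → z (suc p) ^ e) ⟩ ≡ 0#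
    tailMoments e = begin
      ⟨ (λ p → u (suc p)) , (λ p → z (suc p) ^ e) ⟩
        ≡⟨ +-identityˡ _ ⟨
      0# + ⟨ (λ p → u (suc p)) , (λ p → z (suc p) ^ e) ⟩
        ≡⟨ cong (_+ ⟨ (λ p → u (suc p)) , (λ p → z (suc p) ^ e) ⟩)
             (solve 3 (λ w z y → con false := w :* (z :+ z) :* y) refl (w zero) (z zero) (z zero ^ e)) ⟩
      u zero * z zero ^ e + ⟨ (λ p → u (suc p)) , (λ p → z (suc p) ^ e) ⟩
        ≡⟨ pairing-suc u (λ p → z p ^ e) ⟨
      ⟨ u , (λ p → z p ^ e) ⟩
        ≡⟨ uMoments e ⟩
      0# ∎

    rest : ∀ p → w (suc p) ≡ 0#
    rest p with w (suc p) ≟ 0#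
    ... | yes e = e
    ... | no w≢0 = ⊥-elim (noZeroDivisors w≢0 diff
            (vandermonde n (λ q → u (suc q)) (λ q → z (suc q)) (λ eq → Fin.suc-injective (inj eq)) tailMoments p))
      where
      diff : z (suc p) + z zero ≢ 0#
      diff eq with () ← inj {suc p} {zero} (trans (solve 2 (λ a b → a := a :+ b :+ b) refl (z (suc p)) (z zero)) (trans (cong (_+ z zero) eq) (+-identityˡ _)))

    first : w zero ≡ 0#
    first = begin
      w zero                ≡⟨ *-identityʳ _ ⟨
      w zero * 1#           ≡⟨ +-identityʳ _ ⟨
      w zero * 1# + 0#      ≡⟨ cong (w zero * 1# +_) (pairing-null (λ _ → 1#) rest) ⟨
      w zero * 1# + ⟨ (λ p → w (suc p)) , (λ _ → 1#) ⟩ ≡⟨ pairing-suc w (λ _ → 1#) ⟨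
      ⟨ w , (λ _ → 1#) ⟩    ≡⟨ moments 0 ⟩
      0#                    ∎

-- The bound on the number of solutions

module SolutionCount (F : BinaryField) where
  open BinaryField F
  open CommutativeSemiring commutativeSemiring
    using (+-identityˡ; +-identityʳ; *-identityˡ; *-identityʳ; zeroˡ; zeroʳ; *-comm; *-assoc)
  open Char2Solver commutativeSemiring char2 using (solve; _:=_; _:+_; _:*_; con)
  open import Algebra.Properties.CommutativeSemiring.Exp commutativeSemiring using (_^_)
  open FieldProperties F using (noZeroDivisors; rootProd)
  open LinearAlgebra F
  open ≡-Reasoning

  module _ {σ : ℕ} where
    open Spaces F (Fin σ)
    open Subspace

    kernel : (w : Fin σ → Carrier) → Subspace (λ g → ⟨ w , g ⟩ ≡ 0#)
    kernel w .resp e eq = trans (pairing-cong w (λ p → sym (e p))) eq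
    kernel w .null = trans (pairing-comm w _) (pairing-null w (λ _ → refl))
    kernel w .add {f} {g} ef eg = trans (pairing-add w f g) (trans (cong₂ _+_ ef eg) (+-identityˡ 0#))
    kernel w .scale {f} a ef = trans (pairing-scale a w f) (trans (cong (a *_) ef) (zeroʳ a))

    polyBasis : Fun → List Fun → ℕ → List Fun
    polyBasis x B zero = []
    polyBasis x B (suc D) = B ++ map (λ b p → x p * b p) (polyBasis x B D)

    length-polyBasis : ∀ x B D → length (polyBasis x B D) ≡ D ℕ.* length B
    length-polyBasis x B zero = refl
    length-polyBasis x B (suc D) =
      trans (length-++ B) (cong (length B ℕ.+_) (trans (length-map _ (polyBasis x B D)) (length-polyBasis x B D)))

    -- The hypothesis concerns all functionals because the factor `x` of the tail is moved into the
    -- functional, turning `w` into `w * x`.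
    kills-poly : ∀ {x A B} →
      (∀ w → All (λ b → ⟨ w , b ⟩ ≡ 0#) B → ∀ {a} → A a → ⟨ w , a ⟩ ≡ 0#) →
      ∀ D w → All (λ b → ⟨ w , b ⟩ ≡ 0#) (polyBasis x B D) → ∀ {f} → Poly x A D f → ⟨ w , f ⟩ ≡ 0#
    kills-poly kA zero w _ (nil z) = kernel w .resp (λ p → sym (z p)) (kernel w .null)
    kills-poly {x} {A} {B} kA (suc D) w all (cons {g = g} Aa Pg e) = kernel w .resp (λ p → sym (e p))
      (kernel w .add (kA w (All.++⁻ˡ B all) Aa)
        (trans (pairing-move w x g)
          (kills-poly kA D (λ p → w p * x p)
            (All.map (λ {b} eq → trans (sym (pairing-move w x b)) eq) (All.map⁻ (All.++⁻ʳ B all))) Pg)))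

  -- With `x = a + 1 / z`, each `x + ρ` equals `(1 + (a + ρ) z) / z`; these are the numerators.
  reciprocalProd : Carrier → List Carrier → Carrier → Carrier
  reciprocalProd a [] z = 1#
  reciprocalProd a (ρ ∷ ρs) z = (1# + (a + ρ) * z) * reciprocalProd a ρs z

  reciprocal : ∀ {x a z} ρs → (x + a) * z ≡ 1# → reciprocalProd a ρs z ≡ z ^ length ρs * rootProd ρs x
  reciprocal [] _ = sym (*-identityˡ 1#)
  reciprocal {x} {a} {z} (ρ ∷ ρs) e = begin
    (1# + (a + ρ) * z) * reciprocalProd a ρs z
      ≡⟨ cong₂ (λ u v → (u + (a + ρ) * z) * v) (sym e) (reciprocal ρs e) ⟩
    ((x + a) * z + (a + ρ) * z) * (z ^ length ρs * rootProd ρs x)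
      ≡⟨ solve 6 (λ x a z ρ y r → ((x :+ a) :* z :+ (a :+ ρ) :* z) :* (y :* r) := z :* y :* ((x :+ ρ) :* r)) refl
           x a z ρ (z ^ length ρs) (rootProd ρs x) ⟩
    z * z ^ length ρs * ((x + ρ) * rootProd ρs x) ∎

  -- This is `(t + 1)! k^t`, the product over `1 ≤ l ≤ t` of the degree bounds `(l + 1) k` in `V t`.
  dimension : ℕ → ℕ → ℕ
  dimension k zero = 1
  dimension k (suc t) = suc (suc t) ℕ.* k ℕ.* dimension k t

  -- The setting is that of `σ` solutions of `t + 2` equations in `x 0`, ..., `x t` and `y`. That
  -- the `x l` are conjugates enters only in the application.
  module _ {σ k t : ℕ} (k≥1 : 1 ℕ.≤ k) (x : ℕ → Fin σ → Carrier)
    (roots : ℕ → Fin (suc (suc t)) → List Carrier)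
    (length-roots : ∀ l i → length (roots l i) ≡ k)
    (disjoint : ∀ l {i j ρ} → i ≢ j → ρ ∈ roots l i → ρ ∉ roots l j)
    (x-injective : ∀ {p q} → x 0 p ≡ x 0 q → p ≡ q)
    (c : Fin (suc (suc t)) → Carrier) (y : Fin σ → Carrier)
    (c≢0 : ∀ i → c i ≢ 0#) (y≢0 : ∀ p → y p ≢ 0#) where

    open Spaces F (Fin σ)
    open Subspace

    rootProd-nonzero : ∀ {v} ρs → v ∉ ρs → rootProd ρs v ≢ 0#
    rootProd-nonzero [] _ eq = 0≢1 (sym eq)
    rootProd-nonzero {v} (ρ ∷ ρs) v∉ = noZeroDivisors
      (λ eq → v∉ (here (trans (solve 2 (λ v ρ → v := v :+ ρ :+ ρ) refl v ρ) (trans (cong (_+ ρ) eq) (+-identityˡ ρ)))))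
      (rootProd-nonzero ρs (λ v∈ → v∉ (there v∈)))

    rootProd-zero : ∀ {v} ρs → v ∈ ρs → rootProd ρs v ≡ 0#
    rootProd-zero {v} (ρ ∷ ρs) (here refl) = trans (cong (_* rootProd ρs v) (char2 v)) (zeroˡ _)
    rootProd-zero {v} (ρ ∷ ρs) (there v∈) = trans (cong ((v + ρ) *_) (rootProd-zero ρs v∈)) (zeroʳ _)

    open Sylvester x roots length-roots (λ l i≢j ρ∈ → rootProd-nonzero (roots l _) (disjoint l i≢j ρ∈))

    basisV : ℕ → List Fun
    basisV zero = (λ _ → 1#) ∷ []
    basisV (suc t) = polyBasis (x (suc t)) (basisV t) (suc (suc t) ℕ.* k)

    length-basisV : ∀ t → length (basisV t) ≡ dimension k t
    length-basisV zero = refl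
    length-basisV (suc t) = trans (length-polyBasis (x (suc t)) (basisV t) (suc (suc t) ℕ.* k)) (cong (suc (suc t) ℕ.* k ℕ.*_) (length-basisV t))

    kills-V : ∀ t w → All (λ b → ⟨ w , b ⟩ ≡ 0#) (basisV t) → ∀ {v} → V t v → ⟨ w , v ⟩ ≡ 0#
    kills-V zero w (eq ∷ []) (c , e) =
      kernel w .resp (λ p → trans (*-identityʳ c) (sym (e p))) (kernel w .scale c eq)
    kills-V (suc t) w all Vv = kills-poly (kills-V t) _ w all Vv

    module _ (equations : ∀ i p → rootProd (roots 0 i) (x 0 p) * f t i p ≡ c i * y p)
      (σ> : k ℕ.* dimension k t ℕ.< σ) where

      private
        -- Inverting at a root of the equation with index zero makes `G zero` lose its leading term
        -- in `z`, while by disjointness the other `G i` keep theirs. This asymmetry drives the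
        -- elimination.
        firstRoot : ∃ λ a → a ∈ roots 0 zero
        firstRoot with roots 0 zero | length-roots 0 zero
        ... | [] | eq = ⊥-elim (ℕ.n≮0 (subst (1 ℕ.≤_) (sym eq) k≥1))
        ... | a ∷ _ | _ = a , here refl

        a = proj₁ firstRoot

        x+a≢0 : ∀ p → x 0 p + a ≢ 0#
        x+a≢0 p eq = noZeroDivisors (c≢0 zero) (y≢0 p)
          (trans (sym (equations zero p)) (trans (cong (_* f t zero p)
            (rootProd-zero (roots 0 zero) (subst (_∈ roots 0 zero) (sym x≡a) (proj₂ firstRoot)))) (zeroˡ _)))
          where
          x≡a : x 0 p ≡ a
          x≡a = trans (solve 2 (λ v ρ → v := v :+ ρ :+ ρ) refl (x 0 p) a) (trans (cong (_+ a) eq) (+-identityˡ a))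

        z : Fun
        z p = (x 0 p + a) ⁻¹

        z-injective : ∀ {p q} → z p ≡ z q → p ≡ q
        z-injective {p} {q} eq = x-injective (begin
          x 0 p ≡⟨ solve 2 (λ v ρ → v := v :+ ρ :+ ρ) refl (x 0 p) a ⟩
          x 0 p + a + a ≡⟨ cong (_+ a) same ⟩
          x 0 q + a + a ≡⟨ solve 2 (λ v ρ → v :+ ρ :+ ρ := v) refl (x 0 q) a ⟩
          x 0 q ∎)
          where
          same : x 0 p + a ≡ x 0 q + a
          same = begin
            x 0 p + a ≡⟨ *-identityʳ _ ⟨
            (x 0 p + a) * 1# ≡⟨ cong ((x 0 p + a) *_) (inverseʳ (x+a≢0 q)) ⟨
            (x 0 p + a) * ((x 0 q + a) * z q) ≡⟨ cong (λ u → (x 0 p + a) * ((x 0 q + a) * u)) eq ⟨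
            (x 0 p + a) * ((x 0 q + a) * z p) ≡⟨ solve 3 (λ P Q z → P :* (Q :* z) := Q :* (P :* z)) refl (x 0 p + a) (x 0 q + a) (z p) ⟩
            (x 0 q + a) * ((x 0 p + a) * z p) ≡⟨ cong ((x 0 q + a) *_) (inverseʳ (x+a≢0 p)) ⟩
            (x 0 q + a) * 1# ≡⟨ *-identityʳ _ ⟩
            x 0 q + a ∎

        G : Fin (suc (suc t)) → Fun
        G i p = reciprocalProd a (roots 0 i) (z p)

        -- Here `y` is eliminated: both sides are `z ^ k` times `c zero * c i * y`.
        proportional : ∀ i p → c zero * (G i p * f t i p) ≡ c i * (G zero p * f t zero p)
        proportional i p = begin
          c zero * (G i p * f t i p) ≡⟨ cong (c zero *_) (scaled i) ⟩
          c zero * (z p ^ k * (c i * y p))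
            ≡⟨ solve 4 (λ c₀ cᵢ z y → c₀ :* (z :* (cᵢ :* y)) := cᵢ :* (z :* (c₀ :* y))) refl (c zero) (c i) (z p ^ k) (y p) ⟩
          c i * (z p ^ k * (c zero * y p)) ≡⟨ cong (c i *_) (scaled zero) ⟨
          c i * (G zero p * f t zero p) ∎
          where
          scaled : ∀ i → G i p * f t i p ≡ z p ^ k * (c i * y p)
          scaled i = begin
            G i p * f t i p ≡⟨ cong (_* f t i p) (reciprocal (roots 0 i) (inverseʳ (x+a≢0 p))) ⟩
            z p ^ length (roots 0 i) * rootProd (roots 0 i) (x 0 p) * f t i p ≡⟨ *-assoc _ _ _ ⟩
            z p ^ length (roots 0 i) * (rootProd (roots 0 i) (x 0 p) * f t i p)
              ≡⟨ cong₂ (λ n u → z p ^ n * u) (length-roots 0 i) (equations i p) ⟩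
            z p ^ k * (c i * y p) ∎

        module _ (w : Fun) where

          -- reciprocalProd a ρs z has degree length ρs in z, with leading coefficient rootProd ρs a.
          leadingTerm : ∀ ρs e (v : Fun) → (∀ e' → e' ℕ.< e ℕ.+ length ρs → ⟨ w , (λ p → z p ^ e' * v p) ⟩ ≡ 0#) →
            ⟨ w , (λ p → z p ^ e * (reciprocalProd a ρs (z p) * v p)) ⟩ ≡
            rootProd ρs a * ⟨ w , (λ p → z p ^ (e ℕ.+ length ρs) * v p) ⟩
          leadingTerm [] e v low = begin
            ⟨ w , (λ p → z p ^ e * (1# * v p)) ⟩
              ≡⟨ pairing-cong w (λ p → cong₂ (λ n u → z p ^ n * u) (sym (ℕ.+-identityʳ e)) (*-identityˡ (v p))) ⟩
            ⟨ w , (λ p → z p ^ (e ℕ.+ 0) * v p) ⟩ ≡⟨ *-identityˡ _ ⟨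
            1# * ⟨ w , (λ p → z p ^ (e ℕ.+ 0) * v p) ⟩ ∎
          leadingTerm (ρ ∷ ρs) e v low = begin
            ⟨ w , (λ p → z p ^ e * ((1# + (a + ρ) * z p) * R p * v p)) ⟩
              ≡⟨ pairing-cong w (λ p → solve 5 (λ y α z R v →
                   y :* ((con true :+ α :* z) :* R :* v) := y :* (R :* v) :+ α :* (z :* y :* (R :* v))) refl
                   (z p ^ e) (a + ρ) (z p) (R p) (v p)) ⟩
            ⟨ w , (λ p → z p ^ e * (R p * v p) + (a + ρ) * (z p ^ suc e * (R p * v p))) ⟩
              ≡⟨ pairing-add w _ _ ⟩
            ⟨ w , (λ p → z p ^ e * (R p * v p)) ⟩ + ⟨ w , (λ p → (a + ρ) * (z p ^ suc e * (R p * v p))) ⟩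
              ≡⟨ cong₂ _+_
                   (trans (leadingTerm ρs e v (λ e' lt → low e' (ℕ.≤-trans lt (ℕ.+-monoʳ-≤ e (ℕ.n≤1+n _)))))
                     (trans (cong (rootProd ρs a *_) (low (e ℕ.+ length ρs) (ℕ.+-monoʳ-< e ℕ.≤-refl))) (zeroʳ _)))
                   (trans (pairing-scale (a + ρ) w _) (cong ((a + ρ) *_)
                     (leadingTerm ρs (suc e) v (λ e' lt → low e' (subst (e' ℕ.<_) (sym (ℕ.+-suc e _)) lt))))) ⟩
            0# + (a + ρ) * (rootProd ρs a * ⟨ w , (λ p → z p ^ (suc e ℕ.+ length ρs) * v p) ⟩)
              ≡⟨ trans (+-identityˡ _) (sym (*-assoc _ _ _)) ⟩
            (a + ρ) * rootProd ρs a * ⟨ w , (λ p → z p ^ (suc e ℕ.+ length ρs) * v p) ⟩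
              ≡⟨ cong (λ n → (a + ρ) * rootProd ρs a * ⟨ w , (λ p → z p ^ n * v p) ⟩) (sym (ℕ.+-suc e (length ρs))) ⟩
            (a + ρ) * rootProd ρs a * ⟨ w , (λ p → z p ^ (e ℕ.+ suc (length ρs)) * v p) ⟩ ∎
            where
            R : Fun
            R p = reciprocalProd a ρs (z p)

          -- For `i` other than zero, `z^n G i f i u` has as leading term a nonzero multiple of
          -- `z^(n + k) f i u`, and its lower terms are killed by induction. By `proportional` it is
          -- a multiple of `z^n G zero f zero u`, which has lower degree in `z` and is killed too.
          -- So `w` kills `z^(n + k) f i u`, and by `spanning` these reach all of `V t`.
          allPowers : (∀ e → e ℕ.< k → ∀ {v} → V t v → ⟨ w , (λ p → z p ^ e * v p) ⟩ ≡ 0#) →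
            ∀ n e → e ℕ.< n ℕ.+ k → ∀ {v} → V t v → ⟨ w , (λ p → z p ^ e * v p) ⟩ ≡ 0#
          allPowers base zero = base
          allPowers base (suc n) e e< with ℕ.m<1+n⇒m<n∨m≡n e<
          ... | inj₁ lt = allPowers base n e lt
          -- The indices other than zero number `t + 1`, exactly what `spanning` asks for.
          ... | inj₂ refl = spanning t (tabulate suc) (Unique.tabulate⁺ Fin.suc-injective) (length-tabulate suc)
                (preimage (λ p → z p ^ (n ℕ.+ k)) (kernel w)) generator
            where
            top : ∀ i {u} → W t u →
              ⟨ w , (λ p → z p ^ n * (G i p * (f t i p * u p))) ⟩ ≡
              rootProd (roots 0 i) a * ⟨ w , (λ p → z p ^ (n ℕ.+ k) * (f t i p * u p)) ⟩
            top i {u} Wu = subst (λ m → ⟨ w , (λ p → z p ^ n * (G i p * (f t i p * u p))) ⟩ ≡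
                rootProd (roots 0 i) a * ⟨ w , (λ p → z p ^ (n ℕ.+ m) * (f t i p * u p)) ⟩) (length-roots 0 i)
              (leadingTerm (roots 0 i) n (λ p → f t i p * u p)
                (λ e' lt → allPowers base n e' (subst (λ m → e' ℕ.< n ℕ.+ m) (length-roots 0 i) lt) (f*W⊆V t i Wu)))

            generator : ∀ {i u} → i ∈ tabulate suc → W t u →
              ⟨ w , (λ p → z p ^ (n ℕ.+ k) * (f t i p * u p)) ⟩ ≡ 0#
            generator {i} {u} i∈ Wu with ⟨ w , (λ p → z p ^ (n ℕ.+ k) * (f t i p * u p)) ⟩ ≟ 0#
            ... | yes eq = eq
            ... | no neq with j , refl ← ∈-tabulate⁻ {f = suc} i∈ =
              ⊥-elim (noZeroDivisors (c≢0 zero)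
                (noZeroDivisors (rootProd-nonzero (roots 0 (suc j)) (disjoint 0 (λ ()) (proj₂ firstRoot))) neq) (begin
                  c zero * (rootProd (roots 0 (suc j)) a * ⟨ w , (λ p → z p ^ (n ℕ.+ k) * (f t (suc j) p * u p)) ⟩)
                    ≡⟨ cong (c zero *_) (top (suc j) Wu) ⟨
                  c zero * ⟨ w , (λ p → z p ^ n * (G (suc j) p * (f t (suc j) p * u p))) ⟩
                    ≡⟨ pairing-scale (c zero) w _ ⟨
                  ⟨ w , (λ p → c zero * (z p ^ n * (G (suc j) p * (f t (suc j) p * u p)))) ⟩
                    ≡⟨ pairing-cong w exchange ⟩
                  ⟨ w , (λ p → c (suc j) * (z p ^ n * (G zero p * (f t zero p * u p)))) ⟩
                    ≡⟨ pairing-scale (c (suc j)) w _ ⟩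
                  c (suc j) * ⟨ w , (λ p → z p ^ n * (G zero p * (f t zero p * u p))) ⟩
                    ≡⟨ cong (c (suc j) *_) (trans (top zero Wu) (trans (cong (_* ⟨ w , (λ p → z p ^ (n ℕ.+ k) * (f t zero p * u p)) ⟩) (rootProd-zero (roots 0 zero) (proj₂ firstRoot))) (zeroˡ _))) ⟩
                  c (suc j) * 0#
                    ≡⟨ zeroʳ _ ⟩
                  0# ∎))
              where
              exchange : ∀ p → c zero * (z p ^ n * (G (suc j) p * (f t (suc j) p * u p))) ≡
                c (suc j) * (z p ^ n * (G zero p * (f t zero p * u p)))
              exchange p = begin
                c zero * (z p ^ n * (G (suc j) p * (f t (suc j) p * u p)))
                  ≡⟨ solve 5 (λ c y G f u → c :* (y :* (G :* (f :* u))) := c :* (G :* f) :* (y :* u)) refl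
                       (c zero) (z p ^ n) (G (suc j) p) (f t (suc j) p) (u p) ⟩
                c zero * (G (suc j) p * f t (suc j) p) * (z p ^ n * u p)
                  ≡⟨ cong (_* (z p ^ n * u p)) (proportional (suc j) p) ⟩
                c (suc j) * (G zero p * f t zero p) * (z p ^ n * u p)
                  ≡⟨ solve 5 (λ c y G f u → c :* (G :* f) :* (y :* u) := c :* (y :* (G :* (f :* u)))) refl
                       (c (suc j)) (z p ^ n) (G zero p) (f t zero p) (u p) ⟩
                c (suc j) * (z p ^ n * (G zero p * (f t zero p * u p))) ∎

      -- With more solutions than the `k * dimension k t` generators, some nonzero functional kills
      -- all generators, then by `allPowers` all powers of `z`. As `z` separates the solutions, the
      -- functional is zero.
      tooManySolutions : ⊥
      tooManySolutions
        with w , (p , wp≢0) , kills ← annihilator (polyBasis z (basisV t) k)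
          (subst (ℕ._< σ) (sym (trans (length-polyBasis z (basisV t) k) (cong (k ℕ.*_) (length-basisV t)))) σ>) =
        wp≢0 (vandermonde σ w z z-injective
          (λ e → trans (pairing-cong w (λ p → sym (*-identityʳ _)))
            (allPowers w
              (λ e' lt Vv → kills-poly (kills-V t) k w kills (monomial (subV t) e' lt Vv))
              (suc e) e (ℕ.m≤m+n (suc e) k) (one∈V k≥1 t))) p)

  -- The left side is the product of `k`, `2 k`, ..., `(t + 1) k`, which are distinct factors of the
  -- factorial.
  dimension≤factorial : ∀ k t → 1 ℕ.≤ k → k ℕ.* dimension k t ℕ.≤ (k ℕ.* suc t) !
  dimension≤factorial k zero k≥1 = n≤n! (k ℕ.* 1)
    where
    n≤n! : ∀ n → n ℕ.≤ n !
    n≤n! zero = z≤n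
    n≤n! (suc n) = ℕ.m≤m*n (suc n) (n !) ⦃ ℕ._!≢0 n ⦄
  dimension≤factorial k@(suc k₁) (suc t) k≥1 = ℕ.≤-trans
    (ℕ.≤-reflexive (trans (sym (ℕ.*-assoc k (suc (suc t) ℕ.* k) (dimension k t)))
      (trans (cong (ℕ._* dimension k t) (ℕ.*-comm k (suc (suc t) ℕ.* k)))
        (ℕ.*-assoc (suc (suc t) ℕ.* k) k (dimension k t)))))
    (ℕ.≤-trans
      (ℕ.*-mono-≤ {suc (suc t) ℕ.* k} {suc (k₁ ℕ.+ k ℕ.* suc t)}
        (ℕ.≤-reflexive (trans (ℕ.*-comm (suc (suc t)) k) (ℕ.*-suc k (suc t))))
        (ℕ.≤-trans (dimension≤factorial k t k≥1) (!-mono (ℕ.m≤n+m (k ℕ.* suc t) k₁))))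
      (ℕ.≤-reflexive (cong _! (sym (ℕ.*-suc k (suc t))))))
    where
    !-mono : ∀ {a b} → a ℕ.≤ b → a ! ℕ.≤ b !
    !-mono {b = b} z≤n = ℕ.1≤n! b
    !-mono (s≤s le) = ℕ.*-mono-≤ (s≤s le) (!-mono le)

-- Norms and conjugates in a cyclic field

-- The exponent `(b^n - 1) / (b - 1)` of the norm from the field with `b^n` elements to that with
-- `b` elements.
geometric : ℕ → ℕ → ℕ
geometric b zero = 0
geometric b (suc n) = geometric b n ℕ.+ b ℕ.^ n

geometric-sum : ∀ b n → suc (geometric (suc b) n ℕ.* b) ≡ suc b ℕ.^ n
geometric-sum b zero = refl
geometric-sum b (suc n) = begin
  suc ((geometric (suc b) n ℕ.+ suc b ℕ.^ n) ℕ.* b)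
    ≡⟨ cong suc (ℕ.*-distribʳ-+ b (geometric (suc b) n) (suc b ℕ.^ n)) ⟩
  suc (geometric (suc b) n ℕ.* b) ℕ.+ suc b ℕ.^ n ℕ.* b
    ≡⟨ cong₂ ℕ._+_ (geometric-sum b n) (ℕ.*-comm (suc b ℕ.^ n) b) ⟩
  suc b ℕ.^ n ℕ.+ b ℕ.* suc b ℕ.^ n ∎
  where open ≡-Reasoning

minimum : ∀ n (g : Fin (suc n) → ℕ) → ∃ λ i → ∀ j → g i ℕ.≤ g j
minimum zero g = zero , λ { zero → ℕ.≤-refl }
minimum (suc n) g with i , min ← minimum n (λ j → g (suc j)) with ℕ.≤-total (g zero) (g (suc i))
... | inj₁ le = zero , λ { zero → ℕ.≤-refl ; (suc j) → ℕ.≤-trans le (min j) }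
... | inj₂ le = suc i , λ { zero → le ; (suc j) → min j }

module FieldTools {e : ℕ} (L : CyclicField e) where
  open CyclicField L
  open CommutativeSemiring commutativeSemiring
    using (*-identityˡ; *-identityʳ; zeroˡ; zeroʳ; *-comm; +-comm; distribˡ)
  open import Algebra.Properties.CommutativeSemiring.Exp commutativeSemiring
    using (^-homo-*; ^-assocʳ; ^-distrib-*)
  open Char2Solver commutativeSemiring char2 using (solve; _:=_; _:*_)
  open FieldProperties field₂ public
  open Char2 commutativeSemiring char2 public using (horner; rootBound; frobenius; x+y≈0⇒x≈y)
  open ≡-Reasoning

  integral : ∀ {x y} → x * y ≡ 0# → x ≢ 0# → y ≡ 0#
  integral {x} {y} eq x≢0 with y ≟ 0#
  ... | yes p = p
  ... | no y≢0 = ⊥-elim (noZeroDivisors x≢0 y≢0 eq)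

  cancelˡ : ∀ {a x y} → a ≢ 0# → a * x ≡ a * y → x ≡ y
  cancelˡ {a} {x} {y} a≢0 eq = x+y≈0⇒x≈y (integral (trans (distribˡ a x y) (trans (cong (_+ a * y) eq) (char2 _))) a≢0)

  1^ : ∀ n → 1# ^ n ≡ 1#
  1^ zero = refl
  1^ (suc n) = trans (*-identityˡ _) (1^ n)

  ^-nonzero : ∀ {x} n → x ≢ 0# → x ^ n ≢ 0#
  ^-nonzero zero x≢0 eq = 0≢1 (sym eq)
  ^-nonzero (suc n) x≢0 = noZeroDivisors x≢0 (^-nonzero n x≢0)

  ⁻¹-nonzero : ∀ {x} → x ≢ 0# → x ⁻¹ ≢ 0#
  ⁻¹-nonzero {x} x≢0 eq = 0≢1 (trans (sym (zeroʳ x)) (trans (cong (x *_) (sym eq)) (inverseʳ x≢0)))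

  ζ^e* : ∀ n → ζ ^ (e ℕ.* n) ≡ 1#
  ζ^e* n = trans (sym (^-assocʳ ζ e n)) (trans (cong (_^ n) ζ^e≡1) (1^ n))

  ζ^-nonzero : 1 ℕ.≤ e → ∀ n → ζ ^ n ≢ 0#
  ζ^-nonzero e≥1 n = ^-nonzero n (λ ζ≡0 → 0≢1 (trans (sym (zero^ e≥1)) (trans (cong (_^ e) (sym ζ≡0)) ζ^e≡1)))
    where
    zero^ : ∀ {n} → 1 ℕ.≤ n → 0# ^ n ≡ 0#
    zero^ (s≤s _) = zeroˡ _

  fixed : ∀ u → u ^ suc e ≡ u
  fixed u with u ≟ 0#
  ... | yes refl = zeroˡ _
  ... | no u≢0 with t , refl ← log u≢0 = begin
    ζ ^ t * (ζ ^ t) ^ e  ≡⟨ cong (ζ ^ t *_) (trans (^-assocʳ ζ t e) (cong (ζ ^_) (ℕ.*-comm t e))) ⟩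
    ζ ^ t * ζ ^ (e ℕ.* t)  ≡⟨ cong (ζ ^ t *_) (ζ^e* t) ⟩
    ζ ^ t * 1#           ≡⟨ *-identityʳ _ ⟩
    ζ ^ t                ∎

  PowerOfTwo : ℕ → Set
  PowerOfTwo n = ∃ λ j → n ≡ 2 ℕ.^ j

  frobenius-+ : ∀ {n} → PowerOfTwo n → ∀ x y → (x + y) ^ n ≡ x ^ n + y ^ n
  frobenius-+ (j , refl) = frobenius j

  powerOfTwo-^ : ∀ {n} → PowerOfTwo n → ∀ i → PowerOfTwo (n ℕ.^ i)
  powerOfTwo-^ (j , refl) i = j ℕ.* i , ℕ.^-*-assoc 2 j i

  frobenius-zero : ∀ {n} → PowerOfTwo n → 0# ^ n ≡ 0#
  frobenius-zero (j , refl) with 2 ℕ.^ j | ℕ.m^n>0 2 j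
  ... | suc _ | _ = zeroˡ _

  frobenius-injective : ∀ {n} → PowerOfTwo n → ∀ {x y} → x ^ n ≡ y ^ n → x ≡ y
  frobenius-injective {n} n-pow {x} {y} eq with (x + y) ≟ 0#
  ... | yes p = x+y≈0⇒x≈y p
  ... | no p = ⊥-elim (^-nonzero n p (trans (frobenius-+ n-pow x y) (trans (cong (_+ y ^ n) eq) (char2 _))))

  fixed-powers : ∀ {u} b → u ^ b ≡ u → ∀ n → u ^ (b ℕ.^ n) ≡ u
  fixed-powers b eq zero = *-identityʳ _
  fixed-powers {u} b eq (suc n) = trans (sym (^-assocʳ u b (b ℕ.^ n))) (trans (cong (_^ (b ℕ.^ n)) eq) (fixed-powers b eq n))

  rootProd-^ : ∀ {n} → PowerOfTwo n → ∀ ρs x → rootProd ρs x ^ n ≡ rootProd (map (_^ n) ρs) (x ^ n)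
  rootProd-^ {n} n-pow [] x = 1^ n
  rootProd-^ {n} n-pow (ρ ∷ ρs) x = trans (^-distrib-* (x + ρ) (rootProd ρs x) n)
    (cong₂ _*_ (frobenius-+ n-pow x ρ) (rootProd-^ n-pow ρs x))

  module Conjugates (Q : ℕ) (Q-pow : PowerOfTwo Q) where

    conjugates : ℕ → Carrier → List Carrier
    conjugates zero C = []
    conjugates (suc n) C = C ^ (Q ℕ.^ n) ∷ conjugates n C

    length-conjugates : ∀ n C → length (conjugates n C) ≡ n
    length-conjugates zero C = refl
    length-conjugates (suc n) C = cong suc (length-conjugates n C)

    ∈-conjugates : ∀ n {C v} → v ∈ conjugates n C → ∃ λ a → v ≡ C ^ (Q ℕ.^ a)
    ∈-conjugates (suc n) (here eq) = n , eq
    ∈-conjugates (suc n) (there v∈) = ∈-conjugates n v∈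

    -- Since `x` is fixed by the map `x ↦ x ^ Q`, each `(x + C) ^ (Q ^ n)` is `x` plus a conjugate
    -- of `C`.
    norm-conjugates : ∀ n {x} C → x ^ Q ≡ x → (x + C) ^ geometric Q n ≡ rootProd (conjugates n C) x
    norm-conjugates zero C xQ = refl
    norm-conjugates (suc n) {x} C xQ = begin
      (x + C) ^ (geometric Q n ℕ.+ Q ℕ.^ n)
        ≡⟨ ^-homo-* (x + C) (geometric Q n) (Q ℕ.^ n) ⟩
      (x + C) ^ geometric Q n * (x + C) ^ (Q ℕ.^ n)
        ≡⟨ cong₂ _*_ (norm-conjugates n C xQ)
             (trans (frobenius-+ (powerOfTwo-^ Q-pow n) x C) (cong (_+ C ^ (Q ℕ.^ n)) (fixed-powers Q xQ n))) ⟩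
      rootProd (conjugates n C) x * (x + C ^ (Q ℕ.^ n))
        ≡⟨ *-comm _ _ ⟩
      (x + C ^ (Q ℕ.^ n)) * rootProd (conjugates n C) x ∎

  -- As X p lies in the subfield of order Q, the norm of X p + C i splits into values at the
  -- conjugates X p ^ (q ^ l) of polynomials with the conjugates of C i as roots.
  norm-factors : ∀ {q Q k Ix S} → PowerOfTwo q → (Q-pow : PowerOfTwo Q) → (X : S → Carrier) → (∀ p → X p ^ Q ≡ X p) →
    (C : Ix → Carrier) → ∀ t i p →
    let roots = λ l i → map (_^ (q ℕ.^ l)) (Conjugates.conjugates Q Q-pow k (C i))
        x = λ l p → X p ^ (q ℕ.^ l) in
    ((X p + C i) ^ geometric Q k) ^ geometric q (suc t) ≡ rootProd (roots 0 i) (x 0 p) * factorProd x roots t i p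
  norm-factors {q} {Q} {k} q-pow Q-pow X XQ C t i p = go t
    where
    open Conjugates Q Q-pow
    v = (X p + C i) ^ geometric Q k
    power : ∀ l → v ^ (q ℕ.^ l) ≡ rootProd (map (_^ (q ℕ.^ l)) (conjugates k (C i))) (X p ^ (q ℕ.^ l))
    power l = trans (cong (_^ (q ℕ.^ l)) (norm-conjugates k (C i) (XQ p)))
      (rootProd-^ (powerOfTwo-^ q-pow l) (conjugates k (C i)) (X p))
    go : ∀ t → v ^ geometric q (suc t) ≡ _
    go zero = trans (power 0) (sym (*-identityʳ _))
    go (suc t) = trans (^-homo-* v (geometric q (suc t)) (q ℕ.^ suc t))
      (trans (cong₂ _*_ (go t) (power (suc t)))
        (solve 3 (λ a b c → a :* b :* c := a :* (c :* b)) refl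
          (rootProd (map (_^ 1) (conjugates k (C i))) (X p ^ 1))
          (factorProd (λ l p → X p ^ (q ℕ.^ l)) (λ l i → map (_^ (q ℕ.^ l)) (conjugates k (C i))) t i p)
          (rootProd (map (_^ (q ℕ.^ suc t)) (conjugates k (C i))) (X p ^ (q ℕ.^ suc t)))))

  -- The purpose is to single out one element in every orbit, for which an arbitrary injection into
  -- the natural numbers is enough.
  rank : Carrier → ℕ
  rank u with u ≟ 0#
  ... | yes _ = 0
  ... | no u≢0 = suc (proj₁ (log u≢0))

  rank-injective : ∀ {u v} → rank u ≡ rank v → u ≡ v
  rank-injective {u} {v} eq with u ≟ 0# | v ≟ 0#
  ... | yes p | yes p' = trans p (sym p')
  ... | no p | no p' = trans (proj₂ (log p)) (trans (cong (ζ ^_) (ℕ.suc-injective eq)) (sym (proj₂ (log p'))))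

  module Labels (Q k₁ : ℕ) (Q-pow : PowerOfTwo Q) (Q^k≡ : Q ℕ.^ suc k₁ ≡ suc e) where

    private
      k = suc k₁
      σ : ℕ → Carrier → Carrier
      σ a C = C ^ (Q ℕ.^ a)

      σ-+ : ∀ a b C → σ (a ℕ.+ b) C ≡ σ b (σ a C)
      σ-+ a b C = trans (cong (C ^_) (ℕ.^-distribˡ-+-* Q a b)) (sym (^-assocʳ C (Q ℕ.^ a) (Q ℕ.^ b)))

      σ-period : ∀ b C → σ (k ℕ.* b) C ≡ C
      σ-period b C = trans (cong (C ^_) (sym (ℕ.^-*-assoc Q k b)))
        (fixed-powers (Q ℕ.^ k) (trans (cong (C ^_) Q^k≡) (fixed C)) b)

      orbitMin : (C : Carrier) → ∃ λ (i : Fin k) → ∀ j → rank (σ (Fin.toℕ i) C) ℕ.≤ rank (σ (Fin.toℕ j) C)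
      orbitMin C = minimum k₁ (λ i → rank (σ (Fin.toℕ i) C))

    -- The position, within the orbit of C under x ↦ x ^ Q, of the element of least rank.
    label : Carrier → Fin k
    label C = proj₁ (orbitMin C)

    private
      canonical : Carrier → Carrier
      canonical C = σ (Fin.toℕ (label C)) C

      canonical-least : ∀ C a → rank (canonical C) ℕ.≤ rank (σ a C)
      canonical-least C a = subst (λ u → rank (canonical C) ℕ.≤ rank u) (sym reduce) (proj₂ (orbitMin C) (a ℕ.mod k))
        where
        reduce : σ a C ≡ σ (Fin.toℕ (a ℕ.mod k)) C
        reduce = begin
          σ a C ≡⟨ cong (λ n → σ n C) (ℕ.m≡m%n+[m/n]*n a k) ⟩
          σ (a % k ℕ.+ a / k ℕ.* k) C ≡⟨ cong (λ n → σ n C) (trans (ℕ.+-comm (a % k) _) (cong (ℕ._+ a % k) (ℕ.*-comm (a / k) k))) ⟩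
          σ (k ℕ.* (a / k) ℕ.+ a % k) C ≡⟨ σ-+ (k ℕ.* (a / k)) (a % k) C ⟩
          σ (a % k) (σ (k ℕ.* (a / k)) C) ≡⟨ cong (σ (a % k)) (σ-period (a / k) C) ⟩
          σ (a % k) C ≡⟨ cong (λ n → σ n C) (Fin.toℕ-fromℕ< (ℕ.m%n<n a k)) ⟨
          σ (Fin.toℕ (a ℕ.mod k)) C ∎

      conjugate : ∀ {C C'} a b → σ a C ≡ σ b C' → ∃ λ x → C ≡ σ x C'
      -- As `a + k₁ * a` is a multiple of the period `k`, applying `σ (k₁ * a)` undoes `σ a`.
      conjugate {C} {C'} a b eq = b ℕ.+ k₁ ℕ.* a , (begin
        C ≡⟨ σ-period a C ⟨
        σ (a ℕ.+ k₁ ℕ.* a) C ≡⟨ σ-+ a (k₁ ℕ.* a) C ⟩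
        σ (k₁ ℕ.* a) (σ a C) ≡⟨ cong (σ (k₁ ℕ.* a)) eq ⟩
        σ (k₁ ℕ.* a) (σ b C') ≡⟨ σ-+ b (k₁ ℕ.* a) C' ⟨
        σ (b ℕ.+ k₁ ℕ.* a) C' ∎)

      canonical-≤ : ∀ {C C'} → ∃ (λ x → C' ≡ σ x C) → rank (canonical C) ℕ.≤ rank (canonical C')
      canonical-≤ {C} {C'} (x , eq) = subst (λ u → rank (canonical C) ℕ.≤ rank u)
        (trans (σ-+ x (Fin.toℕ (label C')) C) (cong (σ (Fin.toℕ (label C'))) (sym eq)))
        (canonical-least C (x ℕ.+ Fin.toℕ (label C')))

    -- Conjugate elements have the same orbit, hence the same element of least rank. If both reach
    -- it by the same power of the map, its injectivity makes them equal.
    label-conjugate : ∀ {C C'} a b → label C ≡ label C' → C ^ (Q ℕ.^ a) ≡ C' ^ (Q ℕ.^ b) → C ≡ C'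
    label-conjugate {C} {C'} a b same eq = frobenius-injective (powerOfTwo-^ Q-pow (Fin.toℕ (label C)))
      (trans (rank-injective (ℕ.≤-antisym (canonical-≤ (conjugate b a (sym eq))) (canonical-≤ (conjugate a b eq))))
        (cong (λ l → σ (Fin.toℕ l) C') (sym same)))

update : ∀ {d} {s : Fin d → ℕ} → (∀ i → Fin (s i)) → ∀ i → Fin (s i) → ∀ j → Fin (s j)
update x i a j with i Fin.≟ j
... | yes refl = a
... | no _ = x j

update-same : ∀ {d} {s : Fin d → ℕ} (x : ∀ i → Fin (s i)) i a → update x i a i ≡ a
update-same x i a with i Fin.≟ i
... | yes refl = refl
... | no i≢i = ⊥-elim (i≢i refl)

update-other : ∀ {d} {s : Fin d → ℕ} (x : ∀ i → Fin (s i)) {i j} a → i ≢ j → update x i a j ≡ x j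
update-other x {i} {j} a i≢j with i Fin.≟ j
... | yes refl = ⊥-elim (i≢j refl)
... | no _ = refl

snoc : ∀ k {s : Fin (suc k) → ℕ} → (∀ i → Fin (s (inject₁ i))) → Fin (s (fromℕ k)) → ∀ i → Fin (s i)
snoc zero g a zero = a
snoc (suc k) g a zero = g zero
snoc (suc k) {s} g a (suc i) = snoc k {λ i → s (suc i)} (λ i → g (suc i)) a i

snoc-inject₁ : ∀ k {s : Fin (suc k) → ℕ} g (a : Fin (s (fromℕ k))) i → snoc k {s} g a (inject₁ i) ≡ g i
snoc-inject₁ (suc k) g a zero = refl
snoc-inject₁ (suc k) {s} g a (suc i) = snoc-inject₁ k {λ i → s (suc i)} (λ i → g (suc i)) a i

snoc-fromℕ : ∀ k {s : Fin (suc k) → ℕ} g (a : Fin (s (fromℕ k))) → snoc k {s} g a (fromℕ k) ≡ a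
snoc-fromℕ zero g a = refl
snoc-fromℕ (suc k) {s} g a = snoc-fromℕ k {λ i → s (suc i)} (λ i → g (suc i)) a

-- Mixed-radix digits: the numbers below the product enumerate the choices of one vertex from each
-- class.
selection : ∀ k {s : Fin k → ℕ} → Fin (prodFin k s) → ∀ i → Fin (s i)
selection (suc k) {s} p zero = proj₁ (remQuot (prodFin k (λ i → s (suc i))) p)
selection (suc k) {s} p (suc i) = selection k {λ i → s (suc i)} (proj₂ (remQuot {s zero} (prodFin k (λ i → s (suc i))) p)) i

remQuot-injective : ∀ {n} k {i j : Fin (n ℕ.* k)} →
  proj₁ (remQuot {n} k i) ≡ proj₁ (remQuot {n} k j) → proj₂ (remQuot {n} k i) ≡ proj₂ (remQuot {n} k j) → i ≡ j
remQuot-injective {n} k {i} {j} e₁ e₂ =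
  trans (sym (Fin.combine-remQuot {n} k i)) (trans (cong₂ combine e₁ e₂) (Fin.combine-remQuot {n} k j))

selection-injective : ∀ k {s : Fin k → ℕ} {p p' : Fin (prodFin k s)} →
  (∀ i → selection k {s} p i ≡ selection k {s} p' i) → p ≡ p'
selection-injective zero {p = zero} {zero} _ = refl
selection-injective (suc k) {s} eq = remQuot-injective (prodFin k (λ i → s (suc i))) (eq zero)
  (selection-injective k {λ i → s (suc i)} (λ i → eq (suc i)))

-- The powers of `ζ` are known to be distinct only for exponents below `e = Q^k - 1`. With `Q = 2`
-- and `k = 1` the bound would fail.
power<pred : ∀ {Q a k e} → 3 ℕ.≤ Q → a ℕ.< k → Q ℕ.^ k ≡ suc e → Q ℕ.^ a ℕ.< e
power<pred {Q@(suc _)} {a} {k} {e} Q≥3 a<k eq = ℕ.≤-pred (begin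
  2 ℕ.+ Q ℕ.^ a              ≤⟨ ℕ.+-monoˡ-≤ (Q ℕ.^ a) (ℕ.*-monoʳ-≤ 2 (ℕ.m^n>0 Q a)) ⟩
  2 ℕ.* Q ℕ.^ a ℕ.+ Q ℕ.^ a  ≡⟨ ℕ.+-comm (2 ℕ.* Q ℕ.^ a) _ ⟩
  3 ℕ.* Q ℕ.^ a              ≤⟨ ℕ.*-monoˡ-≤ (Q ℕ.^ a) Q≥3 ⟩
  Q ℕ.^ suc a                ≤⟨ ℕ.^-monoʳ-≤ Q a<k ⟩
  Q ℕ.^ k                    ≡⟨ eq ⟩
  suc e                      ∎)
  where open ℕ.≤-Reasoning

-- The norm equations of a copy

module NormGeometry {e : ℕ} (L : CyclicField e) (k₁ q₂ Q₁ t : ℕ) where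
  open CyclicField L
  open FieldTools L
  open CommutativeSemiring commutativeSemiring
    using (*-identityˡ; *-identityʳ; zeroˡ; *-comm; *-assoc; +-comm; distribˡ; semiring; *-commutativeMonoid)
  open import Algebra.Properties.CommutativeSemiring.Exp commutativeSemiring
    using (^-homo-*; ^-assocʳ; ^-distrib-*)
  open Char2Solver commutativeSemiring char2 using (solve; _:=_; _:+_; _:*_)
  open import Algebra.Properties.Semiring.Sum semiring public
    using (sum; sum-cong-≗; sum-remove; sum-init-last; ∑-distrib-+; *-distribˡ-sum; *-distribʳ-sum; sum-permute)
  open import Algebra.Properties.CommutativeMonoid.Sum *-commutativeMonoid public
    using () renaming (sum to prod; sum-cong-≗ to prod-cong; sum-remove to prod-remove; sum-init-last to prod-init-last; sum-permute to prod-permute)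
  open ≡-Reasoning

  k d q₁ q Q m H : ℕ
  k = suc k₁
  d = suc k
  q₁ = suc q₂
  q = suc q₁
  Q = suc Q₁
  m = suc t
  H = geometric Q k

  -- When `Q = q^m`, this is `(Q^k - 1) / (q - 1)`: the norm to the subfield of order `Q`, followed
  -- by the norm to the field of order `q`.
  exponent : ℕ
  exponent = H ℕ.* geometric q m

  norm : Carrier → Carrier
  norm u = u ^ exponent

  horner-sum : ∀ n p x → horner n p x ≡ sum (λ i → p i * x ^ Fin.toℕ i)
  horner-sum zero p x = refl
  horner-sum (suc n) p x = cong₂ _+_ (sym (*-identityʳ _)) (trans (cong (x *_) (horner-sum n (λ i → p (suc i)) x))
    (trans (*-distribˡ-sum x (λ i → p (suc i) * x ^ Fin.toℕ i))
      (sum-cong-≗ (λ i → solve 3 (λ x p y → x :* (p :* y) := p :* (x :* y)) refl x (p (suc i)) (x ^ Fin.toℕ i)))))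

  horner-frobenius : ∀ {r} → PowerOfTwo r → ∀ n p x → (∀ i → p i ^ r ≡ p i) → horner n p x ^ r ≡ horner n p (x ^ r)
  horner-frobenius {r} r-pow zero p x _ = frobenius-zero r-pow
  horner-frobenius {r} r-pow (suc n) p x fix = trans (frobenius-+ r-pow (p zero) _)
    (cong₂ _+_ (fix zero) (trans (^-distrib-* x _ r) (cong (x ^ r *_) (horner-frobenius r-pow n (λ i → p (suc i)) x (λ i → fix (suc i))))))

  -- 1, ζ, ..., ζ^(k-1) are independent over the subfield of order Q, and adding their sum makes
  -- any k of the d elements independent.
  ω : Fin d → Carrier
  ω zero = horner k (λ _ → 1#) ζ
  ω (suc i) = ζ ^ Fin.toℕ i

  prod-nonzero : ∀ {n} (g : Fin n → Carrier) → (∀ i → g i ≢ 0#) → prod g ≢ 0#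
  prod-nonzero {zero} g _ eq = 0≢1 (sym eq)
  prod-nonzero {suc n} g nz = noZeroDivisors (nz zero) (prod-nonzero (λ i → g (suc i)) (λ i → nz (suc i)))

  -- That is, any `k` of the `d` entries are linearly independent over the subfield of order `Q`.
  Independent : (Fin d → Carrier) → Set
  Independent w = ∀ (x : Fin d → Carrier) (c₀ : Fin d) → (∀ c → x c ^ Q ≡ x c) → x c₀ ≡ 0# → sum (λ c → w c * x c) ≡ 0# → ∀ c → x c ≡ 0#

  module _ (q-pow : PowerOfTwo q) (Q≡q^m : Q ≡ q ℕ.^ m) (Q^k≡ : Q ℕ.^ k ≡ suc e) (Q≥3 : 3 ℕ.≤ Q) where

    Q-pow : PowerOfTwo Q
    Q-pow = subst PowerOfTwo (sym Q≡q^m) (powerOfTwo-^ q-pow m)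

    open Labels Q k₁ Q-pow Q^k≡ public
    open Conjugates Q Q-pow

    H*Q₁≡e : H ℕ.* Q₁ ≡ e
    H*Q₁≡e = ℕ.suc-injective (trans (geometric-sum Q₁ k) Q^k≡)

    exponent*q₁≡e : exponent ℕ.* q₁ ≡ e
    exponent*q₁≡e = trans (ℕ.*-assoc H (geometric q m) q₁)
      (trans (cong (H ℕ.*_) (ℕ.suc-injective (trans (geometric-sum q₁ m) (sym Q≡q^m)))) H*Q₁≡e)

    Q^a<e : ∀ {a} → a ℕ.< k → Q ℕ.^ a ℕ.< e
    Q^a<e a<k = power<pred Q≥3 a<k Q^k≡

    e≥1 : 1 ℕ.≤ e
    e≥1 = ℕ.<-≤-trans (s≤s z≤n) (Q^a<e {0} (s≤s z≤n))

    ζ-conjugates-distinct : ∀ {a b : Fin k} → ζ ^ (Q ℕ.^ Fin.toℕ a) ≡ ζ ^ (Q ℕ.^ Fin.toℕ b) → a ≡ b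
    ζ-conjugates-distinct {a} {b} eq = Fin.toℕ-injective (exponents-equal (ζ-injective (Q^a<e (Fin.toℕ<n a)) (Q^a<e (Fin.toℕ<n b)) eq))
      where
      1<Q : 1 ℕ.< Q
      1<Q = ℕ.≤-trans (s≤s (s≤s z≤n)) Q≥3
      exponents-equal : ∀ {a b} → Q ℕ.^ a ≡ Q ℕ.^ b → a ≡ b
      exponents-equal {a} {b} eq with ℕ.<-cmp a b
      ... | tri< lt _ _ = ⊥-elim (ℕ.<-irrefl eq (ℕ.^-monoʳ-< Q 1<Q lt))
      ... | tri≈ _ p _ = p
      ... | tri> _ _ gt = ⊥-elim (ℕ.<-irrefl (sym eq) (ℕ.^-monoʳ-< Q 1<Q gt))

    -- With coefficients in the subfield, a polynomial that vanishes at `ζ` also vanishes at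
    -- `ζ ^ (Q ^ a)` for all `a < k`, which are `k` distinct roots.
    minimalPolynomial : ∀ p → (∀ i → p i ^ Q ≡ p i) → horner k p ζ ≡ 0# → ∀ i → p i ≡ 0#
    minimalPolynomial p fix eq = rootBound integral k p (λ a → ζ ^ (Q ℕ.^ Fin.toℕ a)) ζ-conjugates-distinct
      (λ a → trans (sym (horner-frobenius (powerOfTwo-^ Q-pow (Fin.toℕ a)) k p ζ (λ i → fixed-powers Q (fix i) (Fin.toℕ a))))
        (trans (cong (_^ (Q ℕ.^ Fin.toℕ a)) eq) (frobenius-zero (powerOfTwo-^ Q-pow (Fin.toℕ a)))))

    ω-nonzero : ∀ c → ω c ≢ 0#
    ω-nonzero zero eq = 0≢1 (sym (minimalPolynomial (λ _ → 1#) (λ _ → 1^ Q) eq zero))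
    ω-nonzero (suc i) = ζ^-nonzero e≥1 (Fin.toℕ i)

    -- Collecting powers of `ζ` gives the coefficients `x zero + x (suc i)`. They vanish, so all
    -- `x c` are equal, and one of them is zero.
    ω-independent : Independent ω
    ω-independent x c₀ fix x₀≡0 eq = all
      where
      sums : sum {d} (λ c → ω c * x c) ≡ horner k (λ i → x zero + x (suc i)) ζ
      sums = begin
        ω zero * x zero + sum {k} (λ i → ζ ^ Fin.toℕ i * x (suc i))
          ≡⟨ cong (λ v → v * x zero + sum {k} (λ i → ζ ^ Fin.toℕ i * x (suc i))) (horner-sum k (λ _ → 1#) ζ) ⟩
        sum {k} (λ i → 1# * ζ ^ Fin.toℕ i) * x zero + sum {k} (λ i → ζ ^ Fin.toℕ i * x (suc i))
          ≡⟨ cong (_+ sum {k} (λ i → ζ ^ Fin.toℕ i * x (suc i))) (*-distribʳ-sum {k} (x zero) (λ i → 1# * ζ ^ Fin.toℕ i)) ⟩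
        sum {k} (λ i → 1# * ζ ^ Fin.toℕ i * x zero) + sum {k} (λ i → ζ ^ Fin.toℕ i * x (suc i))
          ≡⟨ ∑-distrib-+ {k} (λ i → 1# * ζ ^ Fin.toℕ i * x zero) (λ i → ζ ^ Fin.toℕ i * x (suc i)) ⟨
        sum {k} (λ i → 1# * ζ ^ Fin.toℕ i * x zero + ζ ^ Fin.toℕ i * x (suc i))
          ≡⟨ sum-cong-≗ (λ i → trans (cong (λ v → v * x zero + ζ ^ Fin.toℕ i * x (suc i)) (*-identityˡ _))
               (solve 3 (λ y a b → y :* a :+ y :* b := (a :+ b) :* y) refl (ζ ^ Fin.toℕ i) (x zero) (x (suc i)))) ⟩
        sum {k} (λ i → (x zero + x (suc i)) * ζ ^ Fin.toℕ i)
          ≡⟨ horner-sum k (λ i → x zero + x (suc i)) ζ ⟨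
        horner k (λ i → x zero + x (suc i)) ζ ∎

      equal : ∀ i → x zero ≡ x (suc i)
      equal i = x+y≈0⇒x≈y (minimalPolynomial (λ i → x zero + x (suc i))
        (λ i → trans (frobenius-+ Q-pow _ _) (cong₂ _+_ (fix zero) (fix (suc i)))) (trans (sym sums) eq) i)

      head≡0 : ∀ c → x c ≡ 0# → x zero ≡ 0#
      head≡0 zero eq = eq
      head≡0 (suc i) eq = trans (equal i) eq

      all : ∀ c → x c ≡ 0#
      all zero = head≡0 c₀ x₀≡0
      all (suc i) = trans (sym (equal i)) (head≡0 c₀ x₀≡0)

    subfield : Fin Q → Carrier
    subfield zero = 0#
    subfield (suc i) = ζ ^ (Fin.toℕ i ℕ.* H)

    subfield-fixed : ∀ a → subfield a ^ Q ≡ subfield a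
    subfield-fixed zero = zeroˡ _
    subfield-fixed (suc i) = begin
      ζ ^ n * (ζ ^ n) ^ Q₁   ≡⟨ cong (ζ ^ n *_) (^-assocʳ ζ n Q₁) ⟩
      ζ ^ n * ζ ^ (n ℕ.* Q₁) ≡⟨ cong (λ l → ζ ^ n * ζ ^ l) (trans (ℕ.*-assoc (Fin.toℕ i) H Q₁) (trans (cong (Fin.toℕ i ℕ.*_) H*Q₁≡e) (ℕ.*-comm (Fin.toℕ i) e))) ⟩
      ζ ^ n * ζ ^ (e ℕ.* Fin.toℕ i) ≡⟨ cong (ζ ^ n *_) (ζ^e* (Fin.toℕ i)) ⟩
      ζ ^ n * 1#             ≡⟨ *-identityʳ _ ⟩
      ζ ^ n                  ∎
      where n = Fin.toℕ i ℕ.* H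

    multiple-injective : ∀ {b} a → a ℕ.* b ≡ e → ∀ {i j : Fin b} → ζ ^ (Fin.toℕ i ℕ.* a) ≡ ζ ^ (Fin.toℕ j ℕ.* a) → i ≡ j
    multiple-injective zero eq = ⊥-elim (ℕ.<-irrefl eq e≥1)
    multiple-injective {b} a@(suc _) eq {i} {j} p = Fin.toℕ-injective (ℕ.*-cancelʳ-≡ (Fin.toℕ i) (Fin.toℕ j) a (ζ-injective (below i) (below j) p))
      where
      below : ∀ (i : Fin b) → Fin.toℕ i ℕ.* a ℕ.< e
      below i = subst (Fin.toℕ i ℕ.* a ℕ.<_) (trans (ℕ.*-comm b a) eq) (ℕ.*-monoˡ-< a (Fin.toℕ<n i))

    subfield-injective : ∀ {a b} → subfield a ≡ subfield b → a ≡ b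
    subfield-injective {zero} {zero} _ = refl
    subfield-injective {zero} {suc j} p = ⊥-elim (ζ^-nonzero e≥1 (Fin.toℕ j ℕ.* H) (sym p))
    subfield-injective {suc i} {zero} p = ⊥-elim (ζ^-nonzero e≥1 (Fin.toℕ i ℕ.* H) p)
    subfield-injective {suc i} {suc j} p = cong suc (multiple-injective H H*Q₁≡e p)

    unit : Fin q₁ → Carrier
    unit b = ζ ^ (Fin.toℕ b ℕ.* exponent)

    unit-nonzero : ∀ b → unit b ≢ 0#
    unit-nonzero b = ζ^-nonzero e≥1 (Fin.toℕ b ℕ.* exponent)

    unit-injective : ∀ {a b} → unit a ≡ unit b → a ≡ b
    unit-injective = multiple-injective exponent exponent*q₁≡e

    norm-*  : ∀ u v → norm (u * v) ≡ norm u * norm v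
    norm-* u v = ^-distrib-* u v exponent

    norm-ζ : ∀ n → norm (ζ ^ n) ≡ ζ ^ (n ℕ.* exponent)
    norm-ζ n = ^-assocʳ ζ n exponent

    private
      ζ^-mod : ∀ n → ζ ^ ((n % q₁) ℕ.* exponent) ≡ ζ ^ (n ℕ.* exponent)
      ζ^-mod n = sym (begin
        ζ ^ (n ℕ.* exponent) ≡⟨ cong (λ n → ζ ^ (n ℕ.* exponent)) (ℕ.m≡m%n+[m/n]*n n q₁) ⟩
        ζ ^ ((n % q₁ ℕ.+ n / q₁ ℕ.* q₁) ℕ.* exponent) ≡⟨ cong (ζ ^_) (ℕ.*-distribʳ-+ exponent (n % q₁) (n / q₁ ℕ.* q₁)) ⟩
        ζ ^ ((n % q₁) ℕ.* exponent ℕ.+ n / q₁ ℕ.* q₁ ℕ.* exponent) ≡⟨ ^-homo-* ζ ((n % q₁) ℕ.* exponent) (n / q₁ ℕ.* q₁ ℕ.* exponent) ⟩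
        ζ ^ ((n % q₁) ℕ.* exponent) * ζ ^ (n / q₁ ℕ.* q₁ ℕ.* exponent)
          ≡⟨ cong (λ l → ζ ^ ((n % q₁) ℕ.* exponent) * ζ ^ l) (trans (ℕ.*-assoc (n / q₁) q₁ exponent)
               (trans (ℕ.*-comm (n / q₁) _) (cong (ℕ._* (n / q₁)) (trans (ℕ.*-comm q₁ exponent) exponent*q₁≡e)))) ⟩
        ζ ^ ((n % q₁) ℕ.* exponent) * ζ ^ (e ℕ.* (n / q₁)) ≡⟨ cong (ζ ^ ((n % q₁) ℕ.* exponent) *_) (ζ^e* (n / q₁)) ⟩
        ζ ^ ((n % q₁) ℕ.* exponent) * 1# ≡⟨ *-identityʳ _ ⟩
        ζ ^ ((n % q₁) ℕ.* exponent) ∎)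

      prod-units : ∀ {n} (b : Fin n → Fin q₁) → ∃ λ B → prod (λ i → unit (b i)) ≡ ζ ^ (B ℕ.* exponent)
      prod-units {zero} b = 0 , refl
      prod-units {suc n} b with B , eq ← prod-units (λ i → b (suc i)) =
        Fin.toℕ (b zero) ℕ.+ B , trans (cong (unit (b zero) *_) eq)
          (trans (sym (^-homo-* ζ (Fin.toℕ (b zero) ℕ.* exponent) (B ℕ.* exponent)))
            (cong (ζ ^_) (sym (ℕ.*-distribʳ-+ exponent (Fin.toℕ (b zero)) B))))

    -- Norms of nonzero elements and units are all powers of `ζ ^ exponent`, so the equation is one
    -- between exponents modulo `q₁`.
    solveUnit : ∀ {n} (b : Fin n → Fin q₁) {u} → u ≢ 0# → ∃ λ b₀ → norm u ≡ unit b₀ * prod (λ i → unit (b i))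
    solveUnit b {u} u≢0 with n , refl ← log u≢0 with B , eq ← prod-units b =
      (l ℕ.mod q₁) , sym (begin
        unit (l ℕ.mod q₁) * prod (λ i → unit (b i)) ≡⟨ cong₂ _*_ (trans (cong (λ i → ζ ^ (i ℕ.* exponent)) (Fin.toℕ-fromℕ< (ℕ.m%n<n l q₁))) (ζ^-mod l)) eq ⟩
        ζ ^ (l ℕ.* exponent) * ζ ^ (B ℕ.* exponent) ≡⟨ ^-homo-* ζ (l ℕ.* exponent) (B ℕ.* exponent) ⟨
        ζ ^ (l ℕ.* exponent ℕ.+ B ℕ.* exponent) ≡⟨ cong (ζ ^_) (ℕ.*-distribʳ-+ exponent l B) ⟨
        ζ ^ ((l ℕ.+ B) ℕ.* exponent) ≡⟨ cong (λ i → ζ ^ (i ℕ.* exponent)) shift ⟩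
        ζ ^ ((n ℕ.+ B ℕ.* q₁) ℕ.* exponent) ≡⟨ ζ^-mod (n ℕ.+ B ℕ.* q₁) ⟨
        ζ ^ (((n ℕ.+ B ℕ.* q₁) % q₁) ℕ.* exponent) ≡⟨ cong (λ i → ζ ^ (i ℕ.* exponent)) (ℕ.[m+kn]%n≡m%n n B q₁) ⟩
        ζ ^ ((n % q₁) ℕ.* exponent) ≡⟨ ζ^-mod n ⟩
        ζ ^ (n ℕ.* exponent) ≡⟨ norm-ζ n ⟨
        norm (ζ ^ n) ∎)
      where
      -- As `q₂ ≡ -1` modulo `q₁`, this is `n - B`.
      l = n ℕ.+ B ℕ.* q₂
      shift : l ℕ.+ B ≡ n ℕ.+ B ℕ.* q₁
      shift = trans (ℕ.+-assoc n (B ℕ.* q₂) B) (cong (n ℕ.+_) (trans (ℕ.+-comm (B ℕ.* q₂) B) (sym (ℕ.*-suc B q₂))))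

    independent-permute : ∀ {w} (π : Fin d → Fin d) (π⁻¹ : Fin d → Fin d) → (∀ c → π (π⁻¹ c) ≡ c) → (∀ i → π⁻¹ (π i) ≡ i) →
      Independent w → Independent (λ i → w (π i))
    independent-permute {w} π π⁻¹ invʳ invˡ ind x c₀ fix x₀≡0 eq c = trans (cong x (sym (invˡ c)))
      (ind (λ c → x (π⁻¹ c)) (π c₀) (λ c → fix (π⁻¹ c)) (trans (cong x (invˡ c₀)) x₀≡0)
        (trans (sum-permute (λ c → w c * x (π⁻¹ c)) perm) (trans (sum-cong-≗ (λ i → cong (λ j → w (π i) * x j) (invˡ i))) eq)) (π c))
      where
      perm : Permutation d d
      perm = permutation π π⁻¹ invʳ invˡ

    module _ {n : ℕ} (π π⁻¹ : Fin n → Fin n) (invʳ : ∀ c → π (π⁻¹ c) ≡ c) (invˡ : ∀ i → π⁻¹ (π i) ≡ i) where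
      sum-reindex : ∀ (h g : Fin n → Carrier) → (∀ i → h (π i) ≡ g i) → sum h ≡ sum g
      sum-reindex h g eq = trans (sum-permute h (permutation π π⁻¹ invʳ invˡ)) (sum-cong-≗ eq)

      prod-reindex : ∀ (h g : Fin n → Carrier) → (∀ i → h (π i) ≡ g i) → prod h ≡ prod g
      prod-reindex h g eq = trans (prod-permute h (permutation π π⁻¹ invʳ invˡ)) (prod-cong eq)

    -- The hypotheses describe a copy class by class, `w` being the `ω` of the parts in which the
    -- classes lie. The last class supplies the solutions, the others the `suc m` equations.
    module _ {s : Fin d → ℕ} (P≡ : suc m ≡ prodFin k (λ i → s (inject₁ i)))
      (w : Fin d → Carrier) (w≢0 : ∀ i → w i ≢ 0#) (w-independent : Independent w)
      (x y : ∀ i → Fin (s i) → Carrier)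
      (x-fixed : ∀ i a → x i a ^ Q ≡ x i a) (y≢0 : ∀ i a → y i a ≢ 0#)
      (xy-injective : ∀ i {a b} → x i a ≡ x i b → y i a ≡ y i b → a ≡ b)
      (base : ∀ i → Fin (s i))
      (edge : ∀ (a : ∀ i → Fin (s i)) → norm (sum (λ i → w i * x i (a i))) ≡ prod (λ i → y i (a i)))
      (l₀ : Fin k)
      (labelled : ∀ (a : ∀ i → Fin (s i)) →
        label (w (fromℕ k) ⁻¹ * (sum (λ i → w i * x i (a i)) + w (fromℕ k) * x (fromℕ k) (a (fromℕ k)))) ≡ l₀)
      where

      -- Complete two vertices of a class with the same point by the same other vertices. The norms
      -- of the two edges agree, hence also the units, and the vertices coincide.
      x-injective : ∀ i {a b} → x i a ≡ x i b → a ≡ b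
      x-injective i {a} {b} eq = xy-injective i eq (trans (cong (y i) (sym (update-same base i a)))
        (trans (cancelˡ rest≢0 (trans (*-comm rest _) (trans (sym (split a)) (trans products (trans (split b) (trans (cong (y i (update base i b i) *_) same-rest) (*-comm _ rest)))))))
          (cong (y i) (update-same base i b))))
        where
        rest : Carrier
        rest = prod (λ j → y (punchIn i j) (update base i a (punchIn i j)))
        rest≢0 : rest ≢ 0#
        rest≢0 = prod-nonzero _ (λ j → y≢0 (punchIn i j) (update base i a (punchIn i j)))
        split : ∀ a → prod (λ j → y j (update base i a j)) ≡
          y i (update base i a i) * prod (λ j → y (punchIn i j) (update base i a (punchIn i j)))
        split a = prod-remove {i = i} (λ j → y j (update base i a j))
        same-rest : prod (λ j → y (punchIn i j) (update base i b (punchIn i j))) ≡ rest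
        same-rest = prod-cong (λ j → cong (y (punchIn i j))
          (trans (update-other base b (λ e → Fin.punchInᵢ≢i i j (sym e))) (sym (update-other base a (λ e → Fin.punchInᵢ≢i i j (sym e))))))
        same-x : ∀ j → x j (update base i a j) ≡ x j (update base i b j)
        same-x j with i Fin.≟ j
        ... | yes refl = eq
        ... | no _ = refl
        products : prod (λ j → y j (update base i a j)) ≡ prod (λ j → y j (update base i b j))
        products = trans (sym (edge (update base i a))) (trans (cong norm (sum-cong-≗ (λ j → cong (w j *_) (same-x j)))) (edge (update base i b)))

      private
        last : Fin d
        last = fromℕ k

        grid : Fin (suc m) → ∀ (i : Fin k) → Fin (s (inject₁ i))
        grid p = selection k (Fin.cast P≡ p)

        B : Fin (suc m) → Carrier
        B p = sum (λ i → w (inject₁ i) * x (inject₁ i) (grid p i))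

        C : Fin (suc m) → Carrier
        C p = w last ⁻¹ * B p

        X : Fin (s last) → Carrier
        X = x last

        full : Fin (suc m) → Fin (s last) → ∀ i → Fin (s i)
        full p a = snoc k {s} (grid p) a

        full-sum : ∀ p a → sum (λ i → w i * x i (full p a i)) ≡ B p + w last * X a
        full-sum p a = trans (sum-init-last (λ i → w i * x i (full p a i)))
          (cong₂ _+_ (sum-cong-≗ (λ i → cong (λ b → w (inject₁ i) * x (inject₁ i) b) (snoc-inject₁ k {s} (grid p) a i)))
            (cong (λ b → w last * X b) (snoc-fromℕ k {s} (grid p) a)))

        Y : Fin (suc m) → Carrier
        Y p = prod (λ i → y (inject₁ i) (grid p i))

        full-prod : ∀ p a → prod (λ i → y i (full p a i)) ≡ Y p * y last a
        full-prod p a = trans (prod-init-last (λ i → y i (full p a i)))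
          (cong₂ _*_ (prod-cong (λ i → cong (y (inject₁ i)) (snoc-inject₁ k {s} (grid p) a i)))
            (cong (y last) (snoc-fromℕ k {s} (grid p) a)))

        label-C : ∀ p → label (C p) ≡ l₀
        label-C p = trans (cong (λ v → label (w last ⁻¹ * v)) (sym (begin
            sum (λ i → w i * x i (full p a i)) + w last * X (full p a last)
              ≡⟨ cong₂ _+_ (full-sum p a) (cong (λ b → w last * X b) (snoc-fromℕ k {s} (grid p) a)) ⟩
            B p + w last * X a + w last * X a
              ≡⟨ solve 2 (λ b c → b :+ c :+ c := b) refl (B p) (w last * X a) ⟩
            B p ∎))) (labelled (full p a))
          where a = base last

        -- Equal sums give a relation among the `w` with vanishing last coefficient. By independence
        -- the two choices have the same points, and by `x-injective` the same vertices.
        C-injective : ∀ {p p'} → C p ≡ C p' → p ≡ p'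
        C-injective {p} {p'} eq = Fin.toℕ-injective (trans (sym (Fin.toℕ-cast P≡ p)) (trans (cong Fin.toℕ
            (selection-injective k {λ i → s (inject₁ i)} (λ i → x-injective (inject₁ i) (x+y≈0⇒x≈y (differences i)))))
            (Fin.toℕ-cast P≡ p')))
          where
          equal-B : B p ≡ B p'
          equal-B = cancelˡ (⁻¹-nonzero (w≢0 last)) eq
          z : Fin d → Carrier
          z i = x i (full p (base last) i) + x i (full p' (base last) i)
          z-sum : sum (λ i → w i * z i) ≡ 0#
          z-sum = begin
            sum (λ i → w i * z i)
              ≡⟨ sum-cong-≗ (λ i → distribˡ (w i) (x i (full p (base last) i)) (x i (full p' (base last) i))) ⟩
            sum (λ i → w i * x i (full p (base last) i) + w i * x i (full p' (base last) i))
              ≡⟨ ∑-distrib-+ (λ i → w i * x i (full p (base last) i)) (λ i → w i * x i (full p' (base last) i)) ⟩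
            sum (λ i → w i * x i (full p (base last) i)) + sum (λ i → w i * x i (full p' (base last) i))
              ≡⟨ cong₂ _+_ (full-sum p (base last)) (full-sum p' (base last)) ⟩
            (B p + w last * X (base last)) + (B p' + w last * X (base last))
              ≡⟨ cong (λ b → (b + w last * X (base last)) + (B p' + w last * X (base last))) equal-B ⟩
            (B p' + w last * X (base last)) + (B p' + w last * X (base last))
              ≡⟨ char2 _ ⟩
            0# ∎
          differences : ∀ i → x (inject₁ i) (grid p i) + x (inject₁ i) (grid p' i) ≡ 0#
          differences i = trans (cong₂ (λ a b → x (inject₁ i) a + x (inject₁ i) b)
              (sym (snoc-inject₁ k {s} (grid p) (base last) i)) (sym (snoc-inject₁ k {s} (grid p') (base last) i)))
            (w-independent z last
              (λ i → trans (frobenius-+ Q-pow _ _) (cong₂ _+_ (x-fixed i _) (x-fixed i _)))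
              (trans (cong₂ (λ a b → X a + X b) (snoc-fromℕ k {s} (grid p) (base last)) (snoc-fromℕ k {s} (grid p') (base last))) (char2 _))
              z-sum (inject₁ i))

        roots : ℕ → Fin (suc m) → List Carrier
        roots l p = map (_^ (q ℕ.^ l)) (conjugates k (C p))

        -- A common root would make `C p` and `C p'` conjugate; having the same label, they would be
        -- equal.
        disjoint : ∀ l {p p' ρ} → p ≢ p' → ρ ∈ roots l p → ρ ∉ roots l p'
        disjoint l {p} {p'} p≢p' ρ∈ ρ∈'
          with v , v∈ , refl ← ∈-map⁻ (_^ (q ℕ.^ l)) ρ∈
          with v' , v'∈ , eq ← ∈-map⁻ (_^ (q ℕ.^ l)) ρ∈'
          with a , refl ← ∈-conjugates k v∈
          with b , refl ← ∈-conjugates k v'∈ =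
          p≢p' (C-injective (label-conjugate a b (trans (label-C p) (sym (label-C p')))
            (frobenius-injective (powerOfTwo-^ q-pow l) eq)))

        nw : Carrier
        nw = norm (w last)

        nw≢0 : nw ≢ 0#
        nw≢0 = ^-nonzero exponent (w≢0 last)

        equations : ∀ p a → norm (X a + C p) ≡ nw ⁻¹ * Y p * y last a
        equations p a = begin
          norm (X a + C p) ≡⟨ *-identityˡ _ ⟨
          1# * norm (X a + C p) ≡⟨ cong (_* norm (X a + C p)) (trans (*-comm _ _) (inverseʳ nw≢0)) ⟨
          nw ⁻¹ * nw * norm (X a + C p) ≡⟨ *-assoc _ _ _ ⟩
          nw ⁻¹ * (nw * norm (X a + C p)) ≡⟨ cong (nw ⁻¹ *_) (norm-* (w last) (X a + C p)) ⟨
          nw ⁻¹ * norm (w last * (X a + C p)) ≡⟨ cong (λ v → nw ⁻¹ * norm v) inner ⟩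
          nw ⁻¹ * norm (sum (λ i → w i * x i (full p a i))) ≡⟨ cong (nw ⁻¹ *_) (trans (edge (full p a)) (full-prod p a)) ⟩
          nw ⁻¹ * (Y p * y last a) ≡⟨ *-assoc _ _ _ ⟨
          nw ⁻¹ * Y p * y last a ∎
          where
          inner : w last * (X a + C p) ≡ sum (λ i → w i * x i (full p a i))
          inner = begin
            w last * (X a + w last ⁻¹ * B p)
              ≡⟨ solve 4 (λ w x v b → w :* (x :+ v :* b) := w :* v :* b :+ w :* x) refl (w last) (X a) (w last ⁻¹) (B p) ⟩
            w last * w last ⁻¹ * B p + w last * X a
              ≡⟨ cong (λ v → v * B p + w last * X a) (inverseʳ (w≢0 last)) ⟩
            1# * B p + w last * X a ≡⟨ cong (_+ w last * X a) (*-identityˡ _) ⟩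
            B p + w last * X a ≡⟨ full-sum p a ⟨
            sum (λ i → w i * x i (full p a i)) ∎

      grid-contradiction : k ℕ.* SolutionCount.dimension field₂ k t ℕ.< s last → ⊥
      grid-contradiction = SolutionCount.tooManySolutions field₂ {s last} {k} {t} (s≤s z≤n)
        (λ l a → X a ^ (q ℕ.^ l)) roots
        (λ l p → trans (length-map _ (conjugates k (C p))) (length-conjugates k (C p)))
        disjoint
        (λ {a} {b} eq → x-injective last (trans (sym (*-identityʳ _)) (trans eq (*-identityʳ _))))
        (λ p → nw ⁻¹ * Y p) (y last)
        (λ p → noZeroDivisors (⁻¹-nonzero nw≢0) (prod-nonzero _ (λ i → y≢0 (inject₁ i) (grid p i)))) (y≢0 last)
        (λ p a → trans (sym (norm-factors q-pow Q-pow X (x-fixed last) C t p a))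
          (trans (^-assocʳ (X a + C p) H (geometric q m)) (equations p a)))

-- The hypergraph

transversal : ∀ d {A} → (Fin d → Fin A) → Subset (d ℕ.* A)
transversal zero w = []
transversal (suc d) w = ⁅ w zero ⁆ ++ᵥ transversal d (λ c → w (suc c))

card-++ : ∀ {m n} (p : Subset m) (p' : Subset n) → card (p ++ᵥ p') ≡ card p ℕ.+ card p'
card-++ [] p' = refl
card-++ (inside ∷ p) p' = cong suc (card-++ p p')
card-++ (outside ∷ p) p' = card-++ p p'

card-transversal : ∀ d {A} (w : Fin d → Fin A) → card (transversal d w) ≡ d
card-transversal zero w = refl
card-transversal (suc d) w = trans (card-++ ⁅ w zero ⁆ (transversal d (λ c → w (suc c))))
  (cong₂ ℕ._+_ (∣⁅x⁆∣≡1 (w zero)) (card-transversal d (λ c → w (suc c))))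

combine∈transversal : ∀ d {A} (w : Fin d → Fin A) c → combine c (w c) ∈ₛ transversal d w
combine∈transversal (suc d) w zero = lookup⇒[]= _ _ (trans (lookup-++ˡ ⁅ w zero ⁆ _ (w zero)) ([]=⇒lookup (x∈⁅x⁆ (w zero))))
combine∈transversal (suc d) {A} w (suc c) = lookup⇒[]= _ _
  (trans (lookup-++ʳ ⁅ w zero ⁆ (transversal d (λ c → w (suc c))) (combine c (w (suc c))))
    ([]=⇒lookup (combine∈transversal d (λ c → w (suc c)) c)))

∈transversal⇒ : ∀ d {A} (w : Fin d → Fin A) c {a} → combine c a ∈ₛ transversal d w → w c ≡ a
∈transversal⇒ (suc d) w zero {a} a∈ = sym (x∈⁅y⁆⇒x≡y (w zero)
  (lookup⇒[]= a ⁅ w zero ⁆ (trans (sym (lookup-++ˡ ⁅ w zero ⁆ (transversal d (λ c → w (suc c))) a)) ([]=⇒lookup a∈))))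
∈transversal⇒ (suc d) w (suc c) {a} a∈ = ∈transversal⇒ d (λ c → w (suc c)) c
  (lookup⇒[]= (combine c a) (transversal d (λ c → w (suc c)))
    (trans (sym (lookup-++ʳ ⁅ w zero ⁆ (transversal d (λ c → w (suc c))) (combine c a))) ([]=⇒lookup a∈)))

transversal-injective : ∀ d {A} {w w' : Fin d → Fin A} → transversal d w ≡ transversal d w' → ∀ c → w c ≡ w' c
transversal-injective d {w = w} {w'} eq c = sym (∈transversal⇒ d w' c (subst (combine c (w c) ∈ₛ_) eq (combine∈transversal d w c)))

maximum : ∀ n (g : Fin (suc n) → ℕ) → ∃ λ i → ∀ j → g j ℕ.≤ g i
maximum zero g = zero , λ { zero → ℕ.≤-refl }
maximum (suc n) g with i , max ← maximum n (λ j → g (suc j)) with ℕ.≤-total (g (suc i)) (g zero)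
... | inj₁ le = zero , λ { zero → ℕ.≤-refl ; (suc j) → ℕ.≤-trans (max j) le }
... | inj₂ le = suc i , λ { zero → le ; (suc j) → max j }

module Pigeonhole {A : Set} where
  open import Algebra.Properties.CommutativeMonoid.Sum ℕ.+-0-commutativeMonoid
    using (sum; sum-cong-≗; sum-remove; ∑-distrib-+; sum-replicate-zero)

  private
    sum-≤ : ∀ n (g : Fin n → ℕ) {M} → (∀ i → g i ℕ.≤ M) → sum g ℕ.≤ n ℕ.* M
    sum-≤ zero g _ = z≤n
    sum-≤ (suc n) g le = ℕ.+-mono-≤ (le zero) (sum-≤ n (λ i → g (suc i)) (λ i → le (suc i)))

    module _ {n : ℕ} (f : A → Fin (suc n)) where
      class : List A → Fin (suc n) → List A
      class xs l = filter (λ a → f a Fin.≟ l) xs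

      indicator : A → Fin (suc n) → ℕ
      indicator a l with f a Fin.≟ l
      ... | yes _ = 1
      ... | no _ = 0

      class-∷ : ∀ a xs l → length (class (a ∷ xs) l) ≡ indicator a l ℕ.+ length (class xs l)
      class-∷ a xs l with f a Fin.≟ l
      ... | yes _ = refl
      ... | no _ = refl

      indicator-hit : ∀ a → indicator a (f a) ≡ 1
      indicator-hit a with f a Fin.≟ f a
      ... | yes _ = refl
      ... | no ne = ⊥-elim (ne refl)

      indicator-miss : ∀ a l → f a ≢ l → indicator a l ≡ 0
      indicator-miss a l ne with f a Fin.≟ l
      ... | yes eq = ⊥-elim (ne eq)
      ... | no _ = refl

      sum-indicator : ∀ a → sum (indicator a) ≡ 1
      sum-indicator a = trans (sum-remove {i = f a} (indicator a)) (cong₂ ℕ._+_ (indicator-hit a)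
        (trans (sum-cong-≗ (λ j → indicator-miss a (punchIn (f a) j) (λ eq → Fin.punchInᵢ≢i (f a) j (sym eq)))) (sum-replicate-zero n)))

      sum-classes : ∀ xs → sum (λ l → length (class xs l)) ≡ length xs
      sum-classes [] = sum-replicate-zero (suc n)
      sum-classes (a ∷ xs) = trans (sum-cong-≗ (class-∷ a xs)) (trans (∑-distrib-+ (indicator a) (λ l → length (class xs l)))
        (cong₂ ℕ._+_ (sum-indicator a) (sum-classes xs)))

  popular : ∀ {n} (f : A → Fin (suc n)) xs → ∃ λ l → length xs ℕ.≤ suc n ℕ.* length (filter (λ a → f a Fin.≟ l) xs)
  popular {n} f xs with l , max ← maximum n (λ l → length (class f xs l)) =
    l , ℕ.≤-trans (ℕ.≤-reflexive (sym (sum-classes f xs))) (sum-≤ (suc n) (λ l → length (class f xs l)) max)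

  -- The `d` labels are fixed one after the other, each at the cost of a factor `suc n`.
  popularAll : ∀ {n} d (f : Fin d → A → Fin (suc n)) (xs : List A) → Unique xs →
    ∃ λ (l : Fin d → Fin (suc n)) → ∃ λ (ys : List A) → Unique ys × All (λ a → ∀ c → f c a ≡ l c) ys ×
      length xs ℕ.≤ suc n ℕ.^ d ℕ.* length ys
  popularAll zero f xs u = (λ ()) , xs , u , All.universal (λ _ ()) xs , ℕ.≤-reflexive (sym (ℕ.+-identityʳ _))
  popularAll {n} (suc d) f xs u
    with l , ys , uys , all , le ← popularAll d (λ c → f (suc c)) xs u
    with l₀ , le₀ ← popular (f zero) ys =
    (λ { zero → l₀ ; (suc c) → l c }) , filter P? ys , Unique.filter⁺ P? uys ,
    All.zipWith (λ { (p , ps) → λ { zero → p ; (suc c) → ps c } }) (All.all-filter P? ys , All.filter⁺ P? all) ,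
    ℕ.≤-trans le (ℕ.≤-trans (ℕ.*-monoʳ-≤ (suc n ℕ.^ d) le₀) (ℕ.≤-reflexive (trans (sym (ℕ.*-assoc (suc n ℕ.^ d) (suc n) _))
      (cong (ℕ._* length (filter P? ys)) (ℕ.*-comm (suc n ℕ.^ d) (suc n))))))
    where
    P? : ∀ a → Dec (f zero a ≡ l₀)
    P? a = f zero a Fin.≟ l₀

-- If `g (π i)` differs from `i`, then `i` is not in the image of `g`, and the injective map `g`
-- would send `Fin d` into a set with one element less.
surjective⇒injective : ∀ {d} (π g : Fin d → Fin d) → (∀ c → π (g c) ≡ c) → ∀ i → g (π i) ≡ i
surjective⇒injective {suc d} π g inv i with g (π i) Fin.≟ i
... | yes eq = eq
... | no ne = let a , b , a<b , eq = Fin.pigeonhole {d} {suc d} ℕ.≤-refl (λ c → punchOut (missed c)) in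
  ⊥-elim (Fin.<-irrefl (trans (sym (inv a)) (trans (cong π (Fin.punchOut-injective (missed a) (missed b) eq)) (inv b))) a<b)
  where
  missed : ∀ c → i ≢ g c
  missed c i≡gc = ne (trans (cong g (trans (cong π i≡gc) (inv c))) (sym i≡gc))

-- The classes of a copy may occupy the parts in any order, recorded by `π`. Indexing by classes
-- keeps the size condition on the last class, wherever that lies.
record Alignment (d A : ℕ) (s : Fin d → ℕ) (Good : (Fin d → Fin A) → Set) : Set where
  field
    π π⁻¹ : Fin d → Fin d
    invʳ : ∀ c → π (π⁻¹ c) ≡ c
    invˡ : ∀ i → π⁻¹ (π i) ≡ i
    elem : ∀ i → Fin (s i) → Fin A
    elem-injective : ∀ i {a b} → elem i a ≡ elem i b → a ≡ b
    tupleOf : ∀ (a : ∀ i → Fin (s i)) → ∃ λ w → Good w × (∀ i → w (π i) ≡ elem i (a i))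

-- Changing one vertex of an edge of the copy keeps the other d - 1 parts occupied, so each
-- class of the copy lies in a single part.
module _ {d A : ℕ} {s : Fin d → ℕ} {Good : (Fin d → Fin A) → Set} (H : UniformHypergraph d (d ℕ.* A))
  (partite : ∀ {S} → S ∈ edges H → ∃ λ w → S ≡ transversal d w × Good w)
  (base : ∀ i → Fin (s i)) (copy : ContainsCompletePartite s H) where

  private
    f : ∀ i → Fin (s i) → Fin (d ℕ.* A)
    f = proj₁ copy

    part : Fin (d ℕ.* A) → Fin d
    part v = proj₁ (remQuot {d} A v)

    element : Fin (d ℕ.* A) → Fin A
    element v = proj₂ (remQuot {d} A v)

    edgeOf : ∀ (a : ∀ i → Fin (s i)) → ∃ λ w → Good w ×
      (∀ i → w (part (f i (a i))) ≡ element (f i (a i))) × (∀ c → ∃ λ i → part (f i (a i)) ≡ c)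
    edgeOf a with S , S∈ , mem ← proj₂ (proj₂ copy) a with w , refl , good ← partite S∈ =
      w , good ,
      (λ i → ∈transversal⇒ d w (part (f i (a i)))
        (subst (_∈ₛ transversal d w) (sym (Fin.combine-remQuot {d} A (f i (a i)))) (Equivalence.from (mem (f i (a i))) (i , refl)))) ,
      (λ c → let i , eq = Equivalence.to (mem (combine c (w c))) (combine∈transversal d w c)
             in i , trans (cong part eq) (cong proj₁ (Fin.remQuot-combine c (w c))))

    π π⁻¹ : Fin d → Fin d
    π i = part (f i (base i))
    π⁻¹ c = proj₁ (proj₂ (proj₂ (proj₂ (edgeOf base))) c)

    invʳ : ∀ c → π (π⁻¹ c) ≡ c
    invʳ c = proj₂ (proj₂ (proj₂ (proj₂ (edgeOf base))) c)

    invˡ : ∀ i → π⁻¹ (π i) ≡ i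
    invˡ = surjective⇒injective π π⁻¹ invʳ

    aligned : ∀ i a → part (f i a) ≡ π i
    aligned i a with proj₂ (proj₂ (proj₂ (edgeOf (update base i a)))) (π i)
    ... | j , eq with i Fin.≟ j
    ...   | yes refl = eq
    ...   | no i≢j = ⊥-elim (i≢j (trans (sym (invˡ i)) (trans (cong π⁻¹ (sym eq)) (invˡ j))))

    element-injective : ∀ i {a b} → element (f i a) ≡ element (f i b) → a ≡ b
    element-injective i {a} {b} eq
      with proj₁ (proj₂ copy) i i a b (remQuot-injective A (trans (aligned i a) (sym (aligned i b))) eq)
    ... | refl , a≡b = a≡b

  alignment : Alignment d A s Good
  alignment = record
    { π = π ; π⁻¹ = π⁻¹ ; invʳ = invʳ ; invˡ = invˡ
    ; elem = λ i a → element (f i a)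
    ; elem-injective = element-injective
    ; tupleOf = λ a → let w , good , eq , _ = edgeOf a in
        w , good , λ i → trans (cong w (sym (aligned i (a i)))) (eq i) }

-- Edges, labels and the edge count

module NormHypergraph {e : ℕ} (L : CyclicField e) (k₁ q₂ Q₁ t : ℕ) where
  open CyclicField L
  open FieldTools L
  open NormGeometry L k₁ q₂ Q₁ t

  A : ℕ
  A = Q ℕ.* q₁

  module _ (q-pow : PowerOfTwo q) (Q≡q^m : Q ≡ q ℕ.^ m) (Q^k≡ : Q ℕ.^ k ≡ suc e) (Q≥3 : 3 ℕ.≤ Q) where

    private
      label′ : Carrier → Fin k
      label′ = label q-pow Q≡q^m Q^k≡ Q≥3
      point : Fin Q → Carrier
      point = subfield q-pow Q≡q^m Q^k≡ Q≥3
      unit′ : Fin q₁ → Carrier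
      unit′ = unit q-pow Q≡q^m Q^k≡ Q≥3

    xv yv : Fin A → Carrier
    xv a = point (proj₁ (remQuot {Q} q₁ a))
    yv a = unit′ (proj₂ (remQuot {Q} q₁ a))

    total : (Fin d → Fin A) → Carrier
    total w = sum (λ c → ω c * xv (w c))

    Edge : (Fin d → Fin A) → Set
    Edge w = norm (total w) ≡ prod (λ c → yv (w c))

    -- The added term cancels in characteristic 2, leaving the sum over the other parts, divided by
    -- `ω c`. This is the element `C` of the norm equations when the large class lies in part `c`.
    apex : Fin d → (Fin d → Fin A) → Carrier
    apex c w = ω c ⁻¹ * (total w + ω c * xv (w c))

    private
      tailSum : (Fin k → Fin A) → Carrier
      tailSum v = sum (λ i → ω (suc i) * xv (v i))

      abstract
        -- A zero sum has norm zero and gives no edge. At most one first point is lost in this way;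
        -- one is always discarded, so that every prefix has exactly `Q₁` extensions.
        vanishing : ∀ v → ∃ λ a₀ → ∀ a → a ≢ a₀ → ω zero * point a + tailSum v ≢ 0#
        vanishing v with Fin.any? (λ a → (ω zero * point a + tailSum v) ≟ 0#)
        ... | no none = zero , λ a _ eq → none (a , eq)
        ... | yes (a₀ , eq₀) = a₀ , λ a a≢a₀ eq → a≢a₀ (subfield-injective q-pow Q≡q^m Q^k≡ Q≥3
               (cancelˡ (ω-nonzero q-pow Q≡q^m Q^k≡ Q≥3 zero) (trans (x+y≈0⇒x≈y eq) (sym (x+y≈0⇒x≈y eq₀)))))

      firstPoint : (Fin k → Fin A) → Fin Q₁ → Fin Q
      firstPoint v j = punchIn (proj₁ (vanishing v)) j

      abstract
        firstUnit : ∀ v j → ∃ λ b → norm (ω zero * point (firstPoint v j) + tailSum v) ≡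
         unit′ b * prod (λ i → yv (v i))
        firstUnit v j = solveUnit q-pow Q≡q^m Q^k≡ Q≥3 (λ i → proj₂ (remQuot {Q} q₁ (v i)))
         (proj₂ (vanishing v) (firstPoint v j) (Fin.punchInᵢ≢i (proj₁ (vanishing v)) j))

      extend : (Fin k → Fin A) → Fin Q₁ → Fin d → Fin A
      extend v j zero = combine (firstPoint v j) (proj₁ (firstUnit v j))
      extend v j (suc i) = v i

      xv-combine : ∀ a b → xv (combine a b) ≡ point a
      xv-combine a b = cong (λ p → point (proj₁ p)) (Fin.remQuot-combine a b)

      yv-combine : ∀ a b → yv (combine {Q} a b) ≡ unit′ b
      yv-combine a b = cong (λ p → unit′ (proj₂ p)) (Fin.remQuot-combine {Q} a b)

      extend-edge : ∀ v j → Edge (extend v j)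
      extend-edge v j = trans
        (cong (λ u → norm (ω zero * u + tailSum v)) (xv-combine (firstPoint v j) (proj₁ (firstUnit v j))))
        (trans (proj₂ (firstUnit v j))
          (cong (_* prod (λ i → yv (v i))) (sym (yv-combine (firstPoint v j) (proj₁ (firstUnit v j))))))

      extend-injective : ∀ {v v' j j'} → v ≡ v' → extend v j zero ≡ extend v' j' zero → j ≡ j'
      extend-injective {v} refl eq = Fin.punchIn-injective (proj₁ (vanishing v)) _ _ (proj₁ (Fin.combine-injective _ _ _ _ eq))

    prefixes : ℕ
    prefixes = prodFin k (λ _ → A)

    Index : Set
    Index = Fin (prefixes ℕ.* Q₁)

    abstract
      tuple : Index → Fin d → Fin A
      tuple τ = extend (selection k (proj₁ (remQuot {prefixes} Q₁ τ))) (proj₂ (remQuot {prefixes} Q₁ τ))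

      tuple-edge : ∀ τ → Edge (tuple τ)
      tuple-edge τ = extend-edge (selection k (proj₁ (remQuot {prefixes} Q₁ τ))) (proj₂ (remQuot {prefixes} Q₁ τ))

      tuple-injective : ∀ {τ τ'} → (∀ c → tuple τ c ≡ tuple τ' c) → τ ≡ τ'
      tuple-injective {τ} {τ'} eq = remQuot-injective Q₁ same
        (extend-injective (cong (selection k) same) (eq zero))
        where
        same : proj₁ (remQuot {prefixes} Q₁ τ) ≡ proj₁ (remQuot {prefixes} Q₁ τ')
        same = selection-injective k {λ _ → A} (λ i → eq (suc i))

    private
      abstract
        chosen : ∃ λ (l : Fin d → Fin k) → ∃ λ (τs : List Index) → Unique τs ×
          All (λ τ → ∀ c → label′ (apex c (tuple τ)) ≡ l c) τs × length (allFin (prefixes ℕ.* Q₁)) ℕ.≤ k ℕ.^ d ℕ.* length τs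
        chosen = Pigeonhole.popularAll d (λ c τ → label′ (apex c (tuple τ))) (allFin (prefixes ℕ.* Q₁)) (Unique.allFin⁺ _)
      labels : Fin d → Fin k
      labels = proj₁ chosen
      indices : List Index
      indices = proj₁ (proj₂ chosen)
      indices-labelled : All (λ τ → ∀ c → label′ (apex c (tuple τ)) ≡ labels c) indices
      indices-labelled = proj₁ (proj₂ (proj₂ (proj₂ chosen)))

    hypergraph : UniformHypergraph d (d ℕ.* A)
    hypergraph = record
      { edges = map (λ τ → transversal d (tuple τ)) indices
      ; distinct = Unique.map⁺ (λ eq → tuple-injective (transversal-injective d eq)) (proj₁ (proj₂ (proj₂ chosen)))
      ; uniform = All.map⁺ (All.universal (λ τ → card-transversal d (tuple τ)) indices) }

    numEdges-≥ : prefixes ℕ.* Q₁ ℕ.≤ k ℕ.^ d ℕ.* numEdges hypergraph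
    numEdges-≥ = ℕ.≤-trans (ℕ.≤-reflexive (sym (length-tabulate (λ i → i))))
      (ℕ.≤-trans (proj₂ (proj₂ (proj₂ (proj₂ chosen))))
        (ℕ.≤-reflexive (cong (k ℕ.^ d ℕ.*_) (sym (length-map (λ τ → transversal d (tuple τ)) indices)))))

    Good : (Fin d → Fin A) → Set
    Good w = Edge w × (∀ c → label′ (apex c w) ≡ labels c)

    partite : ∀ {S} → S ∈ edges hypergraph → ∃ λ w → S ≡ transversal d w × Good w
    partite S∈ = let τ , τ∈ , eq = ∈-map⁻ (λ τ → transversal d (tuple τ)) S∈ in
      tuple τ , eq , tuple-edge τ , All.lookup indices-labelled τ∈

    module _ {s : Fin d → ℕ} (base : ∀ i → Fin (s i)) (al : Alignment d A s Good) where
      open Alignment al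

      private
        Selection : Set
        Selection = ∀ i → Fin (s i)

        w : Selection → Fin d → Fin A
        w a = proj₁ (tupleOf a)

        w-π : ∀ a i → w a (π i) ≡ elem i (a i)
        w-π a = proj₂ (proj₂ (tupleOf a))

        x y : ∀ i → Fin (s i) → Carrier
        x i a = xv (elem i a)
        y i a = yv (elem i a)

        total-π : ∀ (a : Selection) → total (w a) ≡ sum (λ i → ω (π i) * x i (a i))
        total-π a = sum-reindex q-pow Q≡q^m Q^k≡ Q≥3 π π⁻¹ invʳ invˡ
          (λ c → ω c * xv (w a c)) (λ i → ω (π i) * x i (a i))
          (λ i → cong (λ b → ω (π i) * xv b) (w-π a i))

        edge-π : ∀ (a : Selection) → norm (sum (λ i → ω (π i) * x i (a i))) ≡ prod (λ i → y i (a i))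
        edge-π a = trans (cong norm (sym (total-π a))) (trans (proj₁ (proj₁ (proj₂ (tupleOf a))))
          (prod-reindex q-pow Q≡q^m Q^k≡ Q≥3 π π⁻¹ invʳ invˡ
            (λ c → yv (w a c)) (λ i → y i (a i)) (λ i → cong yv (w-π a i))))

        labelled-π : ∀ (a : Selection) → label′ (ω (π (fromℕ k)) ⁻¹ *
          (sum (λ i → ω (π i) * x i (a i)) + ω (π (fromℕ k)) * x (fromℕ k) (a (fromℕ k)))) ≡ labels (π (fromℕ k))
        labelled-π a = trans (cong₂ (λ T b → label′ (ω (π (fromℕ k)) ⁻¹ * (T + ω (π (fromℕ k)) * xv b)))
            (sym (total-π a)) (sym (w-π a (fromℕ k))))
          (proj₂ (proj₁ (proj₂ (tupleOf a))) (π (fromℕ k)))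

        xy-injective : ∀ i {a b} → x i a ≡ x i b → y i a ≡ y i b → a ≡ b
        xy-injective i {a} {b} ex ey = elem-injective i
          (remQuot-injective q₁ (subfield-injective q-pow Q≡q^m Q^k≡ Q≥3 ex) (unit-injective q-pow Q≡q^m Q^k≡ Q≥3 ey))

      impossible : suc m ≡ prodFin k (λ i → s (inject₁ i)) → k ℕ.* SolutionCount.dimension field₂ k t ℕ.< s (fromℕ k) → ⊥
      impossible P≡ = grid-contradiction q-pow Q≡q^m Q^k≡ Q≥3 P≡ (λ i → ω (π i))
        (λ i → ω-nonzero q-pow Q≡q^m Q^k≡ Q≥3 (π i))
        (independent-permute q-pow Q≡q^m Q^k≡ Q≥3 {ω} π π⁻¹ invʳ invˡ (ω-independent q-pow Q≡q^m Q^k≡ Q≥3))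
        x y (λ i a → subfield-fixed q-pow Q≡q^m Q^k≡ Q≥3 (proj₁ (remQuot {Q} q₁ (elem i a))))
        (λ i a → unit-nonzero q-pow Q≡q^m Q^k≡ Q≥3 (proj₂ (remQuot {Q} q₁ (elem i a))))
        xy-injective base edge-π (labels (π (fromℕ k))) labelled-π

-- The edge count in terms of the number of vertices

open import Data.Nat using (_*_; _∸_; _^_; _≤_; _+_)

prodFin-const : ∀ k A → prodFin k (λ _ → A) ≡ A ^ k
prodFin-const zero A = refl
prodFin-const (suc k) A = cong (A *_) (prodFin-const k A)

prodFin-positive : ∀ k (s : Fin k → ℕ) → (∀ i → 2 ≤ s i) → 1 ≤ prodFin k s
prodFin-positive zero s _ = s≤s z≤n
prodFin-positive (suc k) s le = ℕ.*-mono-≤ (ℕ.≤-trans (s≤s z≤n) (le zero)) (prodFin-positive k (λ i → s (suc i)) (λ i → le (suc i)))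

^-distrib-* : ∀ a b n → (a * b) ^ n ≡ a ^ n * b ^ n
^-distrib-* a b zero = refl
^-distrib-* a b (suc n) = trans (cong (a * b *_) (^-distrib-* a b n))
  (ℕ.[m*n]*[o*p]≡[m*o]*[n*p] a b (a ^ n) (b ^ n))

-- Raising to the power `P = suc m` avoids fractional exponents, and `m + k * P` is `(k + 1) P - 1`.
-- The main point is `A ^ m ≤ Q ^ P`, because `A ≤ Q q` and `q ^ m = Q` for `q = suc q₁`. In the
-- constant, `suc d ^ suc k` accounts for the number of parts, `k ^ suc k` for the choice of labels,
-- and `2` for `Q ≤ 2 * Q₁`.
edgeBound : ∀ d k m q₁ Q₁ E → 1 ≤ Q₁ → suc Q₁ ≡ suc q₁ ^ m →
  (suc Q₁ * q₁) ^ k * Q₁ ≤ k ^ suc k * E →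
  (suc d * (suc Q₁ * q₁)) ^ (m + k * suc m) ≤ (suc d ^ suc k * (2 * k ^ suc k)) ^ suc m * E ^ suc m
edgeBound d k m q₁ Q₁ E Q₁≥1 Q≡ le = begin
  (suc d * A) ^ n
    ≡⟨ ^-distrib-* (suc d) A n ⟩
  suc d ^ n * A ^ n
    ≤⟨ ℕ.*-mono-≤ (ℕ.^-monoʳ-≤ (suc d) (ℕ.+-monoˡ-≤ (k * P) (ℕ.n≤1+n m))) (ℕ.≤-reflexive (ℕ.^-distribˡ-+-* A m (k * P))) ⟩
  suc d ^ (suc k * P) * (A ^ m * A ^ (k * P))
    ≡⟨ cong₂ (λ a b → a * (A ^ m * b)) (sym (ℕ.^-*-assoc (suc d) (suc k) P)) (sym (ℕ.^-*-assoc A k P)) ⟩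
  (suc d ^ suc k) ^ P * (A ^ m * (A ^ k) ^ P)
    ≤⟨ ℕ.*-monoʳ-≤ ((suc d ^ suc k) ^ P) (ℕ.*-monoˡ-≤ ((A ^ k) ^ P) A^m≤Q^P) ⟩
  (suc d ^ suc k) ^ P * (Q ^ P * (A ^ k) ^ P)
    ≡⟨ cong ((suc d ^ suc k) ^ P *_) (sym (^-distrib-* Q (A ^ k) P)) ⟩
  (suc d ^ suc k) ^ P * (Q * A ^ k) ^ P
    ≤⟨ ℕ.*-monoʳ-≤ ((suc d ^ suc k) ^ P) (ℕ.^-monoˡ-≤ P step) ⟩
  (suc d ^ suc k) ^ P * (2 * k ^ suc k * E) ^ P
    ≡⟨ cong ((suc d ^ suc k) ^ P *_) (^-distrib-* (2 * k ^ suc k) E P) ⟩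
  (suc d ^ suc k) ^ P * ((2 * k ^ suc k) ^ P * E ^ P)
    ≡⟨ sym (ℕ.*-assoc ((suc d ^ suc k) ^ P) _ _) ⟩
  (suc d ^ suc k) ^ P * (2 * k ^ suc k) ^ P * E ^ P
    ≡⟨ cong (_* E ^ P) (sym (^-distrib-* (suc d ^ suc k) (2 * k ^ suc k) P)) ⟩
  (suc d ^ suc k * (2 * k ^ suc k)) ^ P * E ^ P ∎
  where
  open ℕ.≤-Reasoning
  P = suc m
  Q = suc Q₁
  A = Q * q₁
  n = m + k * P
  A^m≤Q^P : A ^ m ≤ Q ^ P
  A^m≤Q^P = begin
    A ^ m              ≡⟨ ^-distrib-* Q q₁ m ⟩
    Q ^ m * q₁ ^ m     ≤⟨ ℕ.*-monoʳ-≤ (Q ^ m) (ℕ.^-monoˡ-≤ m (ℕ.n≤1+n q₁)) ⟩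
    Q ^ m * suc q₁ ^ m ≡⟨ cong (Q ^ m *_) (sym Q≡) ⟩
    Q ^ m * Q          ≡⟨ ℕ.*-comm (Q ^ m) Q ⟩
    Q ^ P              ∎
  step : Q * A ^ k ≤ 2 * k ^ suc k * E
  step = begin
    Q * A ^ k             ≤⟨ ℕ.*-monoˡ-≤ (A ^ k) (ℕ.+-monoˡ-≤ Q₁ Q₁≥1) ⟩
    (Q₁ + Q₁) * A ^ k     ≡⟨ cong (_* A ^ k) (cong (Q₁ +_) (sym (ℕ.+-identityʳ Q₁))) ⟩
    2 * Q₁ * A ^ k        ≡⟨ trans (ℕ.*-assoc 2 Q₁ (A ^ k)) (cong (2 *_) (ℕ.*-comm Q₁ (A ^ k))) ⟩
    2 * (A ^ k * Q₁)      ≤⟨ ℕ.*-monoʳ-≤ 2 le ⟩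
    2 * (k ^ suc k * E)   ≡⟨ sym (ℕ.*-assoc 2 (k ^ suc k) E) ⟩
    2 * k ^ suc k * E     ∎

above : ∀ {a n} → a ≤ n → ∃ λ b → n ≡ a + b
above {a} {n} le = n ∸ a , sym (ℕ.m+[n∸m]≡n le)

n≤2^n : ∀ n → n ≤ 2 ^ n
n≤2^n zero = z≤n
n≤2^n (suc n) = ℕ.+-mono-≤ (ℕ.m^n>0 2 n) (ℕ.≤-trans (n≤2^n n) (ℕ.m≤m+n (2 ^ n) 0))

module _ {e : ℕ} (L : CyclicField e) (k₁ q₂ Q₁ t : ℕ) where
  open NormHypergraph L k₁ q₂ Q₁ t
  open FieldTools L using (PowerOfTwo)

  private
    k = suc k₁
    constant = suc k ^ suc k * (2 * k ^ suc k)

  normHypergraph-free : PowerOfTwo (2 + q₂) → suc Q₁ ≡ (2 + q₂) ^ suc t → suc Q₁ ^ k ≡ suc e → 3 ≤ suc Q₁ →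
    (s : Fin (suc k) → ℕ) → (∀ i → 2 ≤ s i) → prodFin k (λ i → s (inject₁ i)) ≡ 2 + t →
    (k * (prodFin k (λ i → s (inject₁ i)) ∸ 1)) ! + 1 ≤ s (fromℕ k) →
    Σ (UniformHypergraph (suc k) (suc k * (suc Q₁ * suc q₂))) λ H → ¬ ContainsCompletePartite s H ×
      (suc k * (suc Q₁ * suc q₂)) ^ (suc k * prodFin k (λ i → s (inject₁ i)) ∸ 1) ≤
      constant ^ prodFin k (λ i → s (inject₁ i)) * numEdges H ^ prodFin k (λ i → s (inject₁ i))
  normHypergraph-free q-pow Q≡ Q^k≡ Q≥3 s s≥2 P≡ big = H , free , count
    where
    H = hypergraph q-pow Q≡ Q^k≡ Q≥3

    base : ∀ i → Fin (s i)
    base i = Fin.fromℕ< (ℕ.≤-trans (s≤s z≤n) (s≥2 i))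

    free : ¬ ContainsCompletePartite s H
    free copy = impossible q-pow Q≡ Q^k≡ Q≥3 base
      (alignment H (partite q-pow Q≡ Q^k≡ Q≥3) base copy) (sym P≡)
      -- The `+ 1` in the size condition supplies the strict inequality.
      (ℕ.≤-trans (s≤s (SolutionCount.dimension≤factorial (CyclicField.field₂ L) k t (s≤s z≤n)))
        (ℕ.≤-trans (ℕ.≤-reflexive (sym (trans (cong (λ P → (k * (P ∸ 1)) ! + 1) P≡) (ℕ.+-comm _ 1)))) big))

    count : (suc k * A) ^ (suc k * prodFin k (λ i → s (inject₁ i)) ∸ 1) ≤
      constant ^ prodFin k (λ i → s (inject₁ i)) * numEdges H ^ prodFin k (λ i → s (inject₁ i))
    count = subst (λ P → (suc k * A) ^ (suc k * P ∸ 1) ≤ constant ^ P * numEdges H ^ P) (sym P≡)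
      (edgeBound k k (suc t) (suc q₂) Q₁ (numEdges H) (ℕ.≤-trans (s≤s z≤n) (ℕ.≤-pred Q≥3)) Q≡
        (subst (λ p → p * Q₁ ≤ k ^ suc k * numEdges H) (prodFin-const k A) (numEdges-≥ q-pow Q≡ Q^k≡ Q≥3)))

theorem1p2 : (k : ℕ) → 1 ≤ k → (s : Fin (suc k) → ℕ) → (∀ i → 2 ≤ s i) →
    (k * (prodFin k (λ i → s (inject₁ i)) ∸ 1)) ! + 1 ≤ s (fromℕ k) →
    Σ ℕ λ b → 1 ≤ b × (∀ M → Σ ℕ λ N → M ≤ N × Σ (UniformHypergraph (suc k) N) λ H →
    ¬ ContainsCompletePartite s H ×
    N ^ (suc k * prodFin k (λ i → s (inject₁ i)) ∸ 1)
    ≤ b ^ prodFin k (λ i → s (inject₁ i)) * numEdges H ^ prodFin k (λ i → s (inject₁ i)))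
theorem1p2 k@(suc k₁) _ s s≥2 big
  -- The product is at least `2` because its first factor is. Writing it as `2 + t` gives
  -- `m = suc t`.
  with t , P≡ ← above (ℕ.*-mono-≤ (s≥2 zero) (prodFin-positive k₁ (λ i → s (inject₁ (suc i))) (λ i → s≥2 (inject₁ (suc i))))) =
  suc k ^ suc k * (2 * k ^ suc k) ,
  ℕ.*-mono-≤ (ℕ.m^n>0 (suc k) (suc k)) (ℕ.*-mono-≤ {1} {2} (s≤s z≤n) (ℕ.m^n>0 k (suc k))) ,
  λ M →
    -- The choice `q = 2 ^ (2 + M)` is at least `4`, which gives `Q ≥ 3`, and `q - 2 ≥ M` makes the
    -- number of vertices at least `M`.
    let q₂ , q≡ = above (ℕ.^-monoʳ-≤ 2 {1} {2 + M} (s≤s z≤n))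
        Q₃ , Q≡ = above {4} {(2 ^ (2 + M)) ^ suc t} (ℕ.≤-trans (ℕ.^-monoʳ-≤ 2 {2} {2 + M} (s≤s (s≤s z≤n)))
          (ℕ.m≤m*n (2 ^ (2 + M)) ((2 ^ (2 + M)) ^ t) ⦃ ℕ.m^n≢0 (2 ^ (2 + M)) t ⦃ ℕ.m^n≢0 2 (2 + M) ⦄ ⦄))
        e' , e≡ = above {2} {(4 + Q₃) ^ k} (ℕ.≤-trans (s≤s (s≤s z≤n)) (ℕ.m≤m*n (4 + Q₃) ((4 + Q₃) ^ k₁) ⦃ ℕ.m^n≢0 (4 + Q₃) k₁ ⦄))
        -- The field `L` has degree `(2 + M) m k` over the field with two elements.
        2^N≡ = trans (sym (ℕ.^-*-assoc 2 ((2 + M) * suc t) k))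
          (trans (cong (_^ k) (trans (sym (ℕ.^-*-assoc 2 (2 + M) (suc t))) Q≡)) e≡)
        M≤q₂ = ℕ.≤-pred (ℕ.≤-pred (ℕ.≤-trans (n≤2^n (2 + M)) (ℕ.≤-reflexive q≡)))
    in
    suc k * ((4 + Q₃) * suc q₂) ,
    ℕ.≤-trans (ℕ.m≤n⇒m≤1+n M≤q₂) (ℕ.≤-trans (ℕ.m≤n*m (suc q₂) (4 + Q₃)) (ℕ.m≤n*m ((4 + Q₃) * suc q₂) (suc k))) ,
    normHypergraph-free (Construction.cyclicField ((2 + M) * suc t * k) e' 2^N≡) k₁ q₂ (3 + Q₃) t
      (2 + M , sym q≡) (trans (sym Q≡) (cong (_^ suc t) q≡)) e≡ (s≤s (s≤s (s≤s z≤n))) s s≥2 P≡ big
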